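{- Let $k\ge 2$ be an integer and $\varepsilon\in(0,1)$. Let $X_1,\dots,X_k,D\in[1,\infty)$ with $D\le\min(X_1,\dots,X_k)$, let $\delta\in(0,1]$, and let $A_i\subset[X_i,2X_i]$ ($1\le i\le k$) be sets of integers such that $\gcd(a_1,\dots,a_k)\ge D$ for at least $\delta\prod_{i=1}^k|A_i|$ tuples $(a_1,\dots,a_k)\in\prod_{i=1}^kA_i$. Then $$\prod_{i=1}^k|A_i|\ll_{k,\varepsilon}\delta^{ -\frac{k}{k-1}}\,\frac{\prod_{i=1}^kX_i}{D^{k-\varepsilon}},$$ where the implied constant depends only on $k$ and $\varepsilon$. -}

module Defs where

open import Data.Nat.Base as ℕ using (ℕ; zero; suc)
open import Data.Nat.ListAction using (product)
open import Data.Nat.Properties as ℕ using ()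
open import Data.Integer.Base as ℤ using (ℤ; +_; 0ℤ)
open import Data.Integer.GCD using (gcd)
open import Data.Integer.Properties as ℤ using ()
open import Data.Rational.Base as ℚ using (ℚ; 0ℚ; 1ℚ; _/_; *≤*; *<*)
open import Data.Rational.Properties as ℚ using ()
open import Data.Rational.Unnormalised.Base as ℚᵘ using (mkℚᵘ)
open import Data.Rational.Unnormalised.Properties as ℚᵘ using ()
open import Data.Fin.Base using (Fin)
open import Data.List.Base using (List; length; tabulate)
open import Data.List.Relation.Unary.All using (All)
open import Data.List.Relation.Unary.Unique.Propositional using (Unique)
open import Data.Product.Base using (∃; _×_; _,_; proj₁; proj₂)
open import Data.Sum.Base using (_⊎_; inj₁; inj₂)
open import Data.Vec.Base as Vec using (Vec)
open import Data.Vec.Functional as Fun using ()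
open import Relation.Binary.PropositionalEquality using (_≡_; refl; sym; trans; cong; subst; subst₂)
open import Relation.Nullary.Decidable.Core using (yes; no)
open import Relation.Nullary.Negation.Core using (¬_; contradiction)
open import Algebra.Bundles using (CommutativeRing)

open import Algebra.Properties.Semiring.Exp (CommutativeRing.semiring ℚ.+-*-commutativeRing)
  using (^-assocʳ) renaming (_^_ to _^ℚ_)

infix  4 _<_ _≤_ _∈[_,_]
infixl 6 _-_
infixl 7 _*_ _÷_
infixr 8 _^_
infix  9 _⁻¹

-- Classical Dedekind cuts: x is identified with { q ∈ ℚ : q < x }.  The reals
-- are meant classically, so the existence of points inside and outside the cut
-- is asserted up to double negation and no locatedness is required; every
-- classical real is such a cut, and conversely.
record ℝ : Set₁ where
  field
    Below     : ℚ → Set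
    inhabited : ¬ ¬ ∃ λ q → Below q
    proper    : ¬ ¬ ∃ λ q → ¬ Below q
    downward  : ∀ {p q} → p ℚ.≤ q → Below q → Below p
    rounded   : ∀ {p} → Below p → ∃ λ q → p ℚ.< q × Below q

open ℝ

_<_ : ℝ → ℝ → Set
x < y = ∃ λ q → ¬ Below x q × Below y q

_≤_ : ℝ → ℝ → Set
x ≤ y = ¬ (y < x)

_∈[_,_] : ℝ → ℝ → ℝ → Set
x ∈[ l , u ] = l ≤ x × x ≤ u

p-1<p : ∀ p → p ℚ.- 1ℚ ℚ.< p
p-1<p p = subst (p ℚ.- 1ℚ ℚ.<_) (ℚ.+-identityʳ p) (ℚ.+-monoʳ-< p (ℚ.negative⁻¹ (ℚ.- 1ℚ)))

fromℚ : ℚ → ℝ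
fromℚ q = record
  { Below     = ℚ._< q
  ; inhabited = λ k → k (_ , p-1<p q)
  ; proper    = λ k → k (q , ℚ.<-irrefl refl)
  ; downward  = ℚ.≤-<-trans
  ; rounded   = λ p<q → let r , p<r , r<q = ℚ.<-dense p<q in r , p<r , r<q
  }

fromℤ : ℤ → ℝ
fromℤ i = fromℚ (i / 1)

fromℕ : ℕ → ℝ
fromℕ n = fromℤ (+ n)

0ℝ 1ℝ : ℝ
0ℝ = fromℕ 0
1ℝ = fromℕ 1

-- Every operation below is the supremum of a set of rationals.
sup : (S : ℚ → Set) → ¬ ¬ ∃ S → ¬ ¬ (∃ λ b → ∀ m → S m → m ℚ.≤ b) → ℝ
sup S inh bdd = record
  { Below     = λ q → ∃ λ m → S m × q ℚ.< m
  ; inhabited = λ k → inh λ (m , s) → k (_ , m , s , p-1<p m)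
  ; proper    = λ k → bdd λ (b , ub) → k (b , λ (m , s , b<m) → ℚ.<-irrefl refl (ℚ.<-≤-trans b<m (ub m s)))
  ; downward  = λ p≤q (m , s , q<m) → m , s , ℚ.≤-<-trans p≤q q<m
  ; rounded   = λ (m , s , p<m) → let r , p<r , r<m = ℚ.<-dense p<m in r , p<r , m , s , r<m
  }

below⇒≤ : ∀ x {q} → Below x q → fromℚ q ≤ x
below⇒≤ x bq (p , ¬bp , p<q) = ¬bp (downward x (ℚ.<⇒≤ p<q) bq)

above⇒≥ : ∀ x {q} → ¬ Below x q → x ≤ fromℚ q
above⇒≥ x ¬bq (p , p≮q , bp) = ¬bq (downward x (ℚ.≮⇒≥ p≮q) bp)

≤-via : ∀ x {p q} → fromℚ p ≤ x → x ≤ fromℚ q → p ℚ.≤ q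
≤-via x {p} {q} p≤x x≤q with p ℚ.≤? q
... | yes p≤q = p≤q
... | no  p≰q = contradiction ¬below below
  where
  d = ℚ.<-dense (ℚ.≰⇒> p≰q)
  r = proj₁ d
  below : ¬ ¬ Below x r
  below ¬b = p≤x (r , ¬b , proj₂ (proj₂ d))
  ¬below : ¬ Below x r
  ¬below b = x≤q (r , ℚ.<-asym (proj₁ (proj₂ d)) , b)

lower : ∀ x → ¬ ¬ ∃ λ q → fromℚ q ≤ x
lower x k = inhabited x λ (q , b) → k (q , below⇒≤ x b)

upper : ∀ x → ¬ ¬ ∃ λ q → x ≤ fromℚ q
upper x k = proper x λ (q , b) → k (q , above⇒≥ x b)

box : ∀ x → ¬ ¬ ∃ λ l → ∃ λ u → x ∈[ fromℚ l , fromℚ u ]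
box x k = lower x λ (l , p) → upper x λ (u , q) → k (l , u , p , q)

_-_ : ℝ → ℝ → ℝ
x - y = sup S
  (λ k → lower x λ (l , p) → upper y λ (u , q) → k (_ , l , u , p , q , refl))
  (λ k → upper x λ (b , p) → lower y λ (c , q) → k (b ℚ.- c , λ { _ (l , u , l≤x , y≤u , refl) →
    ℚ.+-mono-≤ (≤-via x l≤x p) (ℚ.neg-antimono-≤ (≤-via y q y≤u)) }))
  where
  S : ℚ → Set
  S m = ∃ λ l → ∃ λ u → fromℚ l ≤ x × y ≤ fromℚ u × m ≡ l ℚ.- u

between : ∀ a e b g {m} → a ℚ.≤ e → e ℚ.≤ b →
          m ℚ.≤ a ℚ.* g → m ℚ.≤ b ℚ.* g → m ℚ.≤ e ℚ.* g
between a e b g a≤e e≤b m≤ag m≤bg with ℚ.≤-total 0ℚ g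
... | inj₁ 0≤g = ℚ.≤-trans m≤ag (ℚ.*-monoʳ-≤-nonNeg g {{ℚ.nonNegative 0≤g}} a≤e)
... | inj₂ g≤0 = ℚ.≤-trans m≤bg (ℚ.*-monoʳ-≤-nonPos g {{ℚ.nonPositive g≤0}} e≤b)

p≤∣p∣ : ∀ p → p ℚ.≤ ℚ.∣ p ∣
p≤∣p∣ p with ℚ.≤-total 0ℚ p
... | inj₁ 0≤p = ℚ.≤-reflexive (sym (ℚ.0≤p⇒∣p∣≡p 0≤p))
... | inj₂ p≤0 = ℚ.≤-trans p≤0 (ℚ.0≤∣p∣ p)

∣∣-bound : ∀ a e b → a ℚ.≤ e → e ℚ.≤ b → ℚ.∣ e ∣ ℚ.≤ ℚ.∣ a ∣ ℚ.⊔ ℚ.∣ b ∣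
∣∣-bound a e b a≤e e≤b with ℚ.∣p∣≡p∨∣p∣≡-p e
... | inj₁ eq = subst (ℚ._≤ _) (sym eq) (ℚ.≤-trans e≤b (ℚ.≤-trans (p≤∣p∣ b) (ℚ.p≤q⊔p ℚ.∣ a ∣ ℚ.∣ b ∣)))
... | inj₂ eq = subst (ℚ._≤ _) (sym eq) (ℚ.≤-trans (ℚ.neg-antimono-≤ a≤e)
  (ℚ.≤-trans (p≤∣p∣ (ℚ.- a)) (ℚ.≤-trans (ℚ.≤-reflexive (ℚ.∣-p∣≡∣p∣ a)) (ℚ.p≤p⊔q ℚ.∣ a ∣ ℚ.∣ b ∣))))

*-bound : ∀ {e f K L} → ℚ.∣ e ∣ ℚ.≤ K → ℚ.∣ f ∣ ℚ.≤ L → e ℚ.* f ℚ.≤ K ℚ.* L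
*-bound {e} {f} {K} {L} e≤K f≤L = begin
  e ℚ.* f                 ≤⟨ p≤∣p∣ (e ℚ.* f) ⟩
  ℚ.∣ e ℚ.* f ∣           ≡⟨ ℚ.∣p*q∣≡∣p∣*∣q∣ e f ⟩
  ℚ.∣ e ∣ ℚ.* ℚ.∣ f ∣     ≤⟨ ℚ.*-monoʳ-≤-nonNeg ℚ.∣ f ∣ {{ℚ.∣-∣-nonNeg f}} e≤K ⟩
  K ℚ.* ℚ.∣ f ∣           ≤⟨ ℚ.*-monoˡ-≤-nonNeg K {{ℚ.nonNegative (ℚ.≤-trans (ℚ.0≤∣p∣ e) e≤K)}} f≤L ⟩
  K ℚ.* L                 ∎
  where open ℚ.≤-Reasoning

-- Interval arithmetic: m is a lower bound for xy when it is at most the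
-- product at each corner of some rational box containing (x , y).
_*_ : ℝ → ℝ → ℝ
x * y = sup S inh bdd
  where
  S : ℚ → Set
  S m = ∃ λ a → ∃ λ b → ∃ λ c → ∃ λ d →
        x ∈[ fromℚ a , fromℚ b ] × y ∈[ fromℚ c , fromℚ d ] ×
        m ℚ.≤ a ℚ.* c × m ℚ.≤ a ℚ.* d × m ℚ.≤ b ℚ.* c × m ℚ.≤ b ℚ.* d

  inh : ¬ ¬ ∃ S
  inh k = box x λ (a , b , xab) → box y λ (c , d , ycd) →
    let p = a ℚ.* c ; q = a ℚ.* d ; r = b ℚ.* c ; s = b ℚ.* d in
    k ( (p ℚ.⊓ q) ℚ.⊓ (r ℚ.⊓ s) , a , b , c , d , xab , ycd
      , ℚ.≤-trans (ℚ.p⊓q≤p (p ℚ.⊓ q) (r ℚ.⊓ s)) (ℚ.p⊓q≤p p q)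
      , ℚ.≤-trans (ℚ.p⊓q≤p (p ℚ.⊓ q) (r ℚ.⊓ s)) (ℚ.p⊓q≤q p q)
      , ℚ.≤-trans (ℚ.p⊓q≤q (p ℚ.⊓ q) (r ℚ.⊓ s)) (ℚ.p⊓q≤p r s)
      , ℚ.≤-trans (ℚ.p⊓q≤q (p ℚ.⊓ q) (r ℚ.⊓ s)) (ℚ.p⊓q≤q r s) )

  -- Any two boxes containing (x , y) share a point (e , f).
  bdd : ¬ ¬ (∃ λ B → ∀ m → S m → m ℚ.≤ B)
  bdd k = box x λ (a₀ , b₀ , a₀≤x , x≤b₀) → box y λ (c₀ , d₀ , c₀≤y , y≤d₀) →
    k ( (ℚ.∣ a₀ ∣ ℚ.⊔ ℚ.∣ b₀ ∣) ℚ.* (ℚ.∣ c₀ ∣ ℚ.⊔ ℚ.∣ d₀ ∣)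
      , λ m (a , b , c , d , (a≤x , x≤b) , (c≤y , y≤d) , m≤ac , m≤ad , m≤bc , m≤bd) →
        let e   = a ℚ.⊔ a₀
            f   = c ℚ.⊔ c₀
            e≤b = ℚ.⊔-lub (≤-via x a≤x x≤b) (≤-via x a₀≤x x≤b)
            f≤d = ℚ.⊔-lub (≤-via y c≤y y≤d) (≤-via y c₀≤y y≤d)
            m≤ec = between a e b c (ℚ.p≤p⊔q a a₀) e≤b m≤ac m≤bc
            m≤ed = between a e b d (ℚ.p≤p⊔q a a₀) e≤b m≤ad m≤bd
            m≤fe = between c f d e (ℚ.p≤p⊔q c c₀) f≤d
                     (subst (m ℚ.≤_) (ℚ.*-comm e c) m≤ec) (subst (m ℚ.≤_) (ℚ.*-comm e d) m≤ed)
        in ℚ.≤-trans (subst (m ℚ.≤_) (ℚ.*-comm f e) m≤fe)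
             (*-bound {e} {f}
               (∣∣-bound a₀ e b₀ (ℚ.p≤q⊔p a a₀) (ℚ.⊔-lub (≤-via x a≤x x≤b₀) (≤-via x a₀≤x x≤b₀)))
               (∣∣-bound c₀ f d₀ (ℚ.p≤q⊔p c c₀) (ℚ.⊔-lub (≤-via y c≤y y≤d₀) (≤-via y c₀≤y y≤d₀)))) )

¬¬-em : {A : Set} → ¬ ¬ (A ⊎ ¬ A)
¬¬-em k = k (inj₂ λ a → k (inj₁ a))

≤-1/ : ∀ {l₀} .{{_ : ℚ.Positive l₀}} .{{_ : ℚ.NonZero l₀}} m u → 0ℚ ℚ.≤ ℚ.1/ l₀ →
            l₀ ℚ.≤ u → m ℚ.* u ℚ.≤ 1ℚ → m ℚ.≤ ℚ.1/ l₀
≤-1/ {l₀} m u 0≤1/l₀ l₀≤u mu≤1 with ℚ.≤-total 0ℚ m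
... | inj₂ m≤0 = ℚ.≤-trans m≤0 0≤1/l₀
... | inj₁ 0≤m = ℚ.*-cancelʳ-≤-pos l₀ (ℚ.≤-trans
        (ℚ.*-monoˡ-≤-nonNeg m {{ℚ.nonNegative 0≤m}} l₀≤u)
        (ℚ.≤-trans mu≤1 (ℚ.≤-reflexive (sym (ℚ.*-inverseˡ l₀)))))

-- For x > 0 the reciprocal; 0ℝ for x ≤ 0.
_⁻¹ : ℝ → ℝ
x ⁻¹ = sup S (λ k → k (0ℚ , inj₁ refl)) bdd
  where
  S : ℚ → Set
  S m = m ≡ 0ℚ ⊎ (∃ λ l → ∃ λ u → 0ℚ ℚ.< l × x ∈[ fromℚ l , fromℚ u ] × m ℚ.* u ℚ.≤ 1ℚ)

  bdd : ¬ ¬ (∃ λ B → ∀ m → S m → m ℚ.≤ B)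
  bdd k = ¬¬-em {∃ λ l → 0ℚ ℚ.< l × fromℚ l ≤ x} λ where
    (inj₂ none) → k (0ℚ , λ where
      m (inj₁ refl) → ℚ.≤-refl
      m (inj₂ (l , u , 0<l , (l≤x , _) , _)) → contradiction (l , 0<l , l≤x) none)
    (inj₁ (l₀ , 0<l₀ , l₀≤x)) →
      let instance
            l₀>0 = ℚ.positive 0<l₀
            l₀≢0 = ℚ.pos⇒nonZero l₀
            1/l₀>0 = ℚ.1/pos⇒pos l₀
          0≤1/l₀ = ℚ.<⇒≤ (ℚ.positive⁻¹ (ℚ.1/ l₀))
      in k (ℚ.1/ l₀ , λ where
        m (inj₁ refl) → 0≤1/l₀
        m (inj₂ (l , u , _ , (_ , x≤u) , mu≤1)) → ≤-1/ m u 0≤1/l₀ (≤-via x l₀≤x x≤u) mu≤1)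

_÷_ : ℝ → ℝ → ℝ
x ÷ y = x * y ⁻¹

^-nonNeg : ∀ {p} n → 0ℚ ℚ.≤ p → 0ℚ ℚ.≤ p ^ℚ n
^-nonNeg zero    0≤p = ℚ.nonNegative⁻¹ 1ℚ
^-nonNeg {p} (suc n) 0≤p = ℚ.nonNegative⁻¹ _
  {{ℚ.nonNeg*nonNeg⇒nonNeg p {{ℚ.nonNegative 0≤p}} (p ^ℚ n) {{ℚ.nonNegative (^-nonNeg n 0≤p)}}}}

^-monoˡ : ∀ {p q} n → 0ℚ ℚ.≤ p → p ℚ.≤ q → p ^ℚ n ℚ.≤ q ^ℚ n
^-monoˡ zero    0≤p p≤q = ℚ.≤-refl
^-monoˡ {p} {q} (suc n) 0≤p p≤q = ℚ.≤-trans
  (ℚ.*-monoˡ-≤-nonNeg p {{ℚ.nonNegative 0≤p}} (^-monoˡ n 0≤p p≤q))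
  (ℚ.*-monoʳ-≤-nonNeg (q ^ℚ n) {{ℚ.nonNegative (^-nonNeg n (ℚ.≤-trans 0≤p p≤q))}} p≤q)

^-monoʳ : ∀ {p m n} → 1ℚ ℚ.≤ p → m ℕ.≤ n → p ^ℚ m ℚ.≤ p ^ℚ n
^-monoʳ {p} {n = zero} 1≤p ℕ.z≤n = ℚ.≤-refl
^-monoʳ {p} {n = suc n} 1≤p ℕ.z≤n = ℚ.≤-trans (^-monoʳ {n = n} 1≤p ℕ.z≤n)
  (ℚ.≤-trans (ℚ.≤-reflexive (sym (ℚ.*-identityˡ (p ^ℚ n))))
    (ℚ.*-monoʳ-≤-nonNeg (p ^ℚ n) {{ℚ.nonNegative (^-nonNeg n (ℚ.≤-trans (ℚ.nonNegative⁻¹ 1ℚ) 1≤p))}} 1≤p))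
^-monoʳ {p} 1≤p (ℕ.s≤s m≤n) =
  ℚ.*-monoˡ-≤-nonNeg p {{ℚ.nonNegative (ℚ.≤-trans (ℚ.nonNegative⁻¹ 1ℚ) 1≤p)}} (^-monoʳ 1≤p m≤n)

^-cancel : ∀ {p q} n → 0ℚ ℚ.≤ q → p ^ℚ suc n ℚ.≤ q ^ℚ suc n → p ℚ.≤ q
^-cancel {p} {q} n 0≤q pⁿ≤qⁿ with p ℚ.≤? q
... | yes p≤q = p≤q
... | no  p≰q = contradiction (ℚ.<-≤-trans qⁿ<pⁿ pⁿ≤qⁿ) (ℚ.<-irrefl refl)
  where
  q<p = ℚ.≰⇒> p≰q
  0<p = ℚ.≤-<-trans 0≤q q<p
  ^-pos : ∀ j → 0ℚ ℚ.< p ^ℚ j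
  ^-pos zero    = ℚ.positive⁻¹ 1ℚ
  ^-pos (suc j) = subst (ℚ._< p ℚ.* (p ^ℚ j)) (ℚ.*-zeroʳ p)
    (ℚ.*-monoʳ-<-pos p {{ℚ.positive 0<p}} (^-pos j))
  qⁿ<pⁿ : q ^ℚ suc n ℚ.< p ^ℚ suc n
  qⁿ<pⁿ = ℚ.≤-<-trans
    (ℚ.*-monoˡ-≤-nonNeg q {{ℚ.nonNegative 0≤q}} (^-monoˡ n 0≤q (ℚ.<⇒≤ q<p)))
    (ℚ.*-monoˡ-<-pos (p ^ℚ n) {{ℚ.positive (^-pos n)}} q<p)

archimedean : ∀ q → ∃ λ N → q ℚ.≤ + N / 1
archimedean q@(ℚ.mkℚ n d _) = ℤ.∣ n ∣ , ℚ.toℚᵘ-cancel-≤ (ℚᵘ.≤-respʳ-≃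
  (ℚᵘ.≃-sym (ℚ.toℚᵘ-fromℚᵘ (mkℚᵘ (+ ℤ.∣ n ∣) 0)))
  (ℚᵘ.*≤* (ℤ.≤-trans (ℤ.≤-reflexive (ℤ.*-identityʳ n)) (step n))))
  where
  step : ∀ i → i ℤ.≤ + ℤ.∣ i ∣ ℤ.* + suc d
  step (+ j)      = subst ((+ j) ℤ.≤_) (ℤ.pos-* j (suc d)) (ℤ.+≤+ (ℕ.m≤m*n j (suc d)))
  step ℤ.-[1+ j ] = subst (ℤ.-[1+ j ] ℤ.≤_) (ℤ.pos-* (suc j) (suc d)) ℤ.-≤+

/≤⇒≤* : ∀ a n N → + a / suc n ℚ.≤ + N / 1 → a ℕ.≤ N ℕ.* suc n
/≤⇒≤* a n N h = ℤ.drop‿+≤+ (subst₂ ℤ._≤_ (ℤ.*-identityʳ (+ a)) (sym (ℤ.pos-* N (suc n)))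
  (ℚᵘ.drop-*≤* (ℚᵘ.≤-respˡ-≃ (ℚ.toℚᵘ-fromℚᵘ (mkℚᵘ (+ a) n))
    (ℚᵘ.≤-respʳ-≃ (ℚ.toℚᵘ-fromℚᵘ (mkℚᵘ (+ N) 0)) (ℚ.toℚᵘ-mono-≤ h)))))

-- For x ≥ 0 and y ≥ 0 the real power (with 0⁰ = 1); 0ℝ if x < 0 or y < 0.
-- It is the supremum of the m ≥ 0 with m ≤ l^(a/n) and m ≤ l^(c/n) for some
-- rationals 0 ≤ l ≤ x and a/n ≤ y ≤ c/n: the smaller of these two powers is
-- l^(a/n) if l ≥ 1 and l^(c/n) if l ≤ 1.
_^_ : ℝ → ℝ → ℝ
x ^ y = sup S (λ k → k (0ℚ , inj₁ refl)) bdd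
  where
  S : ℚ → Set
  S m = m ≡ 0ℚ ⊎ (∃ λ l → ∃ λ a → ∃ λ c → ∃ λ n-1 → let n = suc n-1 in
        0ℚ ℚ.≤ l × fromℚ l ≤ x × y ∈[ fromℚ (+ a / n) , fromℚ (+ c / n) ] ×
        0ℚ ℚ.≤ m × m ^ℚ n ℚ.≤ l ^ℚ a × m ^ℚ n ℚ.≤ l ^ℚ c)

  bdd : ¬ ¬ (∃ λ B → ∀ m → S m → m ℚ.≤ B)
  bdd k = upper x λ (u , x≤u) → upper y λ (v , y≤v) →
    let B = u ℚ.⊔ 1ℚ
        N , v≤N = archimedean v
        1≤B = ℚ.p≤q⊔p u 1ℚ
        0≤B = ℚ.≤-trans (ℚ.nonNegative⁻¹ 1ℚ) 1≤B
    in k (B ^ℚ N , λ where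
      m (inj₁ refl) → ^-nonNeg N 0≤B
      m (inj₂ (l , a , c , n-1 , 0≤l , l≤x , (a/n≤y , _) , 0≤m , mⁿ≤lᵃ , _)) →
        ^-cancel n-1 (^-nonNeg N 0≤B) (ℚ.≤-trans mⁿ≤lᵃ (ℚ.≤-trans
          (^-monoˡ a 0≤l (ℚ.≤-trans (≤-via x l≤x x≤u) (ℚ.p≤p⊔q u 1ℚ)))
          (ℚ.≤-trans
            (^-monoʳ 1≤B (/≤⇒≤* a n-1 N (ℚ.≤-trans (≤-via y a/n≤y y≤v) v≤N)))
            (ℚ.≤-reflexive (sym (^-assocʳ B N (suc n-1))))))))

∏ : ∀ {k} → (Fin k → ℝ) → ℝ
∏ = Fun.foldr _*_ 1ℝ

-- ∏ᵢ |Aᵢ| for finite sets of integers given as lists without repetition.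
∏card : ∀ {k} → (Fin k → List ℤ) → ℕ
∏card A = product (tabulate λ i → length (A i))

gcdᵥ : ∀ {k} → Vec ℤ k → ℤ
gcdᵥ = Vec.foldr′ gcd 0ℤ

-- "P holds for at least r elements", phrased through a list of distinct
-- witnesses because P is not assumed decidable.
AtLeast : {A : Set} → ℝ → (A → Set) → Set
AtLeast r P = ∃ λ T → Unique T × All P T × r ≤ fromℕ (length T)

{-# OPTIONS --safe #-}
module Submission where

-- Let E be the number of the given tuples, P = ∏|Aᵢ|, Nᵢ = max Aᵢ ≤ 2Xᵢ and G the largest power of
-- R = 2ⁿ with G ≤ D, where n ≥ 4/ε.
-- Every tuple counted by E has a common divisor d ≥ G, so E ≤ Σ_{d≥G} ∏ⱼ |{a ∈ Aⱼ : d ∣ a}|.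
-- For each fixed i bound the factors with j ≠ i by Nⱼ/d.  With f(d) = 2^(−⌊log_R d⌋), a dyadic
-- version of d^(−1/n), this gives E Gᵏ⁻¹ Nᵢ ≤ (∏ⱼ Nⱼ) G^(1/n) Σ_{a∈Aᵢ} s(a), where s(a) = Σ_{d∣a} f(d).
-- Every moment of s is bounded on average over a ≤ N.  If |Aᵢ| ≥ Nᵢ/Gᵏ, Markov's inequality for a high
-- moment therefore gives Σ_{a∈Aᵢ} s(a) ≪ G^(1/n) |Aᵢ|, and multiplying over i yields
-- Eᵏ G^(k(k−1)−2k/n) ≪ P (∏ⱼ Nⱼ)ᵏ⁻¹, which is the theorem since E ≥ δP.  If some |Aᵢ| < Nᵢ/Gᵏ,
-- the bound on P is trivial.

-- The weight `f` is what keeps logarithms of the X's out of the bound. Without it `s` would be the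
-- divisor function, whose moments up to N grow, on average, like powers of log N. Since the sum of
-- f(d)/d converges, the moments of `s` stay bounded on average. The price is paid from the estimate
-- itself: bounding the factors with j ≠ i leaves a power of G/d with positive exponent, and for d ≥
-- G this is at most 2^b f(d).
--
-- The exponent n of the overview is `4 * n` in the code, where 1/n ≤ ε. With B = 2^b the quantities
-- G = B^(4n) and G^(1/(4n)) = B are powers of one integer, so the exponents can be compared in ℕ
-- and no roots of G occur.
--
-- The order of the cuts is undecidable, so all counting is done in ℕ and ℚ, and the reals enter at
-- the end through rational bounds for the factors of the right-hand side. As `x ≤ y` is a negation,
-- objects that exist only up to double negation, such as b with R^b ≤ D ≤ R^(b+1), may be used to
-- prove it.

open import Defs
open import Algebra.Bundles using (CommutativeRing)
open import Data.Fin.Base using (Fin; zero; suc)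
import Data.Fin.Properties as Fin
open import Data.Integer.Base as ℤ using (ℤ; +_)
import Data.Integer.Properties as ℤ
open import Data.List.Base
  using (List; []; _∷_; _++_; map; length; concatMap; filter; applyUpTo; downFrom; cartesianProductWith; tabulate)
open import Data.List.Membership.Propositional using (_∈_; lose)
open import Data.List.Membership.Propositional.Properties
open import Data.List.Properties using (length-map; length-++; map-∘; map-id-local)
open import Data.List.Relation.Unary.All as All using (All)
open import Data.List.Relation.Unary.AllPairs using (_∷_)
open import Data.List.Relation.Unary.Any using (here; there)
open import Data.List.Relation.Unary.Unique.Propositional using (Unique)
import Data.List.Relation.Unary.Unique.Propositional.Properties as Unique
open import Data.Nat.Base as ℕ using (ℕ; zero; suc)
import Data.Nat.Coprimality as Coprime
import Data.Nat.DivMod as ℕ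
open import Data.Nat.Divisibility as ℕ∣ using (_∣_; divides; _∣?_)
import Data.Nat.GCD as ℕ
open import Data.Nat.ListAction using (product)
import Data.Nat.Properties as ℕ
import Data.Nat.Solver as ℕ
open import Data.Product.Base using (∃; _×_; _,_; proj₁; proj₂)
open import Data.Rational.Base as ℚ using (ℚ; 0ℚ; 1ℚ; ½; _/_)
import Data.Rational.Properties as ℚ
import Data.Rational.Solver as ℚ
import Data.Rational.Unnormalised.Base as ℚᵘ
import Data.Rational.Unnormalised.Properties as ℚᵘ
open import Data.Sum.Base using (inj₁; inj₂)
open import Data.Vec.Base as Vec using (Vec; []; _∷_; lookup)
open import Data.Vec.Properties using (lookup-map)
open import Function.Base using (_∘_)
open import Relation.Binary.PropositionalEquality
  using (_≡_; refl; sym; trans; cong; cong₂; subst; subst₂; module ≡-Reasoning)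
open import Relation.Nullary.Decidable.Core using (Dec; yes; no)
open import Relation.Nullary.Negation.Core using (¬_; contradiction)
open import Algebra.Properties.CommutativeSemiring.Exp (CommutativeRing.commutativeSemiring ℚ.+-*-commutativeRing)
  using (^-distrib-*)
open import Algebra.Properties.Semiring.Exp (CommutativeRing.semiring ℚ.+-*-commutativeRing)
  using (^-assocʳ; ^-homo-*) renaming (_^_ to _^ℚ_)

-- Arithmetic of rational numbers

-- The fraction `+ n / 1` is normalised through a gcd. Sealed, `ι n` stays an atom for the ring
-- solver and is handled by the laws below.
opaque
  ι : ℕ → ℚ
  ι n = + n / 1

  toℚᵘ-ι : ∀ n → ℚ.toℚᵘ (ι n) ℚᵘ.≃ ℚᵘ.mkℚᵘ (+ n) 0
  toℚᵘ-ι n = ℚ.toℚᵘ-fromℚᵘ (ℚᵘ.mkℚᵘ (+ n) 0)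

  ι-+ : ∀ m n → ι (m ℕ.+ n) ≡ ι m ℚ.+ ι n
  ι-+ m n = ℚ.toℚᵘ-injective (ℚᵘ.≃-trans (toℚᵘ-ι (m ℕ.+ n))
    (ℚᵘ.≃-trans (ℚᵘ.*≡* (cong (ℤ._* + 1) (trans (ℤ.pos-+ m n)
      (sym (cong₂ ℤ._+_ (ℤ.*-identityʳ (+ m)) (ℤ.*-identityʳ (+ n)))))))
    (ℚᵘ.≃-sym (ℚᵘ.≃-trans (ℚ.toℚᵘ-homo-+ (ι m) (ι n)) (ℚᵘ.+-cong (toℚᵘ-ι m) (toℚᵘ-ι n))))))

  ι-* : ∀ m n → ι (m ℕ.* n) ≡ ι m ℚ.* ι n
  ι-* m n = ℚ.toℚᵘ-injective (ℚᵘ.≃-trans (toℚᵘ-ι (m ℕ.* n))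
    (ℚᵘ.≃-trans (ℚᵘ.*≡* (cong (ℤ._* + 1) (ℤ.pos-* m n)))
    (ℚᵘ.≃-sym (ℚᵘ.≃-trans (ℚ.toℚᵘ-homo-* (ι m) (ι n)) (ℚᵘ.*-cong (toℚᵘ-ι m) (toℚᵘ-ι n))))))

  ι-mono : ∀ {m n} → m ℕ.≤ n → ι m ℚ.≤ ι n
  ι-mono {m} {n} m≤n = ℚ.toℚᵘ-cancel-≤ (ℚᵘ.≤-respˡ-≃ (ℚᵘ.≃-sym (toℚᵘ-ι m)) (ℚᵘ.≤-respʳ-≃ (ℚᵘ.≃-sym (toℚᵘ-ι n))
    (ℚᵘ.*≤* (ℤ.*-monoʳ-≤-nonNeg (+ 1) (ℤ.+≤+ m≤n)))))

  ι-cancel : ∀ {m n} → ι m ℚ.≤ ι n → m ℕ.≤ n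
  ι-cancel {m} {n} h = subst (m ℕ.≤_) (ℕ.*-identityʳ n) (/≤⇒≤* m 0 n h)

  ι-def : ∀ n → ι n ≡ + n / 1
  ι-def n = refl

ι0 : ι 0 ≡ 0ℚ
ι0 = ι-def 0

ι1 : ι 1 ≡ 1ℚ
ι1 = ι-def 1

ι-^ : ∀ m n → ι (m ℕ.^ n) ≡ ι m ^ℚ n
ι-^ m zero    = ι1
ι-^ m (suc n) = trans (ι-* m (m ℕ.^ n)) (cong (ι m ℚ.*_) (ι-^ m n))

0≤ι : ∀ n → 0ℚ ℚ.≤ ι n
0≤ι n = subst (ℚ._≤ ι n) ι0 (ι-mono ℕ.z≤n)

*-mono : ∀ {p q r s} → 0ℚ ℚ.≤ q → 0ℚ ℚ.≤ r → p ℚ.≤ q → r ℚ.≤ s → p ℚ.* r ℚ.≤ q ℚ.* s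
*-mono {q = q} {r = r} 0≤q 0≤r p≤q r≤s = ℚ.≤-trans
  (ℚ.*-monoʳ-≤-nonNeg r {{ℚ.nonNegative 0≤r}} p≤q)
  (ℚ.*-monoˡ-≤-nonNeg q {{ℚ.nonNegative 0≤q}} r≤s)

*-monoˡ : ∀ {r p q} → 0ℚ ℚ.≤ r → p ℚ.≤ q → r ℚ.* p ℚ.≤ r ℚ.* q
*-monoˡ {r} 0≤r = ℚ.*-monoˡ-≤-nonNeg r {{ℚ.nonNegative 0≤r}}

*-monoʳ : ∀ {r p q} → 0ℚ ℚ.≤ r → p ℚ.≤ q → p ℚ.* r ℚ.≤ q ℚ.* r
*-monoʳ {r} 0≤r = ℚ.*-monoʳ-≤-nonNeg r {{ℚ.nonNegative 0≤r}}

0≤* : ∀ {p q} → 0ℚ ℚ.≤ p → 0ℚ ℚ.≤ q → 0ℚ ℚ.≤ p ℚ.* q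
0≤* {p} {q} 0≤p 0≤q = subst (ℚ._≤ p ℚ.* q) (ℚ.*-zeroʳ p) (*-monoˡ 0≤p 0≤q)

0≤+ : ∀ {p q} → 0ℚ ℚ.≤ p → 0ℚ ℚ.≤ q → 0ℚ ℚ.≤ p ℚ.+ q
0≤+ = ℚ.+-mono-≤

0≤½ : 0ℚ ℚ.≤ ½
0≤½ = ℚ.nonNegative⁻¹ ½

½≤1 : ½ ℚ.≤ 1ℚ
½≤1 = ℚ.≤ᵇ⇒≤ _

^-inverse : ∀ {p q} n → p ℚ.* q ≡ 1ℚ → p ^ℚ n ℚ.* q ^ℚ n ≡ 1ℚ
^-inverse zero    pq≡1 = refl
^-inverse {p} {q} (suc n) pq≡1 = trans (sym (^-distrib-* p q (suc n)))
  (trans (cong₂ ℚ._*_ pq≡1 (trans (^-distrib-* p q n) (^-inverse {p} {q} n pq≡1))) (ℚ.*-identityˡ 1ℚ))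

½^*2^ : ∀ n → ½ ^ℚ n ℚ.* ι (2 ℕ.^ n) ≡ 1ℚ
½^*2^ n = trans (cong (½ ^ℚ n ℚ.*_) (ι-^ 2 n)) (^-inverse {½} {ι 2} n (cong (½ ℚ.*_) (ι-def 2)))

^-antitone : ∀ {p m n} → 0ℚ ℚ.≤ p → p ℚ.≤ 1ℚ → m ℕ.≤ n → p ^ℚ n ℚ.≤ p ^ℚ m
^-antitone {n = zero}  0≤p p≤1 ℕ.z≤n = ℚ.≤-refl
^-antitone {p} {n = suc n} 0≤p p≤1 ℕ.z≤n = *-mono (ℚ.nonNegative⁻¹ 1ℚ) (^-nonNeg n 0≤p) p≤1 (^-antitone {n = n} 0≤p p≤1 ℕ.z≤n)
^-antitone 0≤p p≤1 (ℕ.s≤s m≤n) = *-monoˡ 0≤p (^-antitone 0≤p p≤1 m≤n)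

-- Finite sums and divisors

module _ {A : Set} where

  ∑ : List A → (A → ℚ) → ℚ
  ∑ []       g = 0ℚ
  ∑ (x ∷ xs) g = g x ℚ.+ ∑ xs g

  ∑-nonNeg : ∀ xs {g} → (∀ {x} → x ∈ xs → 0ℚ ℚ.≤ g x) → 0ℚ ℚ.≤ ∑ xs g
  ∑-nonNeg []       0≤g = ℚ.≤-refl
  ∑-nonNeg (x ∷ xs) 0≤g = 0≤+ (0≤g (here refl)) (∑-nonNeg xs (0≤g ∘ there))

  ∑-mono : ∀ xs {g h} → (∀ {x} → x ∈ xs → g x ℚ.≤ h x) → ∑ xs g ℚ.≤ ∑ xs h
  ∑-mono []       g≤h = ℚ.≤-refl
  ∑-mono (x ∷ xs) g≤h = ℚ.+-mono-≤ (g≤h (here refl)) (∑-mono xs (g≤h ∘ there))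

  ∑-cong : ∀ xs {g h : A → ℚ} → (∀ x → g x ≡ h x) → ∑ xs g ≡ ∑ xs h
  ∑-cong []       g≡h = refl
  ∑-cong (x ∷ xs) g≡h = cong₂ ℚ._+_ (g≡h x) (∑-cong xs g≡h)

  ∑-*ˡ : ∀ xs c g → ∑ xs (λ x → c ℚ.* g x) ≡ c ℚ.* ∑ xs g
  ∑-*ˡ []       c g = sym (ℚ.*-zeroʳ c)
  ∑-*ˡ (x ∷ xs) c g = trans (cong (c ℚ.* g x ℚ.+_) (∑-*ˡ xs c g)) (sym (ℚ.*-distribˡ-+ c (g x) (∑ xs g)))

  ∑-*ʳ : ∀ xs c g → ∑ xs (λ x → g x ℚ.* c) ≡ ∑ xs g ℚ.* c
  ∑-*ʳ xs c g = trans (∑-cong xs (λ x → ℚ.*-comm (g x) c)) (trans (∑-*ˡ xs c g) (ℚ.*-comm c _))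

  ∑-+ : ∀ xs g h → ∑ xs (λ x → g x ℚ.+ h x) ≡ ∑ xs g ℚ.+ ∑ xs h
  ∑-+ []       g h = refl
  ∑-+ (x ∷ xs) g h = trans (cong ((g x ℚ.+ h x) ℚ.+_) (∑-+ xs g h))
    (solve 4 (λ a b c d → (a :+ b) :+ (c :+ d) := (a :+ c) :+ (b :+ d)) refl (g x) (h x) (∑ xs g) (∑ xs h))
    where open ℚ.+-*-Solver

  ∑-++ : ∀ xs ys g → ∑ (xs ++ ys) g ≡ ∑ xs g ℚ.+ ∑ ys g
  ∑-++ []       ys g = sym (ℚ.+-identityˡ _)
  ∑-++ (x ∷ xs) ys g = trans (cong (g x ℚ.+_) (∑-++ xs ys g)) (sym (ℚ.+-assoc (g x) _ _))

  ∑-const : ∀ xs c → ∑ xs (λ _ → c) ≡ ι (length xs) ℚ.* c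
  ∑-const []       c = sym (trans (cong (ℚ._* c) ι0) (ℚ.*-zeroˡ c))
  ∑-const (x ∷ xs) c = trans (cong₂ ℚ._+_ (sym (ℚ.*-identityˡ c)) (∑-const xs c))
    (trans (sym (ℚ.*-distribʳ-+ c 1ℚ (ι (length xs))))
      (cong (ℚ._* c) (sym (trans (ι-+ 1 (length xs)) (cong (ℚ._+ ι (length xs)) ι1)))))

  ∑-filter : ∀ {P : A → Set} (P? : ∀ x → Dec (P x)) xs g h →
             (∀ {x} → P x → g x ≡ h x) → (∀ {x} → ¬ P x → h x ≡ 0ℚ) → ∑ (filter P? xs) g ≡ ∑ xs h
  ∑-filter P? []       g h p q = refl
  ∑-filter P? (x ∷ xs) g h p q with P? x
  ... | yes Px = cong₂ ℚ._+_ (p Px) (∑-filter P? xs g h p q)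
  ... | no ¬Px = trans (∑-filter P? xs g h p q) (trans (sym (ℚ.+-identityˡ _)) (cong (ℚ._+ ∑ xs h) (sym (q ¬Px))))

  -- The list `ys` may repeat elements, so overlapping blocks and lists of products can serve as
  -- covers. One occurrence of the head of `xs` is removed from `ys` at each step.
  ∑-⊆ : ∀ {xs ys g} → Unique xs → (∀ {x} → x ∈ xs → x ∈ ys) → (∀ {x} → x ∈ ys → 0ℚ ℚ.≤ g x) →
        ∑ xs g ℚ.≤ ∑ ys g
  ∑-⊆ {[]}     {ys} _ _ 0≤g = ∑-nonNeg ys 0≤g
  ∑-⊆ {x ∷ xs} {ys} {g} (x∉xs ∷ u) ⊆ 0≤g with ∈-∃++ (⊆ (here refl))
  ... | as , bs , refl = begin
    g x ℚ.+ ∑ xs g                  ≤⟨ ℚ.+-monoʳ-≤ (g x) (∑-⊆ u ⊆′ (0≤g ∘ ⊇)) ⟩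
    g x ℚ.+ ∑ (as ++ bs) g          ≡⟨ cong (g x ℚ.+_) (∑-++ as bs g) ⟩
    g x ℚ.+ (∑ as g ℚ.+ ∑ bs g)     ≡⟨ solve 3 (λ a b c → a :+ (b :+ c) := b :+ (a :+ c)) refl (g x) (∑ as g) (∑ bs g) ⟩
    ∑ as g ℚ.+ ∑ (x ∷ bs) g         ≡⟨ ∑-++ as (x ∷ bs) g ⟨
    ∑ (as ++ x ∷ bs) g              ∎
    where
    open ℚ.≤-Reasoning
    open ℚ.+-*-Solver
    ⊆′ : ∀ {y} → y ∈ xs → y ∈ as ++ bs
    ⊆′ y∈xs with ∈-++⁻ as (⊆ (there y∈xs))
    ... | inj₁ y∈as         = ∈-++⁺ˡ y∈as
    ... | inj₂ (here refl)  = contradiction refl (All.lookup x∉xs y∈xs)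
    ... | inj₂ (there y∈bs) = ∈-++⁺ʳ as y∈bs
    ⊇ : ∀ {y} → y ∈ as ++ bs → y ∈ as ++ x ∷ bs
    ⊇ y∈ with ∈-++⁻ as y∈
    ... | inj₁ y∈as = ∈-++⁺ˡ y∈as
    ... | inj₂ y∈bs = ∈-++⁺ʳ as (there y∈bs)

  length-⊆ : ∀ {xs ys : List A} → Unique xs → (∀ {x} → x ∈ xs → x ∈ ys) → length xs ℕ.≤ length ys
  length-⊆ {xs} {ys} u ⊆ = ι-cancel (subst₂ ℚ._≤_ (eq xs) (eq ys) (∑-⊆ u ⊆ (λ _ → ℚ.nonNegative⁻¹ 1ℚ)))
    where
    eq : ∀ zs → ∑ zs (λ _ → 1ℚ) ≡ ι (length zs)
    eq zs = trans (∑-const zs 1ℚ) (ℚ.*-identityʳ _)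

∑-map : ∀ {A B : Set} (h : A → B) xs g → ∑ (map h xs) g ≡ ∑ xs (g ∘ h)
∑-map h []       g = refl
∑-map h (x ∷ xs) g = cong (g (h x) ℚ.+_) (∑-map h xs g)

∑-concatMap : ∀ {A B : Set} (h : A → List B) xs g → ∑ (concatMap h xs) g ≡ ∑ xs (λ x → ∑ (h x) g)
∑-concatMap h []       g = refl
∑-concatMap h (x ∷ xs) g = trans (∑-++ (h x) (concatMap h xs) g) (cong (∑ (h x) g ℚ.+_) (∑-concatMap h xs g))

∑-swap : ∀ {A B : Set} xs ys (g : A → B → ℚ) → ∑ xs (λ x → ∑ ys (g x)) ≡ ∑ ys (λ y → ∑ xs (λ x → g x y))
∑-swap []       ys g = sym (trans (∑-const ys 0ℚ) (ℚ.*-zeroʳ (ι (length ys))))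
∑-swap (x ∷ xs) ys g = trans (cong (∑ ys (g x) ℚ.+_) (∑-swap xs ys g)) (sym (∑-+ ys (g x) _))

∑-cartesian : ∀ {A B C : Set} (_∙_ : A → B → C) xs ys g →
              ∑ (cartesianProductWith _∙_ xs ys) g ≡ ∑ xs (λ x → ∑ ys (λ y → g (x ∙ y)))
∑-cartesian _∙_ []       ys g = refl
∑-cartesian _∙_ (x ∷ xs) ys g = trans (∑-++ (map (x ∙_) ys) _ g)
  (cong₂ ℚ._+_ (∑-map (x ∙_) ys g) (∑-cartesian _∙_ xs ys g))

range : ℕ → List ℕ
range N = applyUpTo suc N

length-applyUpTo : ∀ {A : Set} (g : ℕ → A) N → length (applyUpTo g N) ≡ N
length-applyUpTo g zero    = refl
length-applyUpTo g (suc N) = cong suc (length-applyUpTo (g ∘ suc) N)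

∈-range⁺ : ∀ {N d} → 1 ℕ.≤ d → d ℕ.≤ N → d ∈ range N
∈-range⁺ (ℕ.s≤s _) d<N = ∈-applyUpTo⁺ suc d<N

∈-range⁻ : ∀ {N d} → d ∈ range N → 1 ℕ.≤ d × d ℕ.≤ N
∈-range⁻ d∈ with _ , i<N , refl ← ∈-applyUpTo⁻ suc d∈ = ℕ.s≤s ℕ.z≤n , i<N

range-unique : ∀ N → Unique (range N)
range-unique N = Unique.applyUpTo⁺₁ suc N λ i<j _ eq → ℕ.<⇒≢ i<j (ℕ.suc-injective eq)

1≤m*n : ∀ {m n} → 1 ℕ.≤ m → 1 ℕ.≤ n → 1 ℕ.≤ m ℕ.* n
1≤m*n = ℕ.*-mono-≤

∣⇒≤ : ∀ {d a} → 1 ℕ.≤ a → d ∣ a → d ℕ.≤ a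
∣⇒≤ (ℕ.s≤s _) d∣a = ℕ∣.∣⇒≤ d∣a

∣⇒1≤ : ∀ {d a} → 1 ℕ.≤ a → d ∣ a → 1 ℕ.≤ d
∣⇒1≤ {zero}  1≤a d∣a = contradiction (ℕ∣.0∣⇒≡0 d∣a) (ℕ.>⇒≢ 1≤a)
∣⇒1≤ {suc d} 1≤a d∣a = ℕ.s≤s ℕ.z≤n

divisors : ℕ → List ℕ
divisors a = filter (_∣? a) (range a)

∈-divisors⁺ : ∀ {d a} → 1 ℕ.≤ a → d ∣ a → d ∈ divisors a
∈-divisors⁺ {a = a} 1≤a d∣a = ∈-filter⁺ (_∣? a) (∈-range⁺ (∣⇒1≤ 1≤a d∣a) (∣⇒≤ 1≤a d∣a)) d∣a

∈-divisors⁻ : ∀ {d a} → d ∈ divisors a → 1 ℕ.≤ d × d ℕ.≤ a × d ∣ a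
∈-divisors⁻ {a = a} d∈ = let d∈range , d∣a = ∈-filter⁻ (_∣? a) d∈ ; 1≤d , d≤a = ∈-range⁻ d∈range in 1≤d , d≤a , d∣a

divisors-unique : ∀ a → Unique (divisors a)
divisors-unique a = Unique.filter⁺ (_∣? a) (range-unique a)

-- Take g = gcd(e, a). Then e/g divides (a/g) b and is coprime to a/g, hence divides b.
∣*-split : ∀ {e a b} → 1 ℕ.≤ e → e ∣ a ℕ.* b → ∃ λ g → ∃ λ h → g ∣ a × h ∣ b × e ≡ g ℕ.* h
∣*-split {e} {a} {b} 1≤e e∣ab =
  g , e ℕ./ g , ℕ.gcd[m,n]∣n e a , Coprime.coprime-divisor (Coprime.coprime-/gcd e a) e/g∣ , e≡
  where
  g = ℕ.gcd e a
  instance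
    g≢0 : ℕ.NonZero g
    g≢0 = ℕ.≢-nonZero (ℕ.gcd[m,n]≢0 e a (inj₁ (ℕ.>⇒≢ 1≤e)))
  e≡ : e ≡ g ℕ.* (e ℕ./ g)
  e≡ = sym (ℕ.m*[n/m]≡n (ℕ.gcd[m,n]∣m e a))
  e/g∣ : e ℕ./ g ∣ (a ℕ./ g) ℕ.* b
  e/g∣ = ℕ∣.*-cancelˡ-∣ g (subst₂ _∣_ e≡
    (trans (cong (ℕ._* b) (sym (ℕ.m*[n/m]≡n (ℕ.gcd[m,n]∣n e a)))) (ℕ.*-assoc g _ b)) e∣ab)

ι-positive : ∀ n → ℚ.Positive (ι (suc n))
ι-positive n = ℚ.positive (ℚ.≰⇒> λ h → ℕ.n≮0 (ι-cancel {suc n} {0} (subst (ι (suc n) ℚ.≤_) (sym ι0) h)))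

-- The default 0 at `zero` makes nonnegativity unconditional, as `Weight` asks.
opaque
  inv : ℕ → ℚ
  inv zero    = 0ℚ
  inv (suc n) = ℚ.1/_ (ι (suc n)) {{ℚ.pos⇒nonZero (ι (suc n)) {{ι-positive n}}}}

  inv-* : ∀ {d} → 1 ℕ.≤ d → inv d ℚ.* ι d ≡ 1ℚ
  inv-* {suc d} _ = ℚ.*-inverseˡ (ι (suc d)) {{_}}

  0≤inv : ∀ d → 0ℚ ℚ.≤ inv d
  0≤inv zero    = ℚ.≤-refl
  0≤inv (suc d) = ℚ.<⇒≤ (ℚ.positive⁻¹ (inv (suc d)) {{ℚ.1/pos⇒pos (ι (suc d)) {{ι-positive d}}}})

inv-cancelʳ : ∀ {d} → 1 ℕ.≤ d → ∀ x → x ℚ.* ι d ℚ.* inv d ≡ x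
inv-cancelʳ {d} 1≤d x = trans (ℚ.*-assoc x _ _)
  (trans (cong (x ℚ.*_) (trans (ℚ.*-comm (ι d) (inv d)) (inv-* 1≤d))) (ℚ.*-identityʳ x))

≤-inv : ∀ {x y d} → 1 ℕ.≤ d → x ℚ.* ι d ℚ.≤ y → x ℚ.≤ y ℚ.* inv d
≤-inv {x} {y} {d} 1≤d h = subst (ℚ._≤ y ℚ.* inv d) (inv-cancelʳ 1≤d x) (*-monoʳ (0≤inv d) h)

inv-homo-* : ∀ {a b} → 1 ℕ.≤ a → 1 ℕ.≤ b → inv (a ℕ.* b) ≡ inv a ℚ.* inv b
inv-homo-* {a} {b} 1≤a 1≤b = begin
  inv (a ℕ.* b)                                             ≡⟨ ℚ.*-identityʳ _ ⟨
  inv (a ℕ.* b) ℚ.* 1ℚ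
    ≡⟨ cong (inv (a ℕ.* b) ℚ.*_) (cong₂ ℚ._*_ (inv-* 1≤a) (inv-* 1≤b)) ⟨
  inv (a ℕ.* b) ℚ.* (inv a ℚ.* ι a ℚ.* (inv b ℚ.* ι b))
    ≡⟨ solve 5 (λ x p q r s → x :* (p :* q :* (r :* s)) := x :* (q :* s) :* (p :* r)) refl (inv (a ℕ.* b)) (inv a) (ι a) (inv b) (ι b) ⟩
  inv (a ℕ.* b) ℚ.* (ι a ℚ.* ι b) ℚ.* (inv a ℚ.* inv b)
    ≡⟨ cong (ℚ._* (inv a ℚ.* inv b)) (trans (cong (inv (a ℕ.* b) ℚ.*_) (sym (ι-* a b))) (inv-* (1≤m*n 1≤a 1≤b))) ⟩
  1ℚ ℚ.* (inv a ℚ.* inv b)                                  ≡⟨ ℚ.*-identityˡ _ ⟩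
  inv a ℚ.* inv b                                           ∎
  where
  open ≡-Reasoning
  open ℚ.+-*-Solver

-- Moments of divisor sums

-- Submultiplicativity is asked of all pairs, not only of coprime ones, because it is applied to a =
-- d b with d an arbitrary divisor of a.
record Weight (φ : ℕ → ℚ) : Set where
  field
    nonNeg  : ∀ a → 0ℚ ℚ.≤ φ a
    submult : ∀ {a b} → 1 ℕ.≤ a → 1 ℕ.≤ b → φ (a ℕ.* b) ℚ.≤ φ a ℚ.* φ b

open Weight

weight-* : ∀ {φ ψ} → Weight φ → Weight ψ → Weight (λ a → φ a ℚ.* ψ a)
weight-* {φ} {ψ} wφ wψ = record
  { nonNeg  = λ a → 0≤* (nonNeg wφ a) (nonNeg wψ a)
  ; submult = λ {a} {b} 1≤a 1≤b → ℚ.≤-trans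
      (*-mono (0≤* (nonNeg wφ a) (nonNeg wφ b)) (nonNeg wψ (a ℕ.* b)) (submult wφ 1≤a 1≤b) (submult wψ 1≤a 1≤b))
      (ℚ.≤-reflexive (solve 4 (λ p q r s → (p :* q) :* (r :* s) := (p :* r) :* (q :* s)) refl (φ a) (φ b) (ψ a) (ψ b)))
  }
  where open ℚ.+-*-Solver

weight-^ : ∀ {φ} → Weight φ → ∀ m → Weight (λ a → φ a ^ℚ m)
weight-^ wφ zero    = record { nonNeg = λ _ → ℚ.nonNegative⁻¹ 1ℚ ; submult = λ _ _ → ℚ.≤-refl }
weight-^ wφ (suc m) = weight-* wφ (weight-^ wφ m)

weight-inv : Weight inv
weight-inv = record { nonNeg = 0≤inv ; submult = λ 1≤a 1≤b → ℚ.≤-reflexive (inv-homo-* 1≤a 1≤b) }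

restrict : ∀ {P : Set} → Dec P → ℚ → ℚ
restrict (yes _) q = q
restrict (no  _) q = 0ℚ

restrict-yes : ∀ {P : Set} (P? : Dec P) {q} → P → q ≡ restrict P? q
restrict-yes (yes _) _ = refl
restrict-yes (no ¬p) p = contradiction p ¬p

restrict-no : ∀ {P : Set} (P? : Dec P) {q} → ¬ P → restrict P? q ≡ 0ℚ
restrict-no (yes p) ¬p = contradiction p ¬p
restrict-no (no _)  _  = refl

cofactors : ℕ → ℕ → List ℕ
cofactors N d = filter (λ b → d ℕ.* b ℕ.≤? N) (range N)

cofactors-unique : ∀ N d → Unique (cofactors N d)
cofactors-unique N d = Unique.filter⁺ (λ b → d ℕ.* b ℕ.≤? N) (range-unique N)

∈-cofactors⁻ : ∀ N d {b} → b ∈ cofactors N d → b ∈ range N × d ℕ.* b ℕ.≤ N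
∈-cofactors⁻ N d = ∈-filter⁻ (λ b → d ℕ.* b ℕ.≤? N) {xs = range N}

module Moments (f : ℕ → ℚ) (wf : Weight f) (f≤1 : ∀ d → f d ℚ.≤ 1ℚ) where

  s : ℕ → ℚ
  s a = ∑ (divisors a) f

  -- Every divisor of a b is a product of a divisor of a and one of b. Several factorisations of the
  -- same divisor only enlarge the right side.
  weight-s : Weight s
  weight-s = record
    { nonNeg  = λ a → ∑-nonNeg (divisors a) (λ {d} _ → nonNeg wf d)
    ; submult = λ {a} {b} 1≤a 1≤b → let open ℚ.≤-Reasoning in begin
        ∑ (divisors (a ℕ.* b)) f
          ≤⟨ ∑-⊆ (divisors-unique (a ℕ.* b)) (split 1≤a 1≤b) (λ {d} _ → nonNeg wf d) ⟩
        ∑ (cartesianProductWith ℕ._*_ (divisors a) (divisors b)) f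
          ≡⟨ ∑-cartesian ℕ._*_ (divisors a) (divisors b) f ⟩
        ∑ (divisors a) (λ x → ∑ (divisors b) (λ y → f (x ℕ.* y)))
          ≤⟨ ∑-mono (divisors a) (λ x∈ → ∑-mono (divisors b) (λ y∈ →
               submult wf (proj₁ (∈-divisors⁻ {a = a} x∈)) (proj₁ (∈-divisors⁻ {a = b} y∈)))) ⟩
        ∑ (divisors a) (λ x → ∑ (divisors b) (λ y → f x ℚ.* f y))
          ≡⟨ ∑-cong (divisors a) (λ x → ∑-*ˡ (divisors b) (f x) f) ⟩
        ∑ (divisors a) (λ x → f x ℚ.* s b)
          ≡⟨ ∑-*ʳ (divisors a) (s b) f ⟩
        s a ℚ.* s b ∎
    }
    where
    split : ∀ {a b} → 1 ℕ.≤ a → 1 ℕ.≤ b → ∀ {e} → e ∈ divisors (a ℕ.* b) →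
            e ∈ cartesianProductWith ℕ._*_ (divisors a) (divisors b)
    split {a} {b} 1≤a 1≤b e∈ =
      let 1≤e , _ , e∣ab = ∈-divisors⁻ e∈
          g , h , g∣a , h∣b , e≡ = ∣*-split {a = a} 1≤e e∣ab
      in subst (_∈ _) (sym e≡) (∈-cartesianProductWith⁺ ℕ._*_ (∈-divisors⁺ 1≤a g∣a) (∈-divisors⁺ 1≤b h∣b))

  -- Interchange the sums over a and d ∣ a, write a = d b, and separate d from b by
  -- submultiplicativity. This opens one factor `s` at a time.
  ∑-s* : ∀ {φ} → Weight φ → ∀ N →
         ∑ (range N) (λ a → s a ℚ.* φ a) ℚ.≤ ∑ (range N) (λ d → f d ℚ.* φ d ℚ.* ∑ (cofactors N d) φ)
  ∑-s* {φ} wφ N = begin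
    ∑ (range N) (λ a → s a ℚ.* φ a)
      ≤⟨ ∑-mono (range N) (λ {a} a∈ → *-monoʳ (nonNeg wφ a) (s≤ a∈)) ⟩
    ∑ (range N) (λ a → ∑ (range N) (w a) ℚ.* φ a)
      ≡⟨ ∑-cong (range N) (λ a → sym (∑-*ʳ (range N) (φ a) (w a))) ⟩
    ∑ (range N) (λ a → ∑ (range N) (λ d → w a d ℚ.* φ a))
      ≡⟨ ∑-swap (range N) (range N) (λ a d → w a d ℚ.* φ a) ⟩
    ∑ (range N) (λ d → ∑ (range N) (λ a → w a d ℚ.* φ a))
      ≤⟨ ∑-mono (range N) (λ {d} d∈ → inner d (proj₁ (∈-range⁻ d∈))) ⟩
    ∑ (range N) (λ d → f d ℚ.* φ d ℚ.* ∑ (cofactors N d) φ) ∎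
    where
    open ℚ.≤-Reasoning
    w : ℕ → ℕ → ℚ
    w a d = restrict (d ∣? a) (f d)

    s≤ : ∀ {a} → a ∈ range N → s a ℚ.≤ ∑ (range N) (w a)
    s≤ {a} a∈ = begin
      ∑ (divisors a) f                  ≤⟨ ∑-⊆ (divisors-unique a) ⊆ (λ {d} _ → nonNeg wf d) ⟩
      ∑ (filter (_∣? a) (range N)) f    ≡⟨ ∑-filter (_∣? a) (range N) f (w a)
                                             (λ {d} → restrict-yes (d ∣? a)) (λ {d} → restrict-no (d ∣? a)) ⟩
      ∑ (range N) (w a)                 ∎
      where
      ⊆ : ∀ {d} → d ∈ divisors a → d ∈ filter (_∣? a) (range N)
      ⊆ d∈ = let 1≤d , d≤a , d∣a = ∈-divisors⁻ d∈ in
        ∈-filter⁺ (_∣? a) (∈-range⁺ 1≤d (ℕ.≤-trans d≤a (proj₂ (∈-range⁻ {N} a∈)))) d∣a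

    inner : ∀ d → 1 ℕ.≤ d → ∑ (range N) (λ a → w a d ℚ.* φ a) ℚ.≤ f d ℚ.* φ d ℚ.* ∑ (cofactors N d) φ
    inner d 1≤d = begin
      ∑ (range N) (λ a → w a d ℚ.* φ a)
        ≡⟨ ∑-filter (d ∣?_) (range N) (λ a → f d ℚ.* φ a) (λ a → w a d ℚ.* φ a)
             (λ {a} p → cong (ℚ._* φ a) (restrict-yes (d ∣? a) p))
             (λ {a} ¬p → trans (cong (ℚ._* φ a) (restrict-no (d ∣? a) ¬p)) (ℚ.*-zeroˡ (φ a))) ⟨
      ∑ (filter (d ∣?_) (range N)) (λ a → f d ℚ.* φ a)
        ≤⟨ ∑-⊆ (Unique.filter⁺ (d ∣?_) (range-unique N)) ⊆ (λ {a} _ → 0≤* (nonNeg wf d) (nonNeg wφ a)) ⟩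
      ∑ (map (d ℕ.*_) (cofactors N d)) (λ a → f d ℚ.* φ a)
        ≡⟨ ∑-map (d ℕ.*_) (cofactors N d) (λ a → f d ℚ.* φ a) ⟩
      ∑ (cofactors N d) (λ b → f d ℚ.* φ (d ℕ.* b))
        ≤⟨ ∑-mono (cofactors N d) (λ {b} b∈ → *-monoˡ (nonNeg wf d)
             (submult wφ 1≤d (proj₁ (∈-range⁻ (proj₁ (∈-cofactors⁻ N d b∈)))))) ⟩
      ∑ (cofactors N d) (λ b → f d ℚ.* (φ d ℚ.* φ b))
        ≡⟨ ∑-cong (cofactors N d) (λ b → sym (ℚ.*-assoc (f d) (φ d) (φ b))) ⟩
      ∑ (cofactors N d) (λ b → f d ℚ.* φ d ℚ.* φ b)
        ≡⟨ ∑-*ˡ (cofactors N d) (f d ℚ.* φ d) φ ⟩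
      f d ℚ.* φ d ℚ.* ∑ (cofactors N d) φ ∎
      where
      ⊆ : ∀ {a} → a ∈ filter (d ∣?_) (range N) → a ∈ map (d ℕ.*_) (cofactors N d)
      ⊆ a∈ with a∈range , divides q refl ← ∈-filter⁻ (d ∣?_) {xs = range N} a∈ =
        subst (_∈ map (d ℕ.*_) (cofactors N d)) (ℕ.*-comm d q) (∈-map⁺ (d ℕ.*_) (∈-filter⁺ (λ b → d ℕ.* b ℕ.≤? N)
          (∈-range⁺ 1≤q (ℕ.≤-trans (ℕ.m≤m*n q d {{ℕ.>-nonZero 1≤d}}) q*d≤N)) (subst (ℕ._≤ N) (ℕ.*-comm q d) q*d≤N)))
        where
        1≤q*d = proj₁ (∈-range⁻ a∈range)
        q*d≤N = proj₂ (∈-range⁻ {N} a∈range)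
        1≤q = ∣⇒1≤ 1≤q*d (ℕ∣.m∣m*n d)

  -- The weight left on d by the induction for `moment`: f(d) from opening one factor `s`, s(d)^m
  -- from the remaining ones, 1/d from the density of the multiples of d.
  φ : ℕ → ℕ → ℚ
  φ m d = f d ℚ.* inv d ℚ.* s d ^ℚ m

  weight-φ : ∀ m → Weight (φ m)
  weight-φ m = weight-* (weight-* wf weight-inv) (weight-^ weight-s m)

  module _ (K₀ : ℕ) (∑φ₀ : ∀ N → ∑ (range N) (λ d → f d ℚ.* inv d) ℚ.≤ ι K₀) where

    K : ℕ → ℕ
    K zero    = K₀
    K (suc m) = K m ℕ.* K m

    -- Since f ≤ 1 the factor f d φ d from ∑-s* is again at most φ d, so each further power of s
    -- squares the previous bound.
    ∑φ≤K : ∀ m N → ∑ (range N) (φ m) ℚ.≤ ι (K m)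
    ∑φ≤K zero    N = subst (ℚ._≤ ι K₀) (∑-cong (range N) (λ d → sym (ℚ.*-identityʳ _))) (∑φ₀ N)
    ∑φ≤K (suc m) N = begin
      ∑ (range N) (φ (suc m))
        ≡⟨ ∑-cong (range N) (λ d → solve 4 (λ a b c e → a :* b :* (c :* e) := c :* (a :* b :* e)) refl (f d) (inv d) (s d) (s d ^ℚ m)) ⟩
      ∑ (range N) (λ d → s d ℚ.* φ m d)
        ≤⟨ ∑-s* (weight-φ m) N ⟩
      ∑ (range N) (λ d → f d ℚ.* φ m d ℚ.* ∑ (cofactors N d) (φ m))
        ≤⟨ ∑-mono (range N) (λ {d} _ → *-mono (0≤φ d) (∑-nonNeg (cofactors N d) (λ {b} _ → 0≤φ b))
             (subst (f d ℚ.* φ m d ℚ.≤_) (ℚ.*-identityˡ (φ m d)) (*-monoʳ (0≤φ d) (f≤1 d)))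
             (ℚ.≤-trans (∑-⊆ (cofactors-unique N d)
               (λ b∈ → proj₁ (∈-cofactors⁻ N d b∈)) (λ {b} _ → 0≤φ b)) (∑φ≤K m N))) ⟩
      ∑ (range N) (λ d → φ m d ℚ.* ι (K m))
        ≡⟨ ∑-*ʳ (range N) (ι (K m)) (φ m) ⟩
      ∑ (range N) (φ m) ℚ.* ι (K m)
        ≤⟨ *-monoʳ (0≤ι (K m)) (∑φ≤K m N) ⟩
      ι (K m) ℚ.* ι (K m)
        ≡⟨ ι-* (K m) (K m) ⟨
      ι (K (suc m)) ∎
      where
      open ℚ.≤-Reasoning
      open ℚ.+-*-Solver
      0≤φ = nonNeg (weight-φ m)

    C : ℕ → ℕ
    C zero    = 1
    C (suc m) = C m ℕ.* K m

    -- One of the m + 1 factors is opened by `∑-s*`. The induction hypothesis at N/d supplies the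
    -- factor N/d, and the remaining sum over d is the one bounded in `∑φ≤K`.
    moment : ∀ m N → ∑ (range N) (λ a → s a ^ℚ m) ℚ.≤ ι (C m) ℚ.* ι N
    moment zero    N = ℚ.≤-reflexive (trans (∑-const (range N) 1ℚ) (trans (ℚ.*-comm (ι (length (range N))) 1ℚ)
      (cong₂ ℚ._*_ (sym ι1) (cong ι (length-applyUpTo suc N)))))
    moment (suc m) N = begin
      ∑ (range N) (λ a → s a ^ℚ suc m)
        ≤⟨ ∑-s* wsᵐ N ⟩
      ∑ (range N) (λ d → f d ℚ.* s d ^ℚ m ℚ.* ∑ (cofactors N d) (λ b → s b ^ℚ m))
        ≤⟨ ∑-mono (range N) (λ {d} d∈ → *-monoˡ (0≤* (nonNeg wf d) (nonNeg wsᵐ d)) (cofactor-moment d (proj₁ (∈-range⁻ d∈)))) ⟩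
      ∑ (range N) (λ d → f d ℚ.* s d ^ℚ m ℚ.* (ι (C m) ℚ.* ι N ℚ.* inv d))
        ≡⟨ ∑-cong (range N) (λ d → solve 5 (λ a b c e i → a :* b :* (c :* e :* i) := c :* e :* (a :* i :* b)) refl
             (f d) (s d ^ℚ m) (ι (C m)) (ι N) (inv d)) ⟩
      ∑ (range N) (λ d → ι (C m) ℚ.* ι N ℚ.* φ m d)
        ≡⟨ ∑-*ˡ (range N) (ι (C m) ℚ.* ι N) (φ m) ⟩
      ι (C m) ℚ.* ι N ℚ.* ∑ (range N) (φ m)
        ≤⟨ *-monoˡ (0≤* (0≤ι (C m)) (0≤ι N)) (∑φ≤K m N) ⟩
      ι (C m) ℚ.* ι N ℚ.* ι (K m)
        ≡⟨ solve 3 (λ a b c → a :* b :* c := a :* c :* b) refl (ι (C m)) (ι N) (ι (K m)) ⟩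
      ι (C m) ℚ.* ι (K m) ℚ.* ι N
        ≡⟨ cong (ℚ._* ι N) (ι-* (C m) (K m)) ⟨
      ι (C (suc m)) ℚ.* ι N ∎
      where
      open ℚ.≤-Reasoning
      open ℚ.+-*-Solver
      wsᵐ = weight-^ weight-s m
      cofactor-moment : ∀ d → 1 ℕ.≤ d → ∑ (cofactors N d) (λ b → s b ^ℚ m) ℚ.≤ ι (C m) ℚ.* ι N ℚ.* inv d
      cofactor-moment (suc d-1) 1≤d = begin
        ∑ (cofactors N d) (λ b → s b ^ℚ m)    ≤⟨ ∑-⊆ (cofactors-unique N d) ⊆ (λ {b} _ → nonNeg wsᵐ b) ⟩
        ∑ (range (N ℕ./ d)) (λ b → s b ^ℚ m)  ≤⟨ moment m (N ℕ./ d) ⟩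
        ι (C m) ℚ.* ι (N ℕ./ d)
          ≤⟨ *-monoˡ (0≤ι (C m)) (≤-inv 1≤d (subst (ℚ._≤ ι N) (ι-* (N ℕ./ d) d) (ι-mono (ℕ.m/n*n≤m N d)))) ⟩
        ι (C m) ℚ.* (ι N ℚ.* inv d)           ≡⟨ ℚ.*-assoc (ι (C m)) (ι N) (inv d) ⟨
        ι (C m) ℚ.* ι N ℚ.* inv d             ∎
        where
        d = suc d-1
        ⊆ : ∀ {b} → b ∈ cofactors N d → b ∈ range (N ℕ./ d)
        ⊆ {b} b∈ with b∈range , db≤N ← ∈-cofactors⁻ N d b∈ =
          ∈-range⁺ (proj₁ (∈-range⁻ b∈range)) (subst (ℕ._≤ N ℕ./ d) (trans (cong (ℕ._/ d) (ℕ.*-comm d b)) (ℕ.m*n/n≡m b d)) (ℕ./-monoˡ-≤ d db≤N))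

-- The weight 2^(−⌊log_R d⌋)

module _ {P : ℕ → Set} (P? : ∀ q → Dec (P q)) where

  -- 0 if P holds nowhere in [0, n].
  largest : ℕ → ℕ
  largest zero    = 0
  largest (suc n) with P? (suc n)
  ... | yes _ = suc n
  ... | no  _ = largest n

  largest-sat : P 0 → ∀ n → P (largest n)
  largest-sat P0 zero    = P0
  largest-sat P0 (suc n) with P? (suc n)
  ... | yes p = p
  ... | no  _ = largest-sat P0 n

  largest-max : ∀ {q} n → q ℕ.≤ n → P q → q ℕ.≤ largest n
  largest-max zero ℕ.z≤n p = ℕ.z≤n
  largest-max (suc n) q≤1+n p with P? (suc n)
  ... | yes _ = q≤1+n
  ... | no ¬p = largest-max n (ℕ.≤-pred (ℕ.≤∧≢⇒< q≤1+n λ { refl → ¬p p })) p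

  largest≤ : ∀ n → largest n ℕ.≤ n
  largest≤ zero    = ℕ.z≤n
  largest≤ (suc n) with P? (suc n)
  ... | yes _ = ℕ.≤-refl
  ... | no  _ = ℕ.m≤n⇒m≤1+n (largest≤ n)

1≤m^n : ∀ {m} n → 1 ℕ.≤ m → 1 ℕ.≤ m ℕ.^ n
1≤m^n {m} n 1≤m = ℕ.m^n>0 m {{ℕ.>-nonZero 1≤m}} n

n<m^n : ∀ {m} n → 2 ℕ.≤ m → n ℕ.< m ℕ.^ n
n<m^n zero    2≤m = ℕ.≤-refl
n<m^n {m} (suc n) 2≤m = ℕ.≤-trans (ℕ.+-mono-≤ (1≤m^n n (ℕ.≤-trans (ℕ.s≤s ℕ.z≤n) 2≤m)) (n<m^n n 2≤m))
  (ℕ.≤-trans (ℕ.≤-reflexive (cong (m ℕ.^ n ℕ.+_) (sym (ℕ.+-identityʳ (m ℕ.^ n))))) (ℕ.*-monoˡ-≤ (m ℕ.^ n) 2≤m))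

-- The partial sum is exactly 2 - 2 (1/2)^n.
∑-geometric : ∀ n → ∑ (downFrom n) (½ ^ℚ_) ℚ.≤ ι 2
∑-geometric n = subst (∑ (downFrom n) (½ ^ℚ_) ℚ.≤_) (exact n)
  (subst (ℚ._≤ ∑ (downFrom n) (½ ^ℚ_) ℚ.+ ι 2 ℚ.* ½ ^ℚ n) (ℚ.+-identityʳ _)
    (ℚ.+-monoʳ-≤ (∑ (downFrom n) (½ ^ℚ_)) (0≤* (0≤ι 2) (^-nonNeg n 0≤½))))
  where
  open ℚ.+-*-Solver
  2*½ : ι 2 ℚ.* ½ ≡ 1ℚ
  2*½ = cong (ℚ._* ½) (ι-def 2)
  2≡1+1 : ι 2 ≡ 1ℚ ℚ.+ 1ℚ
  2≡1+1 = ι-def 2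
  exact : ∀ n → ∑ (downFrom n) (½ ^ℚ_) ℚ.+ ι 2 ℚ.* ½ ^ℚ n ≡ ι 2
  exact zero    = trans (ℚ.+-identityˡ (ι 2 ℚ.* 1ℚ)) (ℚ.*-identityʳ (ι 2))
  exact (suc n) = trans (trans (cong (½ ^ℚ n ℚ.+ S ℚ.+_) (trans (sym (ℚ.*-assoc (ι 2) ½ (½ ^ℚ n))) (cong (ℚ._* ½ ^ℚ n) 2*½)))
    (solve 2 (λ h S → h :+ S :+ con 1ℚ :* h := S :+ (con 1ℚ :+ con 1ℚ) :* h) refl (½ ^ℚ n) S))
    (trans (cong (λ t → S ℚ.+ t ℚ.* ½ ^ℚ n) (sym 2≡1+1)) (exact n))
    where S = ∑ (downFrom n) (½ ^ℚ_)

inv-antitone : ∀ {c d} → 1 ℕ.≤ c → c ℕ.≤ d → inv d ℚ.≤ inv c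
inv-antitone {c} {d} 1≤c c≤d = subst (inv d ℚ.≤_) (ℚ.*-identityˡ (inv c)) (≤-inv 1≤c
  (subst (inv d ℚ.* ι c ℚ.≤_) (inv-* (ℕ.≤-trans 1≤c c≤d)) (*-monoˡ (0≤inv d) (ι-mono c≤d))))

module LogWeight (R : ℕ) (2≤R : 2 ℕ.≤ R) where

  -- This is ⌊log_R d⌋ for d ≥ 1. Searching only up to d loses nothing, because q < R^q.
  v : ℕ → ℕ
  v d = largest (λ q → R ℕ.^ q ℕ.≤? d) d

  1≤R : 1 ℕ.≤ R
  1≤R = ℕ.≤-trans (ℕ.s≤s ℕ.z≤n) 2≤R

  R^v≤ : ∀ {d} → 1 ℕ.≤ d → R ℕ.^ v d ℕ.≤ d
  R^v≤ {d} 1≤d = largest-sat (λ q → R ℕ.^ q ℕ.≤? d) 1≤d d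

  v-max : ∀ {q d} → R ℕ.^ q ℕ.≤ d → q ℕ.≤ v d
  v-max {q} {d} R^q≤d = largest-max (λ q → R ℕ.^ q ℕ.≤? d) d (ℕ.≤-trans (ℕ.<⇒≤ (n<m^n q 2≤R)) R^q≤d) R^q≤d

  f : ℕ → ℚ
  f d = ½ ^ℚ v d

  f≤1 : ∀ d → f d ℚ.≤ 1ℚ
  f≤1 d = ^-antitone {n = v d} 0≤½ ½≤1 ℕ.z≤n

  -- The logarithm `v` is superadditive, since R^(v a + v b) ≤ a b, and powers of 1/2 reverse the
  -- order.
  weight-f : Weight f
  weight-f = record
    { nonNeg  = λ d → ^-nonNeg (v d) 0≤½
    ; submult = λ {a} {b} 1≤a 1≤b → ℚ.≤-trans
        (^-antitone {m = v a ℕ.+ v b} 0≤½ ½≤1 (v-max (subst (ℕ._≤ a ℕ.* b)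
          (sym (ℕ.^-distribˡ-+-* R (v a) (v b))) (ℕ.*-mono-≤ (R^v≤ 1≤a) (R^v≤ 1≤b)))))
        (ℚ.≤-reflexive (^-homo-* ½ (v a) (v b)))
    }

  -- It covers every d with `v d` = q. Running past R^(q+1) avoids a subtraction and is harmless,
  -- because the bounds v d ≥ q and d ≥ R^q persist.
  block : ℕ → List ℕ
  block q = applyUpTo (R ℕ.^ q ℕ.+_) (R ℕ.^ q ℕ.* R)

  ∈-block : ∀ {d} → 1 ℕ.≤ d → d ∈ block (v d)
  ∈-block {d} 1≤d = subst (_∈ block (v d)) (ℕ.m+[n∸m]≡n (R^v≤ 1≤d))
    (∈-applyUpTo⁺ (R ℕ.^ v d ℕ.+_) (ℕ.≤-<-trans (ℕ.m∸n≤m d (R ℕ.^ v d))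
      (ℕ.≰⇒> λ h → ℕ.1+n≰n (v-max {suc (v d)} (subst (ℕ._≤ d) (ℕ.*-comm (R ℕ.^ v d) R) h)))))

  -- A block has R^(q+1) entries, each contributing at most 2^(-q) / R^q, so the blocks form a
  -- geometric series with factor `R`.
  ∑f*inv≤ : ∀ N → ∑ (range N) (λ d → f d ℚ.* inv d) ℚ.≤ ι (R ℕ.* 2)
  ∑f*inv≤ N = begin
    ∑ (range N) g                                       ≤⟨ ∑-⊆ (range-unique N) ⊆ (λ {d} _ → 0≤g d) ⟩
    ∑ (concatMap block (downFrom (suc N))) g            ≡⟨ ∑-concatMap block (downFrom (suc N)) g ⟩
    ∑ (downFrom (suc N)) (λ q → ∑ (block q) g)          ≤⟨ ∑-mono (downFrom (suc N)) (λ {q} _ → ∑-block q) ⟩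
    ∑ (downFrom (suc N)) (λ q → ι R ℚ.* ½ ^ℚ q)         ≡⟨ ∑-*ˡ (downFrom (suc N)) (ι R) (½ ^ℚ_) ⟩
    ι R ℚ.* ∑ (downFrom (suc N)) (½ ^ℚ_)                ≤⟨ *-monoˡ (0≤ι R) (∑-geometric (suc N)) ⟩
    ι R ℚ.* ι 2                                         ≡⟨ ι-* R 2 ⟨
    ι (R ℕ.* 2)                                         ∎
    where
    open ℚ.≤-Reasoning
    g : ℕ → ℚ
    g d = f d ℚ.* inv d
    0≤g : ∀ d → 0ℚ ℚ.≤ g d
    0≤g d = 0≤* (^-nonNeg (v d) 0≤½) (0≤inv d)
    ⊆ : ∀ {d} → d ∈ range N → d ∈ concatMap block (downFrom (suc N))
    ⊆ {d} d∈ = let 1≤d , d≤N = ∈-range⁻ d∈ in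
      ∈-concatMap⁺ block (lose (∈-downFrom⁺ (ℕ.s≤s (ℕ.≤-trans (largest≤ (λ q → R ℕ.^ q ℕ.≤? d) d) d≤N))) (∈-block 1≤d))
    ∑-block : ∀ q → ∑ (block q) g ℚ.≤ ι R ℚ.* ½ ^ℚ q
    ∑-block q = begin
      ∑ (block q) g                                          ≤⟨ ∑-mono (block q) g≤ ⟩
      ∑ (block q) (λ _ → ½ ^ℚ q ℚ.* inv (R ℕ.^ q))           ≡⟨ ∑-const (block q) (½ ^ℚ q ℚ.* inv (R ℕ.^ q)) ⟩
      ι (length (block q)) ℚ.* (½ ^ℚ q ℚ.* inv (R ℕ.^ q))
        ≡⟨ cong (ℚ._* (½ ^ℚ q ℚ.* inv (R ℕ.^ q))) (trans (cong ι (length-applyUpTo (R ℕ.^ q ℕ.+_) (R ℕ.^ q ℕ.* R))) (ι-* (R ℕ.^ q) R)) ⟩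
      ι (R ℕ.^ q) ℚ.* ι R ℚ.* (½ ^ℚ q ℚ.* inv (R ℕ.^ q))
        ≡⟨ solve 4 (λ a b c e → a :* b :* (c :* e) := b :* c :* (e :* a)) refl (ι (R ℕ.^ q)) (ι R) (½ ^ℚ q) (inv (R ℕ.^ q)) ⟩
      ι R ℚ.* ½ ^ℚ q ℚ.* (inv (R ℕ.^ q) ℚ.* ι (R ℕ.^ q))     ≡⟨ cong (ι R ℚ.* ½ ^ℚ q ℚ.*_) (inv-* (1≤m^n q 1≤R)) ⟩
      ι R ℚ.* ½ ^ℚ q ℚ.* 1ℚ                                  ≡⟨ ℚ.*-identityʳ (ι R ℚ.* ½ ^ℚ q) ⟩
      ι R ℚ.* ½ ^ℚ q                                         ∎
      where
      open ℚ.+-*-Solver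
      g≤ : ∀ {d} → d ∈ block q → g d ℚ.≤ ½ ^ℚ q ℚ.* inv (R ℕ.^ q)
      g≤ d∈ with i , _ , refl ← ∈-applyUpTo⁻ (R ℕ.^ q ℕ.+_) d∈ = *-mono (^-nonNeg q 0≤½) (0≤inv (R ℕ.^ q ℕ.+ i))
        (^-antitone {m = q} 0≤½ ½≤1 (v-max (ℕ.m≤m+n (R ℕ.^ q) i))) (inv-antitone (1≤m^n q 1≤R) (ℕ.m≤m+n (R ℕ.^ q) i))

  open Moments f weight-f f≤1 public using (s; weight-s)

  -- `K` is squared at every step, so these constants are enormous; sealing prevents their
  -- evaluation.
  opaque
    C : ℕ → ℕ
    C = Moments.C f weight-f f≤1 (R ℕ.* 2) ∑f*inv≤

    moment : ∀ m N → ∑ (range N) (λ a → s a ^ℚ m) ℚ.≤ ι (C m) ℚ.* ι N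
    moment = Moments.moment f weight-f f≤1 (R ℕ.* 2) ∑f*inv≤

-- Counting tuples with a large common divisor

Π : ∀ {k} → (Fin k → ℕ) → ℕ
Π x = product (tabulate x)

Π-mono : ∀ {k} {x y : Fin k → ℕ} → (∀ i → x i ℕ.≤ y i) → Π x ℕ.≤ Π y
Π-mono {zero}  h = ℕ.≤-refl
Π-mono {suc k} h = ℕ.*-mono-≤ (h zero) (Π-mono (h ∘ suc))

Π-* : ∀ {k} (x y : Fin k → ℕ) → Π (λ i → x i ℕ.* y i) ≡ Π x ℕ.* Π y
Π-* {zero}  x y = refl
Π-* {suc k} x y = trans (cong (x zero ℕ.* y zero ℕ.*_) (Π-* (x ∘ suc) (y ∘ suc)))
  (solve 4 (λ a b c d → a :* b :* (c :* d) := a :* c :* (b :* d)) refl (x zero) (y zero) (Π (x ∘ suc)) (Π (y ∘ suc)))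
  where open ℕ.+-*-Solver

Π-const : ∀ k c → Π {k} (λ _ → c) ≡ c ℕ.^ k
Π-const zero    c = refl
Π-const (suc k) c = cong (c ℕ.*_) (Π-const k c)

^-distribʳ-* : ∀ n a b → (a ℕ.* b) ℕ.^ n ≡ a ℕ.^ n ℕ.* b ℕ.^ n
^-distribʳ-* n a b = trans (sym (Π-const n (a ℕ.* b)))
  (trans (Π-* {n} (λ _ → a) (λ _ → b)) (cong₂ ℕ._*_ (Π-const n a) (Π-const n b)))

1≤Π : ∀ {k} {x : Fin k → ℕ} → (∀ i → 1 ℕ.≤ x i) → 1 ℕ.≤ Π x
1≤Π {zero}  h = ℕ.≤-refl
1≤Π {suc k} h = 1≤m*n (h zero) (1≤Π (h ∘ suc))

Π-*-const : ∀ {k} c (x : Fin k → ℕ) → Π (λ i → x i ℕ.* c) ≡ Π x ℕ.* c ℕ.^ k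
Π-*-const {k} c x = trans (Π-* x (λ _ → c)) (cong (Π x ℕ.*_) (Π-const k c))

-- Factor i is kept and each of the k others is replaced by N j / d; the division is cleared.
Π-≤-single : ∀ {k} d (x N : Fin (suc k) → ℕ) → (∀ i → x i ℕ.* d ℕ.≤ N i) →
             ∀ i → Π x ℕ.* d ℕ.^ k ℕ.* N i ℕ.≤ x i ℕ.* Π N
Π-≤-single {k} d x N xd≤N zero = begin
  x zero ℕ.* Π (x ∘ suc) ℕ.* d ℕ.^ k ℕ.* N zero
    ≡⟨ solve 4 (λ a b c e → a :* b :* c :* e := a :* (e :* (b :* c))) refl (x zero) (Π (x ∘ suc)) (d ℕ.^ k) (N zero) ⟩
  x zero ℕ.* (N zero ℕ.* (Π (x ∘ suc) ℕ.* d ℕ.^ k))  ≡⟨ cong (λ t → x zero ℕ.* (N zero ℕ.* t)) (Π-*-const d (x ∘ suc)) ⟨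
  x zero ℕ.* (N zero ℕ.* Π (λ i → x (suc i) ℕ.* d))  ≤⟨ ℕ.*-monoʳ-≤ (x zero) (ℕ.*-monoʳ-≤ (N zero) (Π-mono (xd≤N ∘ suc))) ⟩
  x zero ℕ.* Π N                                     ∎
  where
  open ℕ.≤-Reasoning
  open ℕ.+-*-Solver
Π-≤-single {suc k} d x N xd≤N (suc i) = begin
  x zero ℕ.* Π (x ∘ suc) ℕ.* (d ℕ.* d ℕ.^ k) ℕ.* N (suc i)
    ≡⟨ solve 5 (λ a b c e g → a :* b :* (c :* e) :* g := (a :* c) :* (b :* e :* g)) refl (x zero) (Π (x ∘ suc)) d (d ℕ.^ k) (N (suc i)) ⟩
  x zero ℕ.* d ℕ.* (Π (x ∘ suc) ℕ.* d ℕ.^ k ℕ.* N (suc i))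
    ≤⟨ ℕ.*-mono-≤ (xd≤N zero) (Π-≤-single d (x ∘ suc) (N ∘ suc) (xd≤N ∘ suc) i) ⟩
  N zero ℕ.* (x (suc i) ℕ.* Π (N ∘ suc))
    ≡⟨ solve 3 (λ a b c → a :* (b :* c) := b :* (a :* c)) refl (N zero) (x (suc i)) (Π (N ∘ suc)) ⟩
  x (suc i) ℕ.* Π N                                             ∎
  where
  open ℕ.≤-Reasoning
  open ℕ.+-*-Solver

prodList : ∀ {A : Set} {k} → (Fin k → List A) → List (Vec A k)
prodList {k = zero}  B = [] ∷ []
prodList {k = suc k} B = cartesianProductWith _∷_ (B zero) (prodList (B ∘ suc))

∈-prodList : ∀ {A : Set} {k} (B : Fin k → List A) (t : Vec A k) → (∀ i → lookup t i ∈ B i) → t ∈ prodList B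
∈-prodList B []      h = here refl
∈-prodList B (x ∷ t) h = ∈-cartesianProductWith⁺ _∷_ (h zero) (∈-prodList (B ∘ suc) t (h ∘ suc))

length-cartesianProductWith : ∀ {A B C : Set} (_∙_ : A → B → C) xs ys →
                              length (cartesianProductWith _∙_ xs ys) ≡ length xs ℕ.* length ys
length-cartesianProductWith _∙_ []       ys = refl
length-cartesianProductWith _∙_ (x ∷ xs) ys = trans (length-++ (map (x ∙_) ys))
  (cong₂ ℕ._+_ (length-map (x ∙_) ys) (length-cartesianProductWith _∙_ xs ys))

length-prodList : ∀ {A : Set} {k} (B : Fin k → List A) → length (prodList B) ≡ Π (length ∘ B)
length-prodList {k = zero}  B = refl
length-prodList {k = suc k} B = trans (length-cartesianProductWith _∷_ (B zero) (prodList (B ∘ suc)))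
  (cong (length (B zero) ℕ.*_) (length-prodList (B ∘ suc)))

∑-length-concatMap : ∀ {A B : Set} (h : A → List B) xs → ι (length (concatMap h xs)) ≡ ∑ xs (λ x → ι (length (h x)))
∑-length-concatMap h []       = ι0
∑-length-concatMap h (x ∷ xs) = trans (cong ι (length-++ (h x)))
  (trans (ι-+ (length (h x)) (length (concatMap h xs))) (cong (ι (length (h x)) ℚ.+_) (∑-length-concatMap h xs)))

length-multiples : ∀ {N d xs} → 1 ℕ.≤ d → Unique xs → (∀ {a} → a ∈ xs → 1 ℕ.≤ a × a ℕ.≤ N) →
                   length (filter (d ∣?_) xs) ℕ.* d ℕ.≤ N
length-multiples {N} {suc d-1} {xs} 1≤d u bounds = ℕ.≤-trans (ℕ.*-monoˡ-≤ d (begin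
  length (filter (d ∣?_) xs)               ≤⟨ length-⊆ (Unique.filter⁺ (d ∣?_) u) ⊆ ⟩
  length (map (ℕ._* d) (range (N ℕ./ d)))  ≡⟨ length-map (ℕ._* d) (range (N ℕ./ d)) ⟩
  length (range (N ℕ./ d))                 ≡⟨ length-applyUpTo suc (N ℕ./ d) ⟩
  N ℕ./ d                                  ∎)) (ℕ.m/n*n≤m N d)
  where
  open ℕ.≤-Reasoning
  d = suc d-1
  ⊆ : ∀ {a} → a ∈ filter (d ∣?_) xs → a ∈ map (ℕ._* d) (range (N ℕ./ d))
  ⊆ a∈ with a∈xs , divides q refl ← ∈-filter⁻ (d ∣?_) {xs = xs} a∈ =
    let 1≤a , a≤N = bounds a∈xs in
    ∈-map⁺ (ℕ._* d) (∈-range⁺ (∣⇒1≤ 1≤a (ℕ∣.m∣m*n d)) (subst (ℕ._≤ N ℕ./ d) (ℕ.m*n/n≡m q d) (ℕ./-monoˡ-≤ d a≤N)))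

cancel-ι : ∀ {x y L} → 1 ℕ.≤ L → x ℚ.* ι L ℚ.≤ y ℚ.* ι L → x ℚ.≤ y
cancel-ι {x} {y} {L} 1≤L h = subst (x ℚ.≤_) (inv-cancelʳ 1≤L y) (≤-inv 1≤L h)

-- There are suc k sets, so k is one less than in the theorem.
module Core (R : ℕ) (2≤R : 2 ℕ.≤ R) (b : ℕ) {k : ℕ} (1≤k : 1 ℕ.≤ k)
            (A : Fin (suc k) → List ℕ) (N : Fin (suc k) → ℕ)
            (unique : ∀ i → Unique (A i)) (bounds : ∀ i {a} → a ∈ A i → 1 ℕ.≤ a × a ℕ.≤ N i)
            (T : List (Vec ℕ (suc k))) (uniqueT : Unique T) (T⊆A : ∀ {t} → t ∈ T → ∀ i → lookup t i ∈ A i)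
            (common : ∀ {t} → t ∈ T → ∃ λ d → R ℕ.^ b ℕ.≤ d × (∀ i → d ∣ lookup t i)) where

  open LogWeight R 2≤R

  G = R ℕ.^ b
  M = Π N
  E = length T

  A[_] : ℕ → Fin (suc k) → List ℕ
  A[ d ] i = filter (d ∣?_) (A i)

  -- The cut-off `N zero` suffices: a common divisor divides the first coordinate, which is positive
  -- and at most `N zero`.
  candidates : List ℕ
  candidates = filter (G ℕ.≤?_) (range (N zero))

  E≤∑ : ι E ℚ.≤ ∑ candidates (λ d → ι (Π (length ∘ A[ d ])))
  E≤∑ = begin
    ι E                                                          ≤⟨ ι-mono (length-⊆ uniqueT ⊆) ⟩
    ι (length (concatMap (λ d → prodList A[ d ]) candidates))    ≡⟨ ∑-length-concatMap (λ d → prodList A[ d ]) candidates ⟩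
    ∑ candidates (λ d → ι (length (prodList A[ d ])))
      ≡⟨ ∑-cong candidates (λ d → cong ι (length-prodList A[ d ])) ⟩
    ∑ candidates (λ d → ι (Π (length ∘ A[ d ])))                 ∎
    where
    open ℚ.≤-Reasoning
    ⊆ : ∀ {t} → t ∈ T → t ∈ concatMap (λ d → prodList A[ d ]) candidates
    ⊆ {t} t∈ =
      let d , G≤d , d∣ = common t∈
          1≤t₀ , t₀≤N = bounds zero (T⊆A t∈ zero)
      in ∈-concatMap⁺ (λ d → prodList A[ d ])
           (lose (∈-filter⁺ (G ℕ.≤?_) (∈-range⁺ (∣⇒1≤ 1≤t₀ (d∣ zero)) (ℕ.≤-trans (∣⇒≤ 1≤t₀ (d∣ zero)) t₀≤N)) G≤d)
                 (∈-prodList A[ d ] t (λ i → ∈-filter⁺ (d ∣?_) (T⊆A t∈ i) (d∣ i))))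

  -- With t = v d - b this is 2^t ≤ R^t ≤ d / G: beyond G, the reciprocal of `f` grows no faster
  -- than d. The factor 2^b is the reciprocal of f(G).
  G*2^v≤ : ∀ {d} → 1 ℕ.≤ d → G ℕ.≤ d → G ℕ.* 2 ℕ.^ v d ℕ.≤ 2 ℕ.^ b ℕ.* d
  G*2^v≤ {d} 1≤d G≤d = begin
    G ℕ.* 2 ℕ.^ v d                ≡⟨ cong (λ t → G ℕ.* 2 ℕ.^ t) v≡ ⟩
    G ℕ.* 2 ℕ.^ (b ℕ.+ t)          ≡⟨ cong (G ℕ.*_) (ℕ.^-distribˡ-+-* 2 b t) ⟩
    G ℕ.* (2 ℕ.^ b ℕ.* 2 ℕ.^ t)    ≤⟨ ℕ.*-monoʳ-≤ G (ℕ.*-monoʳ-≤ (2 ℕ.^ b) (ℕ.^-monoˡ-≤ t 2≤R)) ⟩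
    G ℕ.* (2 ℕ.^ b ℕ.* R ℕ.^ t)    ≡⟨ solve 3 (λ a b c → a :* (b :* c) := b :* (a :* c)) refl G (2 ℕ.^ b) (R ℕ.^ t) ⟩
    2 ℕ.^ b ℕ.* (G ℕ.* R ℕ.^ t)    ≡⟨ cong (2 ℕ.^ b ℕ.*_) (trans (sym (ℕ.^-distribˡ-+-* R b t)) (cong (R ℕ.^_) (sym v≡))) ⟩
    2 ℕ.^ b ℕ.* R ℕ.^ v d          ≤⟨ ℕ.*-monoʳ-≤ (2 ℕ.^ b) (R^v≤ 1≤d) ⟩
    2 ℕ.^ b ℕ.* d                  ∎
    where
    open ℕ.≤-Reasoning
    open ℕ.+-*-Solver
    t = v d ℕ.∸ b
    v≡ : v d ≡ b ℕ.+ t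
    v≡ = sym (ℕ.m+[n∸m]≡n (v-max {b} G≤d))

  -- One of the k factors d pays for 2^(v d), the others are bounded below by G. Hence the condition
  -- k ≥ 1, that is, at least two sets.
  G^k*2^v≤ : ∀ {d k} → 1 ℕ.≤ k → 1 ℕ.≤ d → G ℕ.≤ d → G ℕ.^ k ℕ.* 2 ℕ.^ v d ℕ.≤ 2 ℕ.^ b ℕ.* d ℕ.^ k
  G^k*2^v≤ {d} {suc k} _ 1≤d G≤d = begin
    G ℕ.* G ℕ.^ k ℕ.* 2 ℕ.^ v d      ≡⟨ solve 3 (λ a b c → a :* b :* c := (a :* c) :* b) refl G (G ℕ.^ k) (2 ℕ.^ v d) ⟩
    G ℕ.* 2 ℕ.^ v d ℕ.* G ℕ.^ k      ≤⟨ ℕ.*-mono-≤ (G*2^v≤ 1≤d G≤d) (ℕ.^-monoˡ-≤ k G≤d) ⟩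
    2 ℕ.^ b ℕ.* d ℕ.* d ℕ.^ k        ≡⟨ ℕ.*-assoc (2 ℕ.^ b) d (d ℕ.^ k) ⟩
    2 ℕ.^ b ℕ.* (d ℕ.* d ℕ.^ k)      ∎
    where
    open ℕ.≤-Reasoning
    open ℕ.+-*-Solver

  -- After `Π-≤-single` the factor (G/d)^k remains, and it is at most 2^b f(d). The proof multiplies
  -- through by 2^(v d) and d^k to stay in ℕ.
  term≤ : ∀ i {d} → 1 ℕ.≤ d → G ℕ.≤ d →
          ι (N i ℕ.* G ℕ.^ k) ℚ.* ι (Π (length ∘ A[ d ])) ℚ.≤ ι (M ℕ.* 2 ℕ.^ b) ℚ.* (f d ℚ.* ι (length (A[ d ] i)))
  term≤ i {d} 1≤d G≤d = cancel-ι {L = 2 ℕ.^ v d} (1≤m^n (v d) (ℕ.s≤s ℕ.z≤n)) (begin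
    ι (N i ℕ.* G ℕ.^ k) ℚ.* ι P ℚ.* ι (2 ℕ.^ v d)                  ≡⟨ cong (ℚ._* ι (2 ℕ.^ v d)) (ι-* (N i ℕ.* G ℕ.^ k) P) ⟨
    ι (N i ℕ.* G ℕ.^ k ℕ.* P) ℚ.* ι (2 ℕ.^ v d)                    ≡⟨ ι-* (N i ℕ.* G ℕ.^ k ℕ.* P) (2 ℕ.^ v d) ⟨
    ι (N i ℕ.* G ℕ.^ k ℕ.* P ℕ.* 2 ℕ.^ v d)                        ≤⟨ ι-mono natural ⟩
    ι (M ℕ.* 2 ℕ.^ b ℕ.* x)                                        ≡⟨ ι-* (M ℕ.* 2 ℕ.^ b) x ⟩
    ι (M ℕ.* 2 ℕ.^ b) ℚ.* ι x
      ≡⟨ cong (ι (M ℕ.* 2 ℕ.^ b) ℚ.*_) (trans (sym (ℚ.*-identityˡ (ι x))) (cong (ℚ._* ι x) (sym (½^*2^ (v d))))) ⟩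
    ι (M ℕ.* 2 ℕ.^ b) ℚ.* (f d ℚ.* ι (2 ℕ.^ v d) ℚ.* ι x)
      ≡⟨ solveℚ (ι (M ℕ.* 2 ℕ.^ b)) (f d) (ι (2 ℕ.^ v d)) (ι x) ⟩
    ι (M ℕ.* 2 ℕ.^ b) ℚ.* (f d ℚ.* ι x) ℚ.* ι (2 ℕ.^ v d)          ∎)
    where
    open ℚ.≤-Reasoning
    P = Π (length ∘ A[ d ])
    x = length (A[ d ] i)
    solveℚ : ∀ a b c e → a ℚ.* (b ℚ.* c ℚ.* e) ≡ a ℚ.* (b ℚ.* e) ℚ.* c
    solveℚ = solve 4 (λ a b c e → a :* (b :* c :* e) := a :* (b :* e) :* c) refl
      where open ℚ.+-*-Solver
    natural : N i ℕ.* G ℕ.^ k ℕ.* P ℕ.* 2 ℕ.^ v d ℕ.≤ M ℕ.* 2 ℕ.^ b ℕ.* x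
    natural = ℕ.*-cancelʳ-≤ _ _ (d ℕ.^ k) {{ℕ.>-nonZero (1≤m^n k 1≤d)}} (ineq)
      where
      module ≤ = ℕ.≤-Reasoning
      open ℕ.+-*-Solver
      ineq : N i ℕ.* G ℕ.^ k ℕ.* P ℕ.* 2 ℕ.^ v d ℕ.* d ℕ.^ k ℕ.≤ M ℕ.* 2 ℕ.^ b ℕ.* x ℕ.* d ℕ.^ k
      ineq = ≤.begin
        N i ℕ.* G ℕ.^ k ℕ.* P ℕ.* 2 ℕ.^ v d ℕ.* d ℕ.^ k
          ≤.≡⟨ solve 5 (λ a b c e g → a :* b :* c :* e :* g := (c :* g :* a) :* (b :* e)) refl (N i) (G ℕ.^ k) P (2 ℕ.^ v d) (d ℕ.^ k) ⟩
        (P ℕ.* d ℕ.^ k ℕ.* N i) ℕ.* (G ℕ.^ k ℕ.* 2 ℕ.^ v d)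
          ≤.≤⟨ ℕ.*-mono-≤ (Π-≤-single d (length ∘ A[ d ]) N (λ j → length-multiples 1≤d (unique j) (bounds j)) i) (G^k*2^v≤ 1≤k 1≤d G≤d) ⟩
        (x ℕ.* M) ℕ.* (2 ℕ.^ b ℕ.* d ℕ.^ k)
          ≤.≡⟨ solve 4 (λ a b c e → (a :* b) :* (c :* e) := b :* c :* a :* e) refl x M (2 ℕ.^ b) (d ℕ.^ k) ⟩
        M ℕ.* 2 ℕ.^ b ℕ.* x ℕ.* d ℕ.^ k ≤.∎

  -- Pairs d ∣ a are counted from the side of a. There the candidates form only a part of the
  -- divisors over which `s a` sums.
  ∑-candidates≤ : ∀ xs → (∀ {a} → a ∈ xs → 1 ℕ.≤ a) →
                  ∑ candidates (λ d → f d ℚ.* ι (length (filter (d ∣?_) xs))) ℚ.≤ ∑ xs s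
  ∑-candidates≤ xs 1≤ = begin
    ∑ candidates (λ d → f d ℚ.* ι (length (filter (d ∣?_) xs)))    ≡⟨ ∑-cong candidates eq ⟩
    ∑ candidates (λ d → ∑ xs (λ a → restrict (d ∣? a) (f d)))
      ≡⟨ ∑-swap candidates xs (λ d a → restrict (d ∣? a) (f d)) ⟩
    ∑ xs (λ a → ∑ candidates (λ d → restrict (d ∣? a) (f d)))      ≤⟨ ∑-mono xs (λ {a} a∈ → inner a (1≤ a∈)) ⟩
    ∑ xs s                                                         ∎
    where
    open ℚ.≤-Reasoning
    eq : ∀ d → f d ℚ.* ι (length (filter (d ∣?_) xs)) ≡ ∑ xs (λ a → restrict (d ∣? a) (f d))
    eq d = trans (ℚ.*-comm (f d) (ι (length (filter (d ∣?_) xs)))) (trans (sym (∑-const (filter (d ∣?_) xs) (f d)))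
      (∑-filter (d ∣?_) xs (λ _ → f d) (λ a → restrict (d ∣? a) (f d)) (λ {a} → restrict-yes (d ∣? a)) (λ {a} → restrict-no (d ∣? a))))
    inner : ∀ a → 1 ℕ.≤ a → ∑ candidates (λ d → restrict (d ∣? a) (f d)) ℚ.≤ s a
    inner a 1≤a = begin
      ∑ candidates (λ d → restrict (d ∣? a) (f d))
        ≡⟨ ∑-filter (_∣? a) candidates f (λ d → restrict (d ∣? a) (f d)) (λ {d} → restrict-yes (d ∣? a)) (λ {d} → restrict-no (d ∣? a)) ⟨
      ∑ (filter (_∣? a) candidates) f
        ≤⟨ ∑-⊆ (Unique.filter⁺ (_∣? a) (Unique.filter⁺ (G ℕ.≤?_) (range-unique (N zero))))
             (λ d∈ → ∈-divisors⁺ 1≤a (proj₂ (∈-filter⁻ (_∣? a) {xs = candidates} d∈))) (λ {d} _ → Weight.nonNeg weight-f d) ⟩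
      s a ∎

  E≤∑s : ∀ i → ι (N i ℕ.* G ℕ.^ k) ℚ.* ι E ℚ.≤ ι (M ℕ.* 2 ℕ.^ b) ℚ.* ∑ (A i) s
  E≤∑s i = begin
    c ℚ.* ι E
      ≤⟨ *-monoˡ (0≤ι (N i ℕ.* G ℕ.^ k)) E≤∑ ⟩
    c ℚ.* ∑ candidates (λ d → ι (Π (length ∘ A[ d ])))
      ≡⟨ ∑-*ˡ candidates c (λ d → ι (Π (length ∘ A[ d ]))) ⟨
    ∑ candidates (λ d → c ℚ.* ι (Π (length ∘ A[ d ])))
      ≤⟨ ∑-mono candidates (λ d∈ → let d∈range , G≤d = ∈-filter⁻ (G ℕ.≤?_) {xs = range (N zero)} d∈ in term≤ i (proj₁ (∈-range⁻ d∈range)) G≤d) ⟩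
    ∑ candidates (λ d → c′ ℚ.* (f d ℚ.* ι (length (A[ d ] i))))
      ≡⟨ ∑-*ˡ candidates c′ (λ d → f d ℚ.* ι (length (A[ d ] i))) ⟩
    c′ ℚ.* ∑ candidates (λ d → f d ℚ.* ι (length (A[ d ] i)))
      ≤⟨ *-monoˡ (0≤ι (M ℕ.* 2 ℕ.^ b)) (∑-candidates≤ (A i) (λ a∈ → proj₁ (bounds i a∈))) ⟩
    c′ ℚ.* ∑ (A i) s ∎
    where
    open ℚ.≤-Reasoning
    c  = ι (N i ℕ.* G ℕ.^ k)
    c′ = ι (M ℕ.* 2 ℕ.^ b)

  -- Pointwise, B^m s(a) is at most B^(m+1) when s(a) ≤ B and at most s(a)^(m+1) otherwise. The
  -- second part is summed over the whole range up to `N i`.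
  markov : ∀ B m i → ι (B ℕ.^ m) ℚ.* ∑ (A i) s ℚ.≤ ι (B ℕ.^ m ℕ.* B ℕ.* length (A i) ℕ.+ C (suc m) ℕ.* N i)
  markov B m i = begin
    ι (B ℕ.^ m) ℚ.* ∑ (A i) s
      ≡⟨ ∑-*ˡ (A i) (ι (B ℕ.^ m)) s ⟨
    ∑ (A i) (λ a → ι (B ℕ.^ m) ℚ.* s a)
      ≤⟨ ∑-mono (A i) (λ {a} _ → pointwise a) ⟩
    ∑ (A i) (λ a → ι (B ℕ.^ m ℕ.* B) ℚ.+ s a ^ℚ suc m)
      ≡⟨ ∑-+ (A i) (λ _ → ι (B ℕ.^ m ℕ.* B)) (λ a → s a ^ℚ suc m) ⟩
    ∑ (A i) (λ _ → ι (B ℕ.^ m ℕ.* B)) ℚ.+ ∑ (A i) (λ a → s a ^ℚ suc m)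
      ≤⟨ ℚ.+-mono-≤ (ℚ.≤-reflexive constant) power ⟩
    ι (B ℕ.^ m ℕ.* B ℕ.* length (A i)) ℚ.+ ι (C (suc m) ℕ.* N i)
      ≡⟨ ι-+ (B ℕ.^ m ℕ.* B ℕ.* length (A i)) (C (suc m) ℕ.* N i) ⟨
    ι (B ℕ.^ m ℕ.* B ℕ.* length (A i) ℕ.+ C (suc m) ℕ.* N i) ∎
    where
    open ℚ.≤-Reasoning
    0≤s : ∀ a → 0ℚ ℚ.≤ s a
    0≤s = Weight.nonNeg weight-s
    pointwise : ∀ a → ι (B ℕ.^ m) ℚ.* s a ℚ.≤ ι (B ℕ.^ m ℕ.* B) ℚ.+ s a ^ℚ suc m
    pointwise a with ℚ.≤-total (s a) (ι B)
    ... | inj₁ s≤B = begin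
      ι (B ℕ.^ m) ℚ.* s a                  ≤⟨ *-monoˡ (0≤ι (B ℕ.^ m)) s≤B ⟩
      ι (B ℕ.^ m) ℚ.* ι B                  ≡⟨ ι-* (B ℕ.^ m) B ⟨
      ι (B ℕ.^ m ℕ.* B)                    ≡⟨ ℚ.+-identityʳ (ι (B ℕ.^ m ℕ.* B)) ⟨
      ι (B ℕ.^ m ℕ.* B) ℚ.+ 0ℚ             ≤⟨ ℚ.+-monoʳ-≤ (ι (B ℕ.^ m ℕ.* B)) (^-nonNeg (suc m) (0≤s a)) ⟩
      ι (B ℕ.^ m ℕ.* B) ℚ.+ s a ^ℚ suc m   ∎
    ... | inj₂ B≤s = begin
      ι (B ℕ.^ m) ℚ.* s a                  ≡⟨ cong (ℚ._* s a) (ι-^ B m) ⟩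
      ι B ^ℚ m ℚ.* s a                     ≤⟨ *-monoʳ (0≤s a) (^-monoˡ m (0≤ι B) B≤s) ⟩
      s a ^ℚ m ℚ.* s a                     ≡⟨ ℚ.*-comm (s a ^ℚ m) (s a) ⟩
      s a ^ℚ suc m                         ≡⟨ ℚ.+-identityˡ (s a ^ℚ suc m) ⟨
      0ℚ ℚ.+ s a ^ℚ suc m                  ≤⟨ ℚ.+-monoˡ-≤ (s a ^ℚ suc m) (0≤ι (B ℕ.^ m ℕ.* B)) ⟩
      ι (B ℕ.^ m ℕ.* B) ℚ.+ s a ^ℚ suc m   ∎
    constant : ∑ (A i) (λ _ → ι (B ℕ.^ m ℕ.* B)) ≡ ι (B ℕ.^ m ℕ.* B ℕ.* length (A i))
    constant = trans (∑-const (A i) (ι (B ℕ.^ m ℕ.* B))) (trans (ℚ.*-comm (ι (length (A i))) (ι (B ℕ.^ m ℕ.* B)))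
      (sym (ι-* (B ℕ.^ m ℕ.* B) (length (A i)))))
    power : ∑ (A i) (λ a → s a ^ℚ suc m) ℚ.≤ ι (C (suc m) ℕ.* N i)
    power = ℚ.≤-trans (∑-⊆ (unique i) (λ a∈ → let 1≤a , a≤N = bounds i a∈ in ∈-range⁺ 1≤a a≤N) (λ {a} _ → ^-nonNeg (suc m) (0≤s a)))
      (subst (∑ (range (N i)) (λ a → s a ^ℚ suc m) ℚ.≤_) (sym (ι-* (C (suc m)) (N i))) (moment (suc m) (N i)))

  -- The density hypothesis turns the moment term C N i of `markov` into a multiple of |A i| B^m, so
  -- the average of `s` over `A i` is at most B (1 + C).
  E≤single : ∀ B m → 1 ℕ.≤ B → ∀ i → N i ℕ.≤ length (A i) ℕ.* B ℕ.^ m →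
             N i ℕ.* G ℕ.^ k ℕ.* E ℕ.≤ M ℕ.* 2 ℕ.^ b ℕ.* (length (A i) ℕ.* (B ℕ.* suc (C (suc m))))
  E≤single B m 1≤B i N≤ = ι-cancel (cancel-ι {L = B ℕ.^ m} (1≤m^n m 1≤B) (begin
    ι (n ℕ.* E) ℚ.* ι (B ℕ.^ m)                         ≡⟨ cong (ℚ._* ι (B ℕ.^ m)) (ι-* n E) ⟩
    ι n ℚ.* ι E ℚ.* ι (B ℕ.^ m)                         ≤⟨ *-monoʳ (0≤ι (B ℕ.^ m)) (E≤∑s i) ⟩
    ι M′ ℚ.* ∑ (A i) s ℚ.* ι (B ℕ.^ m)
      ≡⟨ solve 3 (λ a b c → a :* b :* c := a :* (c :* b)) refl (ι M′) (∑ (A i) s) (ι (B ℕ.^ m)) ⟩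
    ι M′ ℚ.* (ι (B ℕ.^ m) ℚ.* ∑ (A i) s)                ≤⟨ *-monoˡ (0≤ι M′) (ℚ.≤-trans (markov B m i) (ι-mono natural)) ⟩
    ι M′ ℚ.* ι (y ℕ.* B ℕ.^ m)                          ≡⟨ ι-* M′ (y ℕ.* B ℕ.^ m) ⟨
    ι (M′ ℕ.* (y ℕ.* B ℕ.^ m))                          ≡⟨ cong ι (ℕ.*-assoc M′ y (B ℕ.^ m)) ⟨
    ι (M′ ℕ.* y ℕ.* B ℕ.^ m)                            ≡⟨ ι-* (M′ ℕ.* y) (B ℕ.^ m) ⟩
    ι (M′ ℕ.* y) ℚ.* ι (B ℕ.^ m)                        ∎))
    where
    open ℚ.≤-Reasoning
    open ℚ.+-*-Solver
    n = N i ℕ.* G ℕ.^ k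
    M′ = M ℕ.* 2 ℕ.^ b
    c = C (suc m)
    l = length (A i)
    y = l ℕ.* (B ℕ.* suc c)
    natural : B ℕ.^ m ℕ.* B ℕ.* l ℕ.+ c ℕ.* N i ℕ.≤ y ℕ.* B ℕ.^ m
    natural = ℕ.≤-trans
      (ℕ.+-monoʳ-≤ (B ℕ.^ m ℕ.* B ℕ.* l) (ℕ.*-monoʳ-≤ c (ℕ.≤-trans N≤ (ℕ.m≤m*n (l ℕ.* B ℕ.^ m) B {{ℕ.>-nonZero 1≤B}}))))
      (ℕ.≤-reflexive (solveℕ (B ℕ.^ m) B l c))
      where
      solveℕ : ∀ p B l c → p ℕ.* B ℕ.* l ℕ.+ c ℕ.* (l ℕ.* p ℕ.* B) ≡ l ℕ.* (B ℕ.* suc c) ℕ.* p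
      solveℕ = S.solve 4 (λ p B l c → p S.:* B S.:* l S.:+ c S.:* (l S.:* p S.:* B) S.:= l S.:* (B S.:* (S.con 1 S.:+ c)) S.:* p) refl
        where module S = ℕ.+-*-Solver

  energy : ∀ B m → 1 ℕ.≤ B → (∀ i → 1 ℕ.≤ N i) → (∀ i → N i ℕ.≤ length (A i) ℕ.* B ℕ.^ m) →
           (G ℕ.^ k ℕ.* E) ℕ.^ suc k ℕ.≤ M ℕ.^ k ℕ.* (Π (length ∘ A) ℕ.* (2 ℕ.^ b ℕ.* (B ℕ.* suc (C (suc m)))) ℕ.^ suc k)
  -- Multiplying `E≤single` over all i produces `M` on the left from the factors N i, and it cancels
  -- one of the `suc k` copies of `M` on the right.
  energy B m 1≤B 1≤N N≤ = ℕ.*-cancelˡ-≤ M {{ℕ.>-nonZero (1≤Π 1≤N)}} (begin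
    M ℕ.* (G ℕ.^ k ℕ.* E) ℕ.^ suc k                     ≡⟨ Π-*-const (G ℕ.^ k ℕ.* E) N ⟨
    Π (λ i → N i ℕ.* (G ℕ.^ k ℕ.* E))
      ≤⟨ Π-mono (λ i → ℕ.≤-trans (ℕ.≤-reflexive (sym (ℕ.*-assoc (N i) (G ℕ.^ k) E)))
                                                             (ℕ.≤-trans (E≤single B m 1≤B i (N≤ i)) (ℕ.≤-reflexive (rearrange (length (A i)))))) ⟩
    Π (λ i → length (A i) ℕ.* (c ℕ.* M))                ≡⟨ Π-*-const (c ℕ.* M) (length ∘ A) ⟩
    P ℕ.* (c ℕ.* M) ℕ.^ suc k                           ≡⟨ cong (P ℕ.*_) (^-distribʳ-* (suc k) c M) ⟩
    P ℕ.* (c ℕ.^ suc k ℕ.* (M ℕ.* M ℕ.^ k))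
      ≡⟨ solve 4 (λ a b c d → a :* (b :* (c :* d)) := c :* (d :* (a :* b))) refl P (c ℕ.^ suc k) M (M ℕ.^ k) ⟩
    M ℕ.* (M ℕ.^ k ℕ.* (P ℕ.* c ℕ.^ suc k))             ∎)
    where
    open ℕ.≤-Reasoning
    open ℕ.+-*-Solver
    P = Π (length ∘ A)
    c = 2 ℕ.^ b ℕ.* (B ℕ.* suc (C (suc m)))
    rearrange : ∀ l → M ℕ.* 2 ℕ.^ b ℕ.* (l ℕ.* (B ℕ.* suc (C (suc m)))) ≡ l ℕ.* (c ℕ.* M)
    rearrange l = solve 4 (λ a b c d → a :* b :* (c :* d) := c :* (b :* d :* a)) refl M (2 ℕ.^ b) l (B ℕ.* suc (C (suc m)))

-- The bound in natural numbers

^-cancelˡ-≤ : ∀ {a b} k → 1 ℕ.≤ k → a ℕ.^ k ℕ.≤ b ℕ.^ k → a ℕ.≤ b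
^-cancelˡ-≤ {a} {b} (suc k) _ h = ι-cancel (^-cancel k (0≤ι b) (subst₂ ℚ._≤_ (ι-^ a (suc k)) (ι-^ b (suc k)) (ι-mono h)))

-- Multiply the first hypothesis by P^k, bound the resulting P^(k+1) by the second, cancel E^(k+1)
-- and take k-th roots. For the root, c^(k+1) is enlarged to (c c)^k and v + 1 to 2 v. `Q` is
-- carried along to give the constant its final form.
root-bound : ∀ {k E B P M v c q} Q → 1 ℕ.≤ k → 1 ℕ.≤ E → 1 ℕ.≤ v → 1 ℕ.≤ c →
             E ℕ.^ suc k ℕ.* B ℕ.^ (q ℕ.* k) ℕ.≤ M ℕ.^ k ℕ.* (P ℕ.* c ℕ.^ suc k) →
             P ℕ.^ suc k ℕ.≤ suc v ℕ.^ k ℕ.* E ℕ.^ suc k →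
             Q ℕ.* P ℕ.* B ℕ.^ q ℕ.≤ Q ℕ.* (2 ℕ.* (c ℕ.* c)) ℕ.* M ℕ.* v
root-bound {k} {E} {B} {P} {M} {v} {c} {q} Q 1≤k 1≤E 1≤v 1≤c h₁ h₂ =
  ^-cancelˡ-≤ k 1≤k (ℕ.*-cancelʳ-≤ _ _ (E ℕ.^ suc k) {{ℕ.>-nonZero (1≤m^n (suc k) 1≤E)}} (begin
    (Q ℕ.* P ℕ.* B ℕ.^ q) ℕ.^ k ℕ.* E ℕ.^ suc k
      ≡⟨ cong (ℕ._* E ℕ.^ suc k) (trans (^-distribʳ-* k (Q ℕ.* P) (B ℕ.^ q)) (cong₂ ℕ._*_ (^-distribʳ-* k Q P) (ℕ.^-*-assoc B q k))) ⟩
    Q ℕ.^ k ℕ.* P ℕ.^ k ℕ.* B ℕ.^ (q ℕ.* k) ℕ.* E ℕ.^ suc k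
      ≡⟨ solve 4 (λ a b c d → a :* b :* c :* d := a :* b :* (d :* c)) refl (Q ℕ.^ k) (P ℕ.^ k) (B ℕ.^ (q ℕ.* k)) (E ℕ.^ suc k) ⟩
    Q ℕ.^ k ℕ.* P ℕ.^ k ℕ.* (E ℕ.^ suc k ℕ.* B ℕ.^ (q ℕ.* k))
      ≤⟨ ℕ.*-monoʳ-≤ (Q ℕ.^ k ℕ.* P ℕ.^ k) h₁ ⟩
    Q ℕ.^ k ℕ.* P ℕ.^ k ℕ.* (M ℕ.^ k ℕ.* (P ℕ.* c ℕ.^ suc k))
      ≡⟨ solve 5 (λ a b c d e → a :* b :* (c :* (d :* e)) := a :* c :* e :* (d :* b)) refl (Q ℕ.^ k) (P ℕ.^ k) (M ℕ.^ k) P (c ℕ.^ suc k) ⟩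
    Q ℕ.^ k ℕ.* M ℕ.^ k ℕ.* c ℕ.^ suc k ℕ.* P ℕ.^ suc k
      ≤⟨ ℕ.*-mono-≤ (ℕ.*-monoʳ-≤ (Q ℕ.^ k ℕ.* M ℕ.^ k) c≤) (ℕ.≤-trans h₂ (ℕ.*-monoˡ-≤ (E ℕ.^ suc k) (ℕ.^-monoˡ-≤ k 1+v≤2v))) ⟩
    Q ℕ.^ k ℕ.* M ℕ.^ k ℕ.* (c ℕ.* c) ℕ.^ k ℕ.* ((2 ℕ.* v) ℕ.^ k ℕ.* E ℕ.^ suc k)
      ≡⟨ cong (λ t → Q ℕ.^ k ℕ.* M ℕ.^ k ℕ.* (c ℕ.* c) ℕ.^ k ℕ.* (t ℕ.* E ℕ.^ suc k)) (^-distribʳ-* k 2 v) ⟩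
    Q ℕ.^ k ℕ.* M ℕ.^ k ℕ.* (c ℕ.* c) ℕ.^ k ℕ.* (2 ℕ.^ k ℕ.* v ℕ.^ k ℕ.* E ℕ.^ suc k)
      ≡⟨ solve 6 (λ a b c d e g → a :* b :* c :* (d :* e :* g) := a :* (d :* c) :* b :* e :* g) refl
           (Q ℕ.^ k) (M ℕ.^ k) ((c ℕ.* c) ℕ.^ k) (2 ℕ.^ k) (v ℕ.^ k) (E ℕ.^ suc k) ⟩
    Q ℕ.^ k ℕ.* (2 ℕ.^ k ℕ.* (c ℕ.* c) ℕ.^ k) ℕ.* M ℕ.^ k ℕ.* v ℕ.^ k ℕ.* E ℕ.^ suc k
      ≡⟨ cong (ℕ._* E ℕ.^ suc k) expand ⟨
    (Q ℕ.* (2 ℕ.* (c ℕ.* c)) ℕ.* M ℕ.* v) ℕ.^ k ℕ.* E ℕ.^ suc k ∎))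
  where
  open ℕ.≤-Reasoning
  open ℕ.+-*-Solver
  c≤ : c ℕ.^ suc k ℕ.≤ (c ℕ.* c) ℕ.^ k
  c≤ = subst (c ℕ.^ suc k ℕ.≤_) (trans (ℕ.^-distribˡ-+-* c k k) (sym (^-distribʳ-* k c c)))
    (ℕ.^-monoʳ-≤ c {{ℕ.>-nonZero 1≤c}} (ℕ.+-monoˡ-≤ k 1≤k))
  1+v≤2v : suc v ℕ.≤ 2 ℕ.* v
  1+v≤2v = subst (suc v ℕ.≤_) (cong (v ℕ.+_) (sym (ℕ.+-identityʳ v))) (ℕ.+-monoˡ-≤ v 1≤v)
  expand : (Q ℕ.* (2 ℕ.* (c ℕ.* c)) ℕ.* M ℕ.* v) ℕ.^ k ≡
           Q ℕ.^ k ℕ.* (2 ℕ.^ k ℕ.* (c ℕ.* c) ℕ.^ k) ℕ.* M ℕ.^ k ℕ.* v ℕ.^ k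
  expand = trans (^-distribʳ-* k (Q ℕ.* (2 ℕ.* (c ℕ.* c)) ℕ.* M) v) (cong (ℕ._* v ℕ.^ k)
    (trans (^-distribʳ-* k (Q ℕ.* (2 ℕ.* (c ℕ.* c))) M) (cong (ℕ._* M ℕ.^ k)
      (trans (^-distribʳ-* k Q (2 ℕ.* (c ℕ.* c))) (cong (Q ℕ.^ k ℕ.*_) (^-distribʳ-* k 2 (c ℕ.* c)))))))

1≤2^ : ∀ n → 1 ℕ.≤ 2 ℕ.^ n
1≤2^ n = 1≤m^n n (ℕ.s≤s ℕ.z≤n)

-- With suc k sets and ε ≥ 1/n the exponent suc k − ε of D is at most p/n.
module Scale (n k p : ℕ) (1+p≡ : suc p ≡ n ℕ.* suc k) where

  1≤n : 1 ℕ.≤ n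
  1≤n = ℕ.n≢0⇒n>0 λ { refl → ℕ.1+n≢0 1+p≡ }

  -- With B = 2^b and G = R^b one has G = B^(4n), and m = 4 n (k + 1) gives B^m = G^(k+1), the
  -- threshold between dense and sparse sets.
  R m : ℕ
  R = 2 ℕ.^ (4 ℕ.* n)
  m = 4 ℕ.* suc p

  2≤R : 2 ℕ.≤ R
  2≤R = ℕ.^-monoʳ-≤ 2 {1} (ℕ.≤-trans 1≤n (ℕ.m≤m+n n (3 ℕ.* n)))

  constant : ℕ
  constant = suc (LogWeight.C R 2≤R (suc m))

  -- Here G^(k(k+1)) = B^(4k(p+1)) = B^(4pk) B^(4k), and the loss B^(2(k+1)) on the right is at most
  -- B^(4k) because k ≥ 1. This is the origin of the 4 in `R`.
  energy-bound : ∀ {b E P M} → 1 ℕ.≤ k →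
                 ((R ℕ.^ b) ℕ.^ k ℕ.* E) ℕ.^ suc k ℕ.≤
                   M ℕ.^ k ℕ.* (P ℕ.* (2 ℕ.^ b ℕ.* (2 ℕ.^ b ℕ.* constant)) ℕ.^ suc k) →
                 E ℕ.^ suc k ℕ.* (2 ℕ.^ b) ℕ.^ (4 ℕ.* p ℕ.* k) ℕ.≤ M ℕ.^ k ℕ.* (P ℕ.* constant ℕ.^ suc k)
  energy-bound {b} {E} {P} {M} 1≤k h = ℕ.*-cancelʳ-≤ _ _ (B ℕ.^ (4 ℕ.* k)) {{ℕ.>-nonZero (1≤m^n (4 ℕ.* k) 1≤B)}} (begin
    E ℕ.^ suc k ℕ.* B ℕ.^ (4 ℕ.* p ℕ.* k) ℕ.* B ℕ.^ (4 ℕ.* k)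
      ≡⟨ ℕ.*-assoc (E ℕ.^ suc k) _ _ ⟩
    E ℕ.^ suc k ℕ.* (B ℕ.^ (4 ℕ.* p ℕ.* k) ℕ.* B ℕ.^ (4 ℕ.* k))
      ≡⟨ cong (E ℕ.^ suc k ℕ.*_) powers ⟩
    E ℕ.^ suc k ℕ.* ((R ℕ.^ b) ℕ.^ k) ℕ.^ suc k
      ≡⟨ trans (ℕ.*-comm (E ℕ.^ suc k) _) (sym (^-distribʳ-* (suc k) ((R ℕ.^ b) ℕ.^ k) E)) ⟩
    ((R ℕ.^ b) ℕ.^ k ℕ.* E) ℕ.^ suc k
      ≤⟨ h ⟩
    M ℕ.^ k ℕ.* (P ℕ.* (B ℕ.* (B ℕ.* constant)) ℕ.^ suc k)
      ≡⟨ cong (λ t → M ℕ.^ k ℕ.* (P ℕ.* t)) (trans (^-distribʳ-* (suc k) B (B ℕ.* constant)) (cong (B ℕ.^ suc k ℕ.*_) (^-distribʳ-* (suc k) B constant))) ⟩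
    M ℕ.^ k ℕ.* (P ℕ.* (B ℕ.^ suc k ℕ.* (B ℕ.^ suc k ℕ.* constant ℕ.^ suc k)))
      ≡⟨ solve 4 (λ a b c d → a :* (b :* (c :* (c :* d))) := a :* (b :* d) :* (c :* c)) refl (M ℕ.^ k) P (B ℕ.^ suc k) (constant ℕ.^ suc k) ⟩
    M ℕ.^ k ℕ.* (P ℕ.* constant ℕ.^ suc k) ℕ.* (B ℕ.^ suc k ℕ.* B ℕ.^ suc k)
      ≤⟨ ℕ.*-monoʳ-≤ (M ℕ.^ k ℕ.* (P ℕ.* constant ℕ.^ suc k)) B≤ ⟩
    M ℕ.^ k ℕ.* (P ℕ.* constant ℕ.^ suc k) ℕ.* B ℕ.^ (4 ℕ.* k) ∎)
    where
    open ℕ.≤-Reasoning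
    open ℕ.+-*-Solver
    B = 2 ℕ.^ b
    1≤B = 1≤2^ b
    exponents : b ℕ.* (4 ℕ.* p ℕ.* k ℕ.+ 4 ℕ.* k) ≡ 4 ℕ.* n ℕ.* b ℕ.* k ℕ.* suc k
    exponents = trans (solve 3 (λ b p k → b :* (con 4 :* p :* k :+ con 4 :* k) := con 4 :* b :* k :* (con 1 :+ p)) refl b p k)
      (trans (cong (4 ℕ.* b ℕ.* k ℕ.*_) 1+p≡)
        (solve 3 (λ n b k → con 4 :* b :* k :* (n :* (con 1 :+ k)) := con 4 :* n :* b :* k :* (con 1 :+ k)) refl n b k))
    powers : B ℕ.^ (4 ℕ.* p ℕ.* k) ℕ.* B ℕ.^ (4 ℕ.* k) ≡ ((R ℕ.^ b) ℕ.^ k) ℕ.^ suc k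
    powers = trans (sym (ℕ.^-distribˡ-+-* B (4 ℕ.* p ℕ.* k) (4 ℕ.* k))) (trans (ℕ.^-*-assoc 2 b (4 ℕ.* p ℕ.* k ℕ.+ 4 ℕ.* k))
      (trans (cong (2 ℕ.^_) exponents) (sym (trans (cong (ℕ._^ suc k) (trans (cong (ℕ._^ k) (ℕ.^-*-assoc 2 (4 ℕ.* n) b)) (ℕ.^-*-assoc 2 (4 ℕ.* n ℕ.* b) k)))
        (ℕ.^-*-assoc 2 (4 ℕ.* n ℕ.* b ℕ.* k) (suc k))))))
    B≤ : B ℕ.^ suc k ℕ.* B ℕ.^ suc k ℕ.≤ B ℕ.^ (4 ℕ.* k)
    B≤ = subst (ℕ._≤ B ℕ.^ (4 ℕ.* k)) (ℕ.^-distribˡ-+-* B (suc k) (suc k)) (ℕ.^-monoʳ-≤ B {{ℕ.>-nonZero 1≤B}}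
      (ℕ.≤-trans (ℕ.+-mono-≤ (ℕ.+-monoˡ-≤ k 1≤k) (ℕ.+-monoˡ-≤ k 1≤k))
        (ℕ.≤-reflexive (solve 1 (λ k → k :+ k :+ (k :+ k) := con 4 :* k) refl k))))

  module _ (b : ℕ) (1≤k : 1 ℕ.≤ k) (A : Fin (suc k) → List ℕ) (N : Fin (suc k) → ℕ)
           (unique : ∀ i → Unique (A i)) (bounds : ∀ i {a} → a ∈ A i → 1 ℕ.≤ a × a ℕ.≤ N i)
           (T : List (Vec ℕ (suc k))) (uniqueT : Unique T) (T⊆A : ∀ {t} → t ∈ T → ∀ i → lookup t i ∈ A i)
           (common : ∀ {t} → t ∈ T → ∃ λ d → R ℕ.^ b ℕ.≤ d × (∀ i → d ∣ lookup t i))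
           (1≤∣A∣ : ∀ i → 1 ℕ.≤ length (A i)) where

    B P : ℕ
    B = 2 ℕ.^ b
    P = Π (length ∘ A)

    ∣A∣≤N : ∀ i → length (A i) ℕ.≤ N i
    ∣A∣≤N i = subst (length (A i) ℕ.≤_) (length-applyUpTo suc (N i))
      (length-⊆ (unique i) (λ a∈ → let 1≤a , a≤N = bounds i a∈ in ∈-range⁺ 1≤a a≤N))

    -- The sparse factor alone saves B^m. For the other factors |A j| ≤ N j is enough, which is
    -- `Π-≤-single` with d = 1.
    sparse : ∀ i → ¬ (N i ℕ.≤ length (A i) ℕ.* B ℕ.^ m) → P ℕ.* B ℕ.^ m ℕ.≤ Π N
    sparse i N> = ℕ.*-cancelˡ-≤ (length (A i)) {{ℕ.>-nonZero (1≤∣A∣ i)}} (begin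
      length (A i) ℕ.* (P ℕ.* B ℕ.^ m)     ≡⟨ swap (length (A i)) P (B ℕ.^ m) ⟩
      P ℕ.* (length (A i) ℕ.* B ℕ.^ m)     ≤⟨ ℕ.*-monoʳ-≤ P (ℕ.≰⇒≥ N>) ⟩
      P ℕ.* N i                            ≡⟨ cong (ℕ._* N i) (sym (trans (cong (P ℕ.*_) (ℕ.^-zeroˡ k)) (ℕ.*-identityʳ P))) ⟩
      P ℕ.* 1 ℕ.^ k ℕ.* N i
        ≤⟨ Π-≤-single 1 (length ∘ A) N (λ j → subst (ℕ._≤ N j) (sym (ℕ.*-identityʳ (length (A j)))) (∣A∣≤N j)) i ⟩
      length (A i) ℕ.* Π N                 ∎)
      where
      open ℕ.≤-Reasoning
      swap : ∀ x y z → x ℕ.* (y ℕ.* z) ≡ y ℕ.* (x ℕ.* z)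
      swap = solve 3 (λ x y z → x :* (y :* z) := y :* (x :* z)) refl
        where open ℕ.+-*-Solver

    dense : (∀ i → N i ℕ.≤ length (A i) ℕ.* B ℕ.^ m) →
            length T ℕ.^ suc k ℕ.* B ℕ.^ (4 ℕ.* p ℕ.* k) ℕ.≤ Π N ℕ.^ k ℕ.* (P ℕ.* constant ℕ.^ suc k)
    dense N≤ = energy-bound {b} {length T} {P} {Π N} 1≤k
      (Core.energy R 2≤R b 1≤k A N unique bounds T uniqueT T⊆A common B m (1≤2^ b)
        (λ i → ℕ.≤-trans (1≤∣A∣ i) (∣A∣≤N i)) N≤)

    finite-bound : 1 ℕ.≤ length T → ∀ {v} → 1 ℕ.≤ v → P ℕ.^ suc k ℕ.≤ suc v ℕ.^ k ℕ.* length T ℕ.^ suc k →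
                   ∀ Q → Q ℕ.* P ℕ.* B ℕ.^ (4 ℕ.* p) ℕ.≤ Q ℕ.* (2 ℕ.* (constant ℕ.* constant)) ℕ.* Π N ℕ.* v
    finite-bound 1≤E {v} 1≤v P≤ Q with Fin.all? (λ i → N i ℕ.≤? length (A i) ℕ.* B ℕ.^ m)
    ... | yes N≤ = root-bound {k} {length T} {B} {P} {Π N} {v} {constant} {4 ℕ.* p} Q 1≤k 1≤E 1≤v (ℕ.s≤s ℕ.z≤n) (dense N≤) P≤
    ... | no ¬N≤ = begin
      Q ℕ.* P ℕ.* B ℕ.^ (4 ℕ.* p)
        ≤⟨ ℕ.*-monoʳ-≤ (Q ℕ.* P) (ℕ.^-monoʳ-≤ B {{ℕ.>-nonZero (1≤2^ b)}} (ℕ.*-monoʳ-≤ 4 (ℕ.n≤1+n p))) ⟩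
      Q ℕ.* P ℕ.* B ℕ.^ m                                     ≡⟨ ℕ.*-assoc Q P (B ℕ.^ m) ⟩
      Q ℕ.* (P ℕ.* B ℕ.^ m)
        ≤⟨ ℕ.*-monoʳ-≤ Q (let i , N> = Fin.¬∀⟶∃¬ (suc k) _ (λ i → N i ℕ.≤? length (A i) ℕ.* B ℕ.^ m) ¬N≤ in sparse i N>) ⟩
      Q ℕ.* Π N
        ≤⟨ ℕ.*-monoˡ-≤ (Π N) (ℕ.m≤m*n Q (2 ℕ.* (constant ℕ.* constant))) ⟩
      Q ℕ.* (2 ℕ.* (constant ℕ.* constant)) ℕ.* Π N
        ≤⟨ ℕ.m≤m*n (Q ℕ.* (2 ℕ.* (constant ℕ.* constant)) ℕ.* Π N) v {{ℕ.>-nonZero 1≤v}} ⟩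
      Q ℕ.* (2 ℕ.* (constant ℕ.* constant)) ℕ.* Π N ℕ.* v     ∎
      where open ℕ.≤-Reasoning

-- Bounds for operations on real numbers

open ℝ

≤-refl : ∀ {x} → x ≤ x
≤-refl (q , ¬bq , bq) = ¬bq bq

≤-trans : ∀ {x y z} → x ≤ y → y ≤ z → x ≤ z
≤-trans x≤y y≤z (q , ¬zq , xq) = x≤y (q , (λ yq → y≤z (q , ¬zq , yq)) , xq)

<⇒≤ : ∀ {x y} → x < y → x ≤ y
<⇒≤ {x} {y} (q , ¬xq , yq) (r , ¬yr , xr) with ℚ.≤-total q r
... | inj₁ q≤r = ¬xq (downward x q≤r xr)
... | inj₂ r≤q = ¬yr (downward y r≤q yq)

fromℚ-mono : ∀ {p q} → p ℚ.≤ q → fromℚ p ≤ fromℚ q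
fromℚ-mono p≤q (r , r≮q , r<p) = r≮q (ℚ.<-≤-trans r<p p≤q)

fromℚ-cancel : ∀ {p q} → fromℚ p ≤ fromℚ q → p ℚ.≤ q
fromℚ-cancel {p} h = ≤-via (fromℚ p) (≤-refl {fromℚ p}) h

fromℕ≡ : ∀ n → fromℕ n ≡ fromℚ (ι n)
fromℕ≡ n = cong fromℚ (sym (ι-def n))

ι≤fromℕ : ∀ n → fromℚ (ι n) ≤ fromℕ n
ι≤fromℕ n = subst (fromℚ (ι n) ≤_) (sym (fromℕ≡ n)) (≤-refl {fromℚ (ι n)})

fromℕ≤ι : ∀ n → fromℕ n ≤ fromℚ (ι n)
fromℕ≤ι n = subst (_≤ fromℚ (ι n)) (sym (fromℕ≡ n)) (≤-refl {fromℚ (ι n)})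

positive-below : ∀ {x} → 0ℝ < x → ∃ λ q → 0ℚ ℚ.< q × fromℚ q ≤ x
positive-below {x} (q , q≮0 , xq) = let r , q<r , xr = rounded x xq in
  r , ℚ.≤-<-trans (ℚ.≮⇒≥ q≮0) q<r , below⇒≤ x xr

-- The box around (x, y) also needs upper ends, which `upper` gives up to double negation. With a
-- and c nonnegative its smallest corner is a c.
*-lower : ∀ {x y a c} → 0ℚ ℚ.≤ a → 0ℚ ℚ.≤ c → fromℚ a ≤ x → fromℚ c ≤ y → fromℚ (a ℚ.* c) ≤ x * y
*-lower {x} {y} {a} {c} 0≤a 0≤c a≤x c≤y (q , ¬q , q<ac) = upper x λ (b , x≤b) → upper y λ (d , y≤d) →
  let a≤b = ≤-via x a≤x x≤b
      c≤d = ≤-via y c≤y y≤d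
  in ¬q (a ℚ.* c , (a , b , c , d , (a≤x , x≤b) , (c≤y , y≤d) , ℚ.≤-refl , *-monoˡ 0≤a c≤d , *-monoʳ 0≤c a≤b
       , *-mono (ℚ.≤-trans 0≤a a≤b) 0≤c a≤b c≤d) , q<ac)

-- Clipping the lower ends of an arbitrary box at 0 gives a point (e, f) that lies in that box and
-- in [0, b] × [0, d]. A lower bound for the corners is a lower bound for e f, by linearity in each
-- variable.
*-upper : ∀ {x y b d} → fromℚ 0ℚ ≤ x → fromℚ 0ℚ ≤ y → x ≤ fromℚ b → y ≤ fromℚ d → x * y ≤ fromℚ (b ℚ.* d)
*-upper {x} {y} {b₀} {d₀} 0≤x 0≤y x≤b₀ y≤d₀
  (q , q≮ , m , (a , b , c , d , (a≤x , x≤b) , (c≤y , y≤d) , m≤ac , m≤ad , m≤bc , m≤bd) , q<m) =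
  q≮ (ℚ.<-≤-trans q<m (ℚ.≤-trans (subst (m ℚ.≤_) (ℚ.*-comm f e) m≤fe)
    (*-mono (≤-via x 0≤x x≤b₀) (ℚ.p≤q⊔p c 0ℚ) (ℚ.⊔-lub (≤-via x a≤x x≤b₀) (≤-via x 0≤x x≤b₀))
      (ℚ.⊔-lub (≤-via y c≤y y≤d₀) (≤-via y 0≤y y≤d₀)))))
  where
  e = a ℚ.⊔ 0ℚ
  f = c ℚ.⊔ 0ℚ
  e≤b = ℚ.⊔-lub (≤-via x a≤x x≤b) (≤-via x 0≤x x≤b)
  f≤d = ℚ.⊔-lub (≤-via y c≤y y≤d) (≤-via y 0≤y y≤d)
  m≤ec = between a e b c (ℚ.p≤p⊔q a 0ℚ) e≤b m≤ac m≤bc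
  m≤ed = between a e b d (ℚ.p≤p⊔q a 0ℚ) e≤b m≤ad m≤bd
  m≤fe = between c f d e (ℚ.p≤p⊔q c 0ℚ) f≤d (subst (m ℚ.≤_) (ℚ.*-comm e c) m≤ec) (subst (m ℚ.≤_) (ℚ.*-comm e d) m≤ed)

⁻¹-nonNeg : ∀ {x} → fromℚ 0ℚ ≤ x ⁻¹
⁻¹-nonNeg (q , ¬q , q<0) = ¬q (0ℚ , inj₁ refl , q<0)

⁻¹-lower : ∀ {x l u m} → 0ℚ ℚ.< l → fromℚ l ≤ x → x ≤ fromℚ u → m ℚ.* u ℚ.≤ 1ℚ → fromℚ m ≤ x ⁻¹
⁻¹-lower {l = l} {u} {m} 0<l l≤x x≤u mu≤1 (q , ¬q , q<m) = ¬q (m , inj₂ (l , u , 0<l , (l≤x , x≤u) , mu≤1) , q<m)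

∏-lower : ∀ {k} (X : Fin k → ℝ) (a : Fin k → ℕ) r → 0ℚ ℚ.≤ r →
          (∀ i → fromℚ (ι (a i) ℚ.* r) ≤ X i) → fromℚ (ι (Π a) ℚ.* r ^ℚ k) ≤ ∏ X
∏-lower {zero}  X a r 0≤r h = subst (_≤ 1ℝ) (trans (fromℕ≡ 1) (cong fromℚ (sym (ℚ.*-identityʳ (ι 1))))) (≤-refl {1ℝ})
∏-lower {suc k} X a r 0≤r h = subst (λ t → fromℚ t ≤ ∏ X)
  (trans (solve 4 (λ x r y s → x :* r :* (y :* s) := x :* y :* (r :* s)) refl (ι (a zero)) r (ι (Π (a ∘ suc))) (r ^ℚ k))
    (cong (ℚ._* (r ^ℚ suc k)) (sym (ι-* (a zero) (Π (a ∘ suc))))))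
  (*-lower {X zero} {∏ (X ∘ suc)} (0≤* (0≤ι (a zero)) 0≤r) (0≤* (0≤ι (Π (a ∘ suc))) (^-nonNeg k 0≤r))
    (h zero) (∏-lower (X ∘ suc) (a ∘ suc) r 0≤r (h ∘ suc)))
  where open ℚ.+-*-Solver

-‿upper : ∀ {x y a e} → x ≤ fromℚ a → fromℚ e ≤ y → x - y ≤ fromℚ (a ℚ.- e)
-‿upper {x} {y} x≤a e≤y (q , q≮ , _ , (l , u , l≤x , y≤u , refl) , q<) =
  q≮ (ℚ.<-≤-trans q< (ℚ.+-mono-≤ (≤-via x l≤x x≤a) (ℚ.neg-antimono-≤ (≤-via y e≤y y≤u))))

-‿lower : ∀ {x y l u} → fromℚ l ≤ x → y ≤ fromℚ u → fromℚ (l ℚ.- u) ≤ x - y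
-‿lower {l = l} {u} l≤x y≤u (q , ¬q , q<) = ¬q (l ℚ.- u , (l , u , l≤x , y≤u , refl) , q<)

/-*-cancel : ∀ c n → + c / suc n ℚ.* ι (suc n) ≡ ι c
/-*-cancel c n = ℚ.toℚᵘ-injective (ℚᵘ.≃-trans (ℚ.toℚᵘ-homo-* (+ c / suc n) (ι (suc n)))
  (ℚᵘ.≃-trans (ℚᵘ.*-cong (ℚ.toℚᵘ-fromℚᵘ (ℚᵘ.mkℚᵘ (+ c) n)) (toℚᵘ-ι (suc n)))
  (ℚᵘ.≃-trans (ℚᵘ.*≡* {ℚᵘ.mkℚᵘ (+ c) n ℚᵘ.* ℚᵘ.mkℚᵘ (+ suc n) 0} {ℚᵘ.mkℚᵘ (+ c) 0}
    (ℤ.*-assoc (+ c) (+ suc n) (+ 1)))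
    (ℚᵘ.≃-sym (toℚᵘ-ι c)))))

cross-≤ : ∀ {r c n p q} → ι p ℚ.≤ r ℚ.* ι q → r ℚ.≤ + c / suc n → p ℕ.* suc n ℕ.≤ c ℕ.* q
cross-≤ {r} {c} {n} {p} {q} p≤rq r≤ = ι-cancel (begin
  ι (p ℕ.* suc n)                        ≡⟨ ι-* p (suc n) ⟩
  ι p ℚ.* ι (suc n)                      ≤⟨ *-monoʳ (0≤ι (suc n)) (ℚ.≤-trans p≤rq (*-monoʳ (0≤ι q) r≤)) ⟩
  (+ c / suc n) ℚ.* ι q ℚ.* ι (suc n)
    ≡⟨ solve 3 (λ a b c → a :* b :* c := a :* c :* b) refl (+ c / suc n) (ι q) (ι (suc n)) ⟩
  (+ c / suc n) ℚ.* ι (suc n) ℚ.* ι q    ≡⟨ cong (ℚ._* ι q) (/-*-cancel c n) ⟩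
  ι c ℚ.* ι q                            ≡⟨ ι-* c q ⟨
  ι (c ℕ.* q)                            ∎)
  where
  open ℚ.≤-Reasoning
  open ℚ.+-*-Solver

cross-≥ : ∀ {r c n p q} → r ℚ.* ι q ℚ.≤ ι p → + c / suc n ℚ.≤ r → c ℕ.* q ℕ.≤ p ℕ.* suc n
cross-≥ {r} {c} {n} {p} {q} rq≤p ≤r = ι-cancel (begin
  ι (c ℕ.* q)                            ≡⟨ ι-* c q ⟩
  ι c ℚ.* ι q                            ≡⟨ cong (ℚ._* ι q) (/-*-cancel c n) ⟨
  (+ c / suc n) ℚ.* ι (suc n) ℚ.* ι q
    ≡⟨ solve 3 (λ a b c → a :* b :* c := a :* c :* b) refl (+ c / suc n) (ι (suc n)) (ι q) ⟩
  (+ c / suc n) ℚ.* ι q ℚ.* ι (suc n)    ≤⟨ *-monoʳ (0≤ι (suc n)) (ℚ.≤-trans (*-monoʳ (0≤ι q) ≤r) rq≤p) ⟩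
  ι p ℚ.* ι (suc n)                      ≡⟨ ι-* p (suc n) ⟨
  ι (p ℕ.* suc n)                        ∎)
  where
  open ℚ.≤-Reasoning
  open ℚ.+-*-Solver

-- For a base at most 1 the power decreases in the exponent, so p/q ≤ y is used, together with the
-- bound l^(c/n) in the definition of the power. The hypothesis ranges over the rationals below x
-- because x need not be rational.
^-upper-≤1 : ∀ {x y r u p q-1} → x ≤ 1ℝ → fromℚ r ≤ y → ι p ℚ.≤ r ℚ.* ι (suc q-1) → 0ℚ ℚ.≤ u →
             (∀ {l} → 0ℚ ℚ.≤ l → fromℚ l ≤ x → l ^ℚ p ℚ.≤ u ^ℚ suc q-1) → x ^ y ≤ fromℚ u
^-upper-≤1 {x} {y} {r} {u} {p} {q-1} x≤1 r≤y p≤rq 0≤u h (t , t≮u , m , Sm , t<m) = t≮u (ℚ.<-≤-trans t<m (m≤u Sm))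
  where
  q = suc q-1
  m≤u : _ → m ℚ.≤ u
  m≤u (inj₁ refl) = 0≤u
  -- `^-cancel` takes the predecessor of the exponent, and `q-1 + n-1 * q` is that of n q. Raising
  -- to the power n q clears both denominators.
  m≤u (inj₂ (l , a , c , n-1 , 0≤l , l≤x , (_ , y≤c/n) , 0≤m , _ , mⁿ≤lᶜ)) = ^-cancel {m} {u} (q-1 ℕ.+ n-1 ℕ.* q) 0≤u (begin
    m ^ℚ (n ℕ.* q)      ≡⟨ ^-assocʳ m n q ⟨
    (m ^ℚ n) ^ℚ q       ≤⟨ ^-monoˡ q (^-nonNeg n 0≤m) mⁿ≤lᶜ ⟩
    (l ^ℚ c) ^ℚ q       ≡⟨ ^-assocʳ l c q ⟩
    l ^ℚ (c ℕ.* q)      ≤⟨ ^-antitone 0≤l l≤1 (cross-≤ {r} {c} {n-1} {p} {q} p≤rq (≤-via y r≤y y≤c/n)) ⟩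
    l ^ℚ (p ℕ.* n)      ≡⟨ ^-assocʳ l p n ⟨
    (l ^ℚ p) ^ℚ n       ≤⟨ ^-monoˡ n (^-nonNeg p 0≤l) (h 0≤l l≤x) ⟩
    (u ^ℚ q) ^ℚ n       ≡⟨ ^-assocʳ u q n ⟩
    u ^ℚ (q ℕ.* n)      ≡⟨ cong (u ^ℚ_) (ℕ.*-comm q n) ⟩
    u ^ℚ (n ℕ.* q)      ∎)
    where
    open ℚ.≤-Reasoning
    n = suc n-1
    l≤1 : l ℚ.≤ 1ℚ
    l≤1 = ≤-via x l≤x x≤1

-- The counterpart for y ≤ p/q: the base is replaced by a rational d ≥ 1, whose powers increase, and
-- the bound l^(a/n) is used.
^-upper-≥1 : ∀ {x y r u d p q-1} → y ≤ fromℚ r → r ℚ.* ι (suc q-1) ℚ.≤ ι p → x ≤ fromℚ d →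
             1ℚ ℚ.≤ d → 0ℚ ℚ.≤ u → d ^ℚ p ℚ.≤ u ^ℚ suc q-1 → x ^ y ≤ fromℚ u
^-upper-≥1 {x} {y} {r} {u} {d} {p} {q-1} y≤r rq≤p x≤d 1≤d 0≤u h (t , t≮u , m , Sm , t<m) = t≮u (ℚ.<-≤-trans t<m (m≤u Sm))
  where
  q = suc q-1
  0≤d : 0ℚ ℚ.≤ d
  0≤d = ℚ.≤-trans (ℚ.nonNegative⁻¹ 1ℚ) 1≤d
  m≤u : _ → m ℚ.≤ u
  m≤u (inj₁ refl) = 0≤u
  m≤u (inj₂ (l , a , c , n-1 , 0≤l , l≤x , (a/n≤y , _) , 0≤m , mⁿ≤lᵃ , _)) = ^-cancel {m} {u} (q-1 ℕ.+ n-1 ℕ.* q) 0≤u (begin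
    m ^ℚ (n ℕ.* q)      ≡⟨ ^-assocʳ m n q ⟨
    (m ^ℚ n) ^ℚ q       ≤⟨ ^-monoˡ q (^-nonNeg n 0≤m) (ℚ.≤-trans mⁿ≤lᵃ (^-monoˡ a 0≤l (≤-via x l≤x x≤d))) ⟩
    (d ^ℚ a) ^ℚ q       ≡⟨ ^-assocʳ d a q ⟩
    d ^ℚ (a ℕ.* q)      ≤⟨ ^-monoʳ 1≤d (cross-≥ {r} {a} {n-1} {p} {q} rq≤p (≤-via y a/n≤y y≤r)) ⟩
    d ^ℚ (p ℕ.* n)      ≡⟨ ^-assocʳ d p n ⟨
    (d ^ℚ p) ^ℚ n       ≤⟨ ^-monoˡ n (^-nonNeg p 0≤d) h ⟩
    (u ^ℚ q) ^ℚ n       ≡⟨ ^-assocʳ u q n ⟩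
    u ^ℚ (q ℕ.* n)      ≡⟨ cong (u ^ℚ_) (ℕ.*-comm q n) ⟩
    u ^ℚ (n ℕ.* q)      ∎)
    where
    open ℚ.≤-Reasoning
    n = suc n-1

-- The reciprocal has positive elements only when its argument has a positive rational lower bound;
-- this provides one for the powers.
^-positive : ∀ {x y l} → 0ℚ ℚ.< l → l ℚ.≤ 1ℚ → fromℚ l ≤ x → 0ℝ ≤ y → ¬ ¬ ∃ λ m → 0ℚ ℚ.< m × fromℚ m ≤ x ^ y
^-positive {x} {y} {l} 0<l l≤1 l≤x 0≤y κ = upper y λ (w , y≤w) →
  let c , w≤c = archimedean w in
  -- The exponent is enclosed in [0/1, c/1]. Since l ≤ 1, the smaller of l^0 and l^c is l^c.
  κ (l ^ℚ c , l^>0 c , λ (q , ¬q , q<m) → ¬q (l ^ℚ c , inj₂ (l , 0 , c , 0 , ℚ.<⇒≤ 0<l , l≤x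
    , (0≤y , ≤-trans {y} {fromℚ w} {fromℚ (+ c / 1)} y≤w (fromℚ-mono w≤c))
    , ℚ.<⇒≤ (l^>0 c)
    , subst (ℚ._≤ 1ℚ) (sym (ℚ.*-identityʳ (l ^ℚ c))) (^-antitone {n = c} (ℚ.<⇒≤ 0<l) l≤1 ℕ.z≤n)
    , ℚ.≤-reflexive (ℚ.*-identityʳ (l ^ℚ c))) , q<m))
  where
  l^>0 : ∀ n → 0ℚ ℚ.< l ^ℚ n
  l^>0 zero    = ℚ.positive⁻¹ 1ℚ
  l^>0 (suc n) = subst (ℚ._< l ℚ.* (l ^ℚ n)) (ℚ.*-zeroʳ l) (ℚ.*-monoʳ-<-pos l {{ℚ.positive 0<l}} (l^>0 n))

-- Reduction to natural numbers

fromℤ-cancel : ∀ {i j} → fromℤ i ≤ fromℤ j → i ℤ.≤ j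
fromℤ-cancel {i} {j} h = subst₂ ℤ._≤_ (ℤ.*-identityʳ i) (ℤ.*-identityʳ j)
  (ℚᵘ.drop-*≤* (ℚᵘ.≤-respˡ-≃ (ℚ.toℚᵘ-fromℚᵘ (ℚᵘ.mkℚᵘ i 0))
    (ℚᵘ.≤-respʳ-≃ (ℚ.toℚᵘ-fromℚᵘ (ℚᵘ.mkℚᵘ j 0)) (ℚ.toℚᵘ-mono-≤ (fromℚ-cancel h)))))

fromℕ≤fromℤ : ∀ {n} i → fromℕ n ≤ fromℤ i → i ≡ + ℤ.∣ i ∣ × n ℕ.≤ ℤ.∣ i ∣
fromℕ≤fromℤ {n} i h with fromℤ-cancel {+ n} {i} h
... | ℤ.+≤+ n≤j = refl , n≤j

-- Descends from n, deciding `P` at each step up to double negation. It locates D between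
-- consecutive powers of R, where the comparison is undecidable.
¬¬-crossing : ∀ {P : ℕ → Set} n → P 0 → ¬ P n → ¬ ¬ ∃ λ b → P b × ¬ P (suc b)
¬¬-crossing zero    P0 ¬Pn κ = ¬Pn P0
¬¬-crossing (suc n) P0 ¬Pn κ = ¬¬-em λ where
  (inj₁ Pn)  → κ (n , Pn , ¬Pn)
  (inj₂ ¬Pn) → ¬¬-crossing n P0 ¬Pn κ

maximum : ∀ xs → 1 ℕ.≤ length xs → ∃ λ N → N ∈ xs × (∀ {a} → a ∈ xs → a ℕ.≤ N)
maximum (x ∷ [])     _ = x , here refl , λ { (here refl) → ℕ.≤-refl }
maximum (x ∷ y ∷ xs) _ with N , N∈ , ≤N ← maximum (y ∷ xs) (ℕ.s≤s ℕ.z≤n) with ℕ.≤-total x N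
... | inj₁ x≤N = N , there N∈ , λ { (here refl) → x≤N ; (there a∈) → ≤N a∈ }
... | inj₂ N≤x = x , here refl , λ { (here refl) → ℕ.≤-refl ; (there a∈) → ℕ.≤-trans (≤N a∈) N≤x }

0<⇒inv≤ : ∀ {q} → 0ℚ ℚ.< q → ∃ λ n → inv (suc n) ℚ.≤ q
0<⇒inv≤ {q} 0<q = from (archimedean (ℚ.1/ q))
  where
  instance
    q>0 = ℚ.positive 0<q
    q≢0 = ℚ.pos⇒nonZero q
  1≤ : ∀ N → ℚ.1/ q ℚ.≤ + N / 1 → 1ℚ ℚ.≤ q ℚ.* ι N
  1≤ N h = subst (ℚ._≤ q ℚ.* ι N) (ℚ.*-inverseʳ q) (*-monoˡ (ℚ.<⇒≤ 0<q) (subst (ℚ.1/ q ℚ.≤_) (sym (ι-def N)) h))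
  from : (∃ λ N → ℚ.1/ q ℚ.≤ + N / 1) → ∃ λ n → inv (suc n) ℚ.≤ q
  from (zero  , h) = contradiction (subst (1ℚ ℚ.≤_) (trans (cong (q ℚ.*_) ι0) (ℚ.*-zeroʳ q)) (1≤ 0 h))
    (λ h → ℚ.<-irrefl refl (ℚ.<-≤-trans (ℚ.positive⁻¹ 1ℚ) h))
  from (suc n , h) = n , subst₂ ℚ._≤_ (ℚ.*-identityˡ (inv (suc n)))
    (inv-cancelʳ {suc n} (ℕ.s≤s ℕ.z≤n) q) (*-monoʳ (0≤inv (suc n)) (1≤ (suc n) h))

-- The left inverse is required only on the list: absolute values are injective on the positive
-- integers that occur, not on ℤ.
Unique-map⁺ : ∀ {A B : Set} (f : A → B) (g : B → A) {xs} → (∀ {x} → x ∈ xs → g (f x) ≡ x) → Unique xs → Unique (map f xs)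
Unique-map⁺ f g {xs} gf≡ u = Unique.map⁻ {f = g} (subst Unique (sym (trans (sym (map-∘ xs)) (map-id-local (All.tabulate gf≡)))) u)

abs-retract : ∀ {k} (t : Vec ℤ k) → (∀ i → lookup t i ≡ + ℤ.∣ lookup t i ∣) → Vec.map +_ (Vec.map ℤ.∣_∣ t) ≡ t
abs-retract []      h = refl
abs-retract (x ∷ t) h = cong₂ _∷_ (sym (h zero)) (abs-retract t (h ∘ suc))

gcdᵥ-∣ : ∀ {k} (t : Vec ℤ k) i → ℤ.∣ gcdᵥ t ∣ ∣ ℤ.∣ lookup t i ∣
gcdᵥ-∣ (x ∷ t) zero    = ℕ.gcd[m,n]∣m ℤ.∣ x ∣ ℤ.∣ gcdᵥ t ∣
gcdᵥ-∣ (x ∷ t) (suc i) = ℕ∣.∣-trans (ℕ.gcd[m,n]∣n ℤ.∣ x ∣ ℤ.∣ gcdᵥ t ∣) (gcdᵥ-∣ t i)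

Π-cong : ∀ {k} {x y : Fin k → ℕ} → (∀ i → x i ≡ y i) → Π x ≡ Π y
Π-cong {zero}  h = refl
Π-cong {suc k} h = cong₂ ℕ._*_ (h zero) (Π-cong (h ∘ suc))

1≤Π⁻ : ∀ {k} {x : Fin k → ℕ} → 1 ℕ.≤ Π x → ∀ i → 1 ℕ.≤ x i
1≤Π⁻ {suc k} {x} h zero    = ℕ.n≢0⇒n>0 λ eq → ℕ.<⇒≢ h (sym (cong (ℕ._* Π (x ∘ suc)) eq))
1≤Π⁻ {suc k} {x} h (suc i) = 1≤Π⁻ {x = x ∘ suc} (ℕ.n≢0⇒n>0 λ eq →
  ℕ.<⇒≢ h (sym (trans (cong (x zero ℕ.*_) eq) (ℕ.*-zeroʳ (x zero))))) i

-- An integer v within a factor 2 of (P/E)^(suc k / k) spares a rational approximation of δ^(suc k / k).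
integer-root : ∀ {k E P} → 1 ℕ.≤ k → 1 ℕ.≤ E → E ℕ.≤ P →
               ∃ λ v → 1 ℕ.≤ v × v ℕ.^ k ℕ.* E ℕ.^ suc k ℕ.≤ P ℕ.^ suc k ×
               P ℕ.^ suc k ℕ.≤ suc v ℕ.^ k ℕ.* E ℕ.^ suc k
integer-root {k@(suc _)} {E} {P} _ 1≤E E≤P =
  v , largest-max fits? bound (1≤m^n (suc k) (ℕ.≤-trans 1≤E E≤P)) fits-1 , largest-sat fits? ℕ.z≤n bound
  , ℕ.≰⇒≥ λ h → ℕ.1+n≰n (largest-max fits? bound (≤bound (suc v) h) h)
  where
  -- Any q that fits is at most P^(k+1), because k and E are positive, so the bounded search finds
  -- the largest one.
  bound = P ℕ.^ suc k
  fits? = λ q → q ℕ.^ k ℕ.* E ℕ.^ suc k ℕ.≤? bound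
  v = largest fits? bound
  fits-1 : 1 ℕ.^ k ℕ.* E ℕ.^ suc k ℕ.≤ bound
  fits-1 = subst (ℕ._≤ bound) (sym (trans (cong (ℕ._* E ℕ.^ suc k) (ℕ.^-zeroˡ k)) (ℕ.*-identityˡ _))) (ℕ.^-monoˡ-≤ (suc k) E≤P)
  ≤bound : ∀ q → q ℕ.^ k ℕ.* E ℕ.^ suc k ℕ.≤ bound → q ℕ.≤ bound
  ≤bound zero    _ = ℕ.z≤n
  ≤bound (suc q) h = ℕ.≤-trans (ℕ.m≤m*n (suc q) _ {{ℕ.>-nonZero (1≤m^n (ℕ.pred k) (ℕ.s≤s ℕ.z≤n))}})
    (ℕ.≤-trans (ℕ.m≤m*n (suc q ℕ.^ k) (E ℕ.^ suc k) {{ℕ.>-nonZero (1≤m^n (suc k) 1≤E)}}) h)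

-- Lower bounds for the factors of the right-hand side

1≤⇒0≤ : ∀ {x} → 1ℝ ≤ x → fromℚ 0ℚ ≤ x
1≤⇒0≤ {x} 1≤x = ≤-trans {fromℚ 0ℚ} {1ℝ} {x} (fromℚ-mono {0ℚ} {1ℚ} (ℚ.nonNegative⁻¹ 1ℚ)) 1≤x

0≤fromℕ : ∀ n → fromℚ 0ℚ ≤ fromℕ n
0≤fromℕ n = subst (fromℚ 0ℚ ≤_) (sym (fromℕ≡ n)) (fromℚ-mono (0≤ι n))

ratio-≤ : ∀ {δ l P E} → 0ℚ ℚ.≤ l → fromℚ l ≤ δ → δ * fromℕ P ≤ fromℕ E → l ℚ.* ι P ℚ.≤ ι E
ratio-≤ {δ} {l} {P} {E} 0≤l l≤δ δP≤E = fromℚ-cancel (subst (fromℚ (l ℚ.* ι P) ≤_) (fromℕ≡ E)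
  (≤-trans {fromℚ (l ℚ.* ι P)} {δ * fromℕ P} {fromℕ E}
    (*-lower {δ} {fromℕ P} 0≤l (0≤ι P) l≤δ (ι≤fromℕ P)) δP≤E))

-- For rational l with 0 ≤ l ≤ δ one has l P ≤ E, so l^K v^k P^K ≤ v^k E^K ≤ P^K and l^K ≤ v^(-k).
-- Hence δ^(K/k) ≤ 1/v, and the reciprocal is at least v.
δ-power-lower : ∀ {δ k-1 E P v} → let k = suc k-1 in 0ℝ < δ → δ ≤ 1ℝ → 1 ℕ.≤ P → 1 ℕ.≤ v →
                δ * fromℕ P ≤ fromℕ E → v ℕ.^ k ℕ.* E ℕ.^ suc k ℕ.≤ P ℕ.^ suc k →
                fromℚ (ι v) ≤ (δ ^ (fromℕ (suc k) ÷ fromℕ k)) ⁻¹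
δ-power-lower {δ} {k-1} {E} {P} {v} 0<δ δ≤1 1≤P 1≤v δP≤E vE≤P q =
  -- The last argument `q` is the assumed violation of the inequality. The goal is therefore
  -- absurdity, and the double negation can be opened.
  ^-positive {δ} {fromℕ K ÷ fromℕ k} 0<l l≤1 l≤δ 0≤y λ (m , 0<m , m≤) →
    ⁻¹-lower {δ ^ (fromℕ K ÷ fromℕ k)} {m} {inv v} {ι v} 0<m m≤ upper-bound
      (ℚ.≤-reflexive (trans (ℚ.*-comm (ι v) (inv v)) (inv-* 1≤v))) q
  where
  k K : ℕ
  k = suc k-1
  K = suc k
  l = proj₁ (positive-below {δ} 0<δ)
  0<l = proj₁ (proj₂ (positive-below {δ} 0<δ))
  l≤δ = proj₂ (proj₂ (positive-below {δ} 0<δ))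
  l≤1 : l ℚ.≤ 1ℚ
  l≤1 = ≤-via δ l≤δ δ≤1
  1≤fromℕk : fromℚ 1ℚ ≤ fromℕ k
  1≤fromℕk = subst₂ _≤_ (cong fromℚ ι1) (sym (fromℕ≡ k)) (fromℚ-mono (ι-mono {1} {k} (ℕ.s≤s ℕ.z≤n)))
  inv≤ : fromℚ (inv k) ≤ fromℕ k ⁻¹
  inv≤ = ⁻¹-lower {fromℕ k} {1ℚ} {ι k} (ℚ.positive⁻¹ 1ℚ) 1≤fromℕk
    (fromℕ≤ι k) (ℚ.≤-reflexive (inv-* {k} (ℕ.s≤s ℕ.z≤n)))
  y≥ : fromℚ (ι K ℚ.* inv k) ≤ fromℕ K ÷ fromℕ k
  y≥ = *-lower {fromℕ K} {fromℕ k ⁻¹} (0≤ι K) (0≤inv k) (ι≤fromℕ K) inv≤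
  0≤y : 0ℝ ≤ fromℕ K ÷ fromℕ k
  0≤y = ≤-trans {0ℝ} {fromℚ (ι K ℚ.* inv k)} {fromℕ K ÷ fromℕ k} (fromℚ-mono (0≤* (0≤ι K) (0≤inv k))) y≥
  power≤ : ∀ {l} → 0ℚ ℚ.≤ l → fromℚ l ≤ δ → l ^ℚ K ℚ.≤ inv v ^ℚ k
  power≤ {l} 0≤l l≤δ = begin
    l ^ℚ K                                      ≡⟨ ℚ.*-identityʳ (l ^ℚ K) ⟨
    l ^ℚ K ℚ.* 1ℚ
      ≡⟨ cong (l ^ℚ K ℚ.*_) (^-inverse {ι v} {inv v} k (trans (ℚ.*-comm (ι v) (inv v)) (inv-* 1≤v))) ⟨
    l ^ℚ K ℚ.* (ι v ^ℚ k ℚ.* inv v ^ℚ k)        ≡⟨ ℚ.*-assoc (l ^ℚ K) (ι v ^ℚ k) (inv v ^ℚ k) ⟨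
    l ^ℚ K ℚ.* ι v ^ℚ k ℚ.* inv v ^ℚ k          ≤⟨ *-monoʳ (^-nonNeg k (0≤inv v)) l^K*v^k≤1 ⟩
    1ℚ ℚ.* inv v ^ℚ k                           ≡⟨ ℚ.*-identityˡ (inv v ^ℚ k) ⟩
    inv v ^ℚ k                                  ∎
    where
    open ℚ.≤-Reasoning
    l^K*v^k≤1 : l ^ℚ K ℚ.* ι v ^ℚ k ℚ.≤ 1ℚ
    l^K*v^k≤1 = cancel-ι {L = P ℕ.^ K} (1≤m^n K 1≤P) (begin
      l ^ℚ K ℚ.* ι v ^ℚ k ℚ.* ι (P ℕ.^ K)       ≡⟨ cong (l ^ℚ K ℚ.* ι v ^ℚ k ℚ.*_) (ι-^ P K) ⟩
      l ^ℚ K ℚ.* ι v ^ℚ k ℚ.* ι P ^ℚ K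
        ≡⟨ solve 3 (λ a b c → a :* b :* c := b :* (a :* c)) refl (l ^ℚ K) (ι v ^ℚ k) (ι P ^ℚ K) ⟩
      ι v ^ℚ k ℚ.* (l ^ℚ K ℚ.* ι P ^ℚ K)        ≡⟨ cong (ι v ^ℚ k ℚ.*_) (^-distrib-* l (ι P) K) ⟨
      ι v ^ℚ k ℚ.* (l ℚ.* ι P) ^ℚ K
        ≤⟨ *-monoˡ (^-nonNeg k (0≤ι v)) (^-monoˡ K (0≤* 0≤l (0≤ι P)) (ratio-≤ {δ} {l} {P} {E} 0≤l l≤δ δP≤E)) ⟩
      ι v ^ℚ k ℚ.* ι E ^ℚ K                     ≡⟨ cong₂ ℚ._*_ (ι-^ v k) (ι-^ E K) ⟨
      ι (v ℕ.^ k) ℚ.* ι (E ℕ.^ K)               ≡⟨ ι-* (v ℕ.^ k) (E ℕ.^ K) ⟨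
      ι (v ℕ.^ k ℕ.* E ℕ.^ K)                   ≤⟨ ι-mono vE≤P ⟩
      ι (P ℕ.^ K)                               ≡⟨ ℚ.*-identityˡ (ι (P ℕ.^ K)) ⟨
      1ℚ ℚ.* ι (P ℕ.^ K)                        ∎)
      where open ℚ.+-*-Solver
  upper-bound : δ ^ (fromℕ K ÷ fromℕ k) ≤ fromℚ (inv v)
  upper-bound = ^-upper-≤1 {δ} {fromℕ K ÷ fromℕ k} {ι K ℚ.* inv k} {inv v} {K} {k-1} δ≤1 y≥
    (ℚ.≤-reflexive (sym (trans (ℚ.*-assoc (ι K) (inv k) (ι k)) (trans (cong (ι K ℚ.*_) (inv-* {k} (ℕ.s≤s ℕ.z≤n))) (ℚ.*-identityʳ (ι K))))))
    (0≤inv v) power≤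

-- The exponent K - ε is at most K - 1/n = p/n, and (R^b)^p = (2^(4bp))^n, so D^(K-ε) ≤ 2^(4bp). It
-- is applied with `suc b` in place of the exponent of G, since D lies above G.
D-power-lower : ∀ {D ε K n-1 p b} → let n = suc n-1 in 1 ℕ.≤ K → suc p ≡ n ℕ.* K → 1ℝ ≤ D →
                D ≤ fromℚ (ι ((2 ℕ.^ (4 ℕ.* n)) ℕ.^ b)) → fromℚ (inv n) ≤ ε → ε ≤ 1ℝ → fromℚ (½ ^ℚ (b ℕ.* (4 ℕ.* p))) ≤ (D ^ (fromℕ K - ε)) ⁻¹
D-power-lower {D} {ε} {K} {n-1} {p} {b} 1≤K 1+p≡ 1≤D D≤ inv≤ε ε≤1 q =
  ^-positive {D} {z} (ℚ.positive⁻¹ 1ℚ) ℚ.≤-refl 1≤D 0≤z λ (m , 0<m , m≤) →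
    ⁻¹-lower {D ^ z} {m} {ι (2 ℕ.^ e)} {½ ^ℚ e} 0<m m≤ upper-bound (ℚ.≤-reflexive (½^*2^ e)) q
  where
  n e : ℕ
  n = suc n-1
  e = b ℕ.* (4 ℕ.* p)
  z = fromℕ K - ε
  K≥ : fromℚ (ι K) ≤ fromℕ K
  K≥ = ι≤fromℕ K
  K≤ : fromℕ K ≤ fromℚ (ι K)
  K≤ = fromℕ≤ι K
  0≤z : 0ℝ ≤ z
  0≤z = ≤-trans {0ℝ} {fromℚ (ι K ℚ.- 1ℚ)} {z}
    (fromℚ-mono (subst (ℚ._≤ ι K ℚ.- 1ℚ) (ℚ.+-inverseʳ 1ℚ) (ℚ.+-monoˡ-≤ (ℚ.- 1ℚ) (subst (ℚ._≤ ι K) ι1 (ι-mono 1≤K)))))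
    (-‿lower {fromℕ K} {ε} K≥ ε≤1)
  r*n≤p : (ι K ℚ.- inv n) ℚ.* ι n ℚ.≤ ι p
  r*n≤p = ℚ.≤-reflexive (trans (solve 3 (λ a i c → (a :- i) :* c := c :* a :- i :* c) refl (ι K) (inv n) (ι n))
    (trans (cong₂ ℚ._-_ (trans (sym (ι-* n K)) (trans (cong ι (sym 1+p≡)) (trans (ι-+ 1 p) (cong (ℚ._+ ι p) ι1)))) (inv-* {n} (ℕ.s≤s ℕ.z≤n)))
      (solve 1 (λ a → con 1ℚ :+ a :- con 1ℚ := a) refl (ι p))))
    where open ℚ.+-*-Solver
  powers : ((2 ℕ.^ (4 ℕ.* n)) ℕ.^ b) ℕ.^ p ≡ (2 ℕ.^ e) ℕ.^ n
  powers = trans (cong (ℕ._^ p) (ℕ.^-*-assoc 2 (4 ℕ.* n) b)) (trans (ℕ.^-*-assoc 2 (4 ℕ.* n ℕ.* b) p)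
    (trans (cong (2 ℕ.^_) (solve 3 (λ n b p → con 4 :* n :* b :* p := b :* (con 4 :* p) :* n) refl n b p)) (sym (ℕ.^-*-assoc 2 e n))))
    where open ℕ.+-*-Solver
  upper-bound : D ^ z ≤ fromℚ (ι (2 ℕ.^ e))
  upper-bound = ^-upper-≥1 {D} {z} {ι K ℚ.- inv n} {ι (2 ℕ.^ e)} {ι ((2 ℕ.^ (4 ℕ.* n)) ℕ.^ b)} {p} {n-1}
    (-‿upper {fromℕ K} {ε} K≤ inv≤ε) r*n≤p D≤
    (subst (ℚ._≤ ι ((2 ℕ.^ (4 ℕ.* n)) ℕ.^ b)) ι1 (ι-mono (1≤m^n b (1≤2^ (4 ℕ.* n))))) (0≤ι (2 ℕ.^ e))
    (ℚ.≤-reflexive (trans (sym (ι-^ ((2 ℕ.^ (4 ℕ.* n)) ℕ.^ b) p)) (trans (cong ι powers) (ι-^ (2 ℕ.^ e) n))))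

product-lower : ∀ {k} {X : Fin k → ℝ} {Y Z} N {C v e P} → (∀ i → fromℚ (ι (N i) ℚ.* ½) ≤ X i) →
                fromℚ (ι v) ≤ Y → fromℚ (½ ^ℚ e) ≤ Z → 2 ℕ.^ k ℕ.* 2 ℕ.^ e ℕ.* P ℕ.≤ C ℕ.* Π N ℕ.* v →
                fromℕ P ≤ fromℕ C * Y * (∏ X * Z)
product-lower {k} {X} {Y} {Z} N {C} {v} {e} {P} N½≤X v≤Y ½≤Z natural =
  ≤-trans {fromℕ P} {fromℚ low} {fromℕ C * Y * (∏ X * Z)} (subst (_≤ fromℚ low) (sym (fromℕ≡ P)) (fromℚ-mono P≤low))
    (*-lower {fromℕ C * Y} {∏ X * Z} {ι C ℚ.* ι v}
      (0≤* (0≤ι C) (0≤ι v)) (0≤* 0≤M½ (^-nonNeg e 0≤½))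
      (*-lower {fromℕ C} {Y} (0≤ι C) (0≤ι v) (ι≤fromℕ C) v≤Y)
      (*-lower {∏ X} {Z} 0≤M½ (^-nonNeg e 0≤½) (∏-lower X N ½ 0≤½ N½≤X) ½≤Z))
  where
  low = ι C ℚ.* ι v ℚ.* (ι (Π N) ℚ.* ½ ^ℚ k ℚ.* ½ ^ℚ e)
  0≤M½ : 0ℚ ℚ.≤ ι (Π N) ℚ.* ½ ^ℚ k
  0≤M½ = 0≤* (0≤ι (Π N)) (^-nonNeg k 0≤½)
  P≤low : ι P ℚ.≤ low
  P≤low = cancel-ι {L = 2 ℕ.^ k ℕ.* 2 ℕ.^ e} (1≤m*n (1≤2^ k) (1≤2^ e)) (begin
    ι P ℚ.* ι (2 ℕ.^ k ℕ.* 2 ℕ.^ e)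
      ≡⟨ trans (ℚ.*-comm (ι P) (ι (2 ℕ.^ k ℕ.* 2 ℕ.^ e))) (sym (ι-* (2 ℕ.^ k ℕ.* 2 ℕ.^ e) P)) ⟩
    ι (2 ℕ.^ k ℕ.* 2 ℕ.^ e ℕ.* P)           ≤⟨ ι-mono natural ⟩
    ι (C ℕ.* Π N ℕ.* v)                     ≡⟨ trans (ι-* (C ℕ.* Π N) v) (cong (ℚ._* ι v) (ι-* C (Π N))) ⟩
    ι C ℚ.* ι (Π N) ℚ.* ι v                 ≡⟨ ℚ.*-identityʳ (ι C ℚ.* ι (Π N) ℚ.* ι v) ⟨
    ι C ℚ.* ι (Π N) ℚ.* ι v ℚ.* (1ℚ ℚ.* 1ℚ)
      ≡⟨ cong (ι C ℚ.* ι (Π N) ℚ.* ι v ℚ.*_) (cong₂ ℚ._*_ (½^*2^ k) (½^*2^ e)) ⟨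
    ι C ℚ.* ι (Π N) ℚ.* ι v ℚ.* (½ ^ℚ k ℚ.* ι (2 ℕ.^ k) ℚ.* (½ ^ℚ e ℚ.* ι (2 ℕ.^ e)))
      ≡⟨ rearrange (ι C) (ι (Π N)) (ι v) (½ ^ℚ k) (ι (2 ℕ.^ k)) (½ ^ℚ e) (ι (2 ℕ.^ e)) ⟩
    low ℚ.* (ι (2 ℕ.^ k) ℚ.* ι (2 ℕ.^ e))   ≡⟨ cong (low ℚ.*_) (ι-* (2 ℕ.^ k) (2 ℕ.^ e)) ⟨
    low ℚ.* ι (2 ℕ.^ k ℕ.* 2 ℕ.^ e)         ∎)
    where
    open ℚ.≤-Reasoning
    rearrange : ∀ c M v h K g e → c ℚ.* M ℚ.* v ℚ.* (h ℚ.* K ℚ.* (g ℚ.* e)) ≡ c ℚ.* v ℚ.* (M ℚ.* h ℚ.* g) ℚ.* (K ℚ.* e)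
    rearrange = solve 7 (λ c M v h K g e → c :* M :* v :* (h :* K :* (g :* e)) := c :* v :* (M :* h :* g) :* (K :* e)) refl
      where open ℚ.+-*-Solver

-- The bound over the reals

module Main (k-1 n-1 p : ℕ) (1+p≡ : suc p ≡ suc n-1 ℕ.* suc (suc k-1))
            {ε : ℝ} (inv≤ε : fromℚ (inv (suc n-1)) ≤ ε) (ε≤1 : ε ≤ 1ℝ) where

  k n : ℕ
  k = suc k-1
  n = suc n-1

  open Scale n k p 1+p≡ using (R; 2≤R; constant; finite-bound)

  -- In `Q`, the factor 2^(k+1) pays for N i ≤ 2 X i, and 2^(4p) for bounding D by R^(b+1) while the
  -- common divisors are only known to be at least R^b.
  Q C₀ : ℕ
  Q  = 2 ℕ.^ suc k ℕ.* 2 ℕ.^ (4 ℕ.* p)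
  C₀ = Q ℕ.* (2 ℕ.* (constant ℕ.* constant))

  0<C₀ : 0ℝ < fromℕ C₀
  0<C₀ = 0ℚ , ℚ.<-irrefl refl , subst (0ℚ ℚ.<_) (ι-def C₀)
    (ℚ.<-≤-trans (subst (0ℚ ℚ.<_) (sym ι1) (ℚ.positive⁻¹ 1ℚ)) (ι-mono (1≤m*n (1≤m*n (1≤2^ (suc k)) (1≤2^ (4 ℕ.* p))) (ℕ.s≤s ℕ.z≤n))))

  module _ (X : Fin (suc k) → ℝ) (D : ℝ) (1≤X : ∀ i → 1ℝ ≤ X i) (1≤D : 1ℝ ≤ D)
           (δ : ℝ) (0<δ : 0ℝ < δ) (δ≤1 : δ ≤ 1ℝ)
           (A : Fin (suc k) → List ℤ) (unique : ∀ i → Unique (A i))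
           (A⊂ : ∀ i {a} → a ∈ A i → fromℤ a ∈[ X i , fromℕ 2 * X i ])
           (T : List (Vec ℤ (suc k))) (uniqueT : Unique T)
           (T∈ : All (λ t → (∀ i → lookup t i ∈ A i) × D ≤ fromℤ (gcdᵥ t)) T)
           (δP≤E : δ * fromℕ (∏card A) ≤ fromℕ (length T)) where

    P E : ℕ
    P = ∏card A
    E = length T

    rhs : ℝ
    rhs = fromℕ C₀ * (δ ^ (fromℕ (suc k) ÷ fromℕ k)) ⁻¹ * (∏ X ÷ D ^ (fromℕ (suc k) - ε))

    -- This settles the case P = 0, in which some `A i` is empty and has no maximum.
    0≤rhs : fromℚ 0ℚ ≤ rhs
    0≤rhs = *-lower {fromℕ C₀ * (δ ^ (fromℕ (suc k) ÷ fromℕ k)) ⁻¹} {∏ X ÷ D ^ (fromℕ (suc k) - ε)} {0ℚ} {0ℚ} ℚ.≤-refl ℚ.≤-refl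
      (*-lower {fromℕ C₀} {(δ ^ (fromℕ (suc k) ÷ fromℕ k)) ⁻¹} {0ℚ} {0ℚ} ℚ.≤-refl ℚ.≤-refl
        (0≤fromℕ C₀) (⁻¹-nonNeg {δ ^ (fromℕ (suc k) ÷ fromℕ k)}))
      (*-lower {∏ X} {(D ^ (fromℕ (suc k) - ε)) ⁻¹} {0ℚ} {0ℚ} ℚ.≤-refl ℚ.≤-refl 0≤∏X (⁻¹-nonNeg {D ^ (fromℕ (suc k) - ε)}))
      where
      0≤∏X : fromℚ 0ℚ ≤ ∏ X
      0≤∏X = ≤-trans {fromℚ 0ℚ} {fromℚ (ι (Π {suc k} (λ _ → 0)) ℚ.* ½ ^ℚ suc k)} {∏ X}
        (fromℚ-mono (0≤* (0≤ι (Π {suc k} (λ _ → 0))) (^-nonNeg (suc k) 0≤½)))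
        (∏-lower X (λ _ → 0) ½ 0≤½ (λ i →
          subst (λ t → fromℚ t ≤ X i) (sym (trans (cong (ℚ._* ½) ι0) (ℚ.*-zeroˡ ½))) (1≤⇒0≤ {X i} (1≤X i))))

    positive : ∀ i {a} → a ∈ A i → a ≡ + ℤ.∣ a ∣ × 1 ℕ.≤ ℤ.∣ a ∣
    positive i {a} a∈ = fromℕ≤fromℤ a (≤-trans {1ℝ} {X i} {fromℤ a} (1≤X i) (proj₁ (A⊂ i a∈)))

    ∣A∣ : Fin (suc k) → List ℕ
    ∣A∣ i = map ℤ.∣_∣ (A i)

    ∣A∣-unique : ∀ i → Unique (∣A∣ i)
    ∣A∣-unique i = Unique-map⁺ ℤ.∣_∣ +_ (λ a∈ → sym (proj₁ (positive i a∈))) (unique i)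

    ∣T∣ : List (Vec ℕ (suc k))
    ∣T∣ = map (Vec.map ℤ.∣_∣) T

    ∣T∣-unique : Unique ∣T∣
    ∣T∣-unique = Unique-map⁺ (Vec.map ℤ.∣_∣) (Vec.map +_)
      (λ {t} t∈ → abs-retract t (λ i → proj₁ (positive i (proj₁ (All.lookup T∈ t∈) i)))) uniqueT

    ∣T∣⊆∣A∣ : ∀ {t} → t ∈ ∣T∣ → ∀ i → lookup t i ∈ ∣A∣ i
    ∣T∣⊆∣A∣ t∈ i with t , t∈T , refl ← ∈-map⁻ (Vec.map ℤ.∣_∣) t∈ =
      subst (_∈ ∣A∣ i) (sym (lookup-map i ℤ.∣_∣ t)) (∈-map⁺ ℤ.∣_∣ (proj₁ (All.lookup T∈ t∈T) i))

    E≤P : E ℕ.≤ P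
    E≤P = subst (E ℕ.≤_) (length-prodList A)
      (length-⊆ uniqueT (λ {t} t∈ → ∈-prodList A t (proj₁ (All.lookup T∈ t∈))))

    module _ (1≤P : 1 ℕ.≤ P) where

      1≤E : 1 ℕ.≤ E
      1≤E = ℕ.n≢0⇒n>0 λ E≡0 →
        let l , 0<l , l≤δ = positive-below {δ} 0<δ
            l≤lP : l ℚ.≤ l ℚ.* ι P
            l≤lP = subst (ℚ._≤ l ℚ.* ι P) (ℚ.*-identityʳ l) (*-monoˡ (ℚ.<⇒≤ 0<l) (subst (ℚ._≤ ι P) ι1 (ι-mono 1≤P)))
            lP≤0 : l ℚ.* ι P ℚ.≤ 0ℚ
            lP≤0 = subst (l ℚ.* ι P ℚ.≤_) (trans (cong ι E≡0) ι0) (ratio-≤ {δ} {l} {P} {E} (ℚ.<⇒≤ 0<l) l≤δ δP≤E)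
        in ℚ.<-irrefl refl (ℚ.<-≤-trans 0<l (ℚ.≤-trans l≤lP lP≤0))

      1≤∣A∣ : ∀ i → 1 ℕ.≤ length (∣A∣ i)
      1≤∣A∣ i = subst (1 ℕ.≤_) (sym (length-map ℤ.∣_∣ (A i))) (1≤Π⁻ {x = length ∘ A} 1≤P i)

      N : Fin (suc k) → ℕ
      N i = proj₁ (maximum (∣A∣ i) (1≤∣A∣ i))

      bounds : ∀ i {a} → a ∈ ∣A∣ i → 1 ℕ.≤ a × a ℕ.≤ N i
      bounds i a∈ = 1≤a a∈ , proj₂ (proj₂ (maximum (∣A∣ i) (1≤∣A∣ i))) a∈
        where
        1≤a : ∀ {a} → a ∈ ∣A∣ i → 1 ℕ.≤ a
        1≤a a∈ with a , a∈A , refl ← ∈-map⁻ ℤ.∣_∣ a∈ = proj₂ (positive i a∈A)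

      -- A violation gives a rational q with X i ≤ q < N i / 2. Then N i ≤ 2 X i ≤ 2 q, a
      -- contradiction reached in ℚ.
      N½≤X : ∀ i → fromℚ (ι (N i) ℚ.* ½) ≤ X i
      N½≤X i (q , ¬Xq , q<) = ℚ.<-irrefl refl (ℚ.<-≤-trans q< (subst (ι (N i) ℚ.* ½ ℚ.≤_) half (*-monoʳ 0≤½ N≤2q)))
        where
        N≤2X : fromℕ (N i) ≤ fromℕ 2 * X i
        N≤2X with a , a∈A , N≡ ← ∈-map⁻ ℤ.∣_∣ (proj₁ (proj₂ (maximum (∣A∣ i) (1≤∣A∣ i)))) =
          subst (λ j → fromℤ j ≤ fromℕ 2 * X i) (trans (proj₁ (positive i a∈A)) (cong +_ (sym N≡))) (proj₂ (A⊂ i a∈A))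
        N≤2q : ι (N i) ℚ.≤ ι 2 ℚ.* q
        N≤2q = fromℚ-cancel (subst (_≤ fromℚ (ι 2 ℚ.* q)) (fromℕ≡ (N i))
          (≤-trans {fromℕ (N i)} {fromℕ 2 * X i} {fromℚ (ι 2 ℚ.* q)} N≤2X
          (*-upper {fromℕ 2} {X i} (0≤fromℕ 2) (1≤⇒0≤ {X i} (1≤X i)) (fromℕ≤ι 2) (above⇒≥ (X i) ¬Xq))))
        half : ι 2 ℚ.* q ℚ.* ½ ≡ q
        half = trans (solve 3 (λ a b c → a :* b :* c := b :* (a :* c)) refl (ι 2) q ½)
          (trans (cong (q ℚ.*_) (cong (ℚ._* ½) (ι-def 2))) (ℚ.*-identityʳ q))
          where open ℚ.+-*-Solver

      bound : ∀ b → fromℕ (R ℕ.^ b) ≤ D → D ≤ fromℕ (R ℕ.^ suc b) → fromℕ P ≤ rhs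
      bound b R^b≤D D≤ = product-lower {X = X} {(δ ^ (fromℕ (suc k) ÷ fromℕ k)) ⁻¹} {(D ^ (fromℕ (suc k) - ε)) ⁻¹}
        N {C₀} {v} {suc b ℕ.* (4 ℕ.* p)} {P} N½≤X
        (δ-power-lower {δ} {k-1} {E} {P} {v} 0<δ δ≤1 1≤P 1≤v δP≤E vE≤P)
        (D-power-lower {D} {ε} {suc k} {n-1} {p} {suc b} (ℕ.s≤s ℕ.z≤n) 1+p≡ 1≤D
          (subst (D ≤_) (fromℕ≡ (R ℕ.^ suc b)) D≤) inv≤ε ε≤1)
        natural
        where
        root = integer-root {k} {E} {P} (ℕ.s≤s ℕ.z≤n) 1≤E E≤P
        v = proj₁ root
        1≤v = proj₁ (proj₂ root)
        vE≤P = proj₁ (proj₂ (proj₂ root))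
        P≤vE = proj₂ (proj₂ (proj₂ root))
        e = suc b ℕ.* (4 ℕ.* p)

        common : ∀ {t} → t ∈ ∣T∣ → ∃ λ d → R ℕ.^ b ℕ.≤ d × (∀ i → d ∣ lookup t i)
        common t∈ with t , t∈T , refl ← ∈-map⁻ (Vec.map ℤ.∣_∣) t∈ = ℤ.∣ gcdᵥ t ∣
          , proj₂ (fromℕ≤fromℤ (gcdᵥ t) (≤-trans {fromℕ (R ℕ.^ b)} {D} {fromℤ (gcdᵥ t)} R^b≤D (proj₂ (All.lookup T∈ t∈T))))
          , λ i → subst (ℤ.∣ gcdᵥ t ∣ ∣_) (sym (lookup-map i ℤ.∣_∣ t)) (gcdᵥ-∣ t i)

        Π≡P : Π (length ∘ ∣A∣) ≡ P
        Π≡P = Π-cong (λ i → length-map ℤ.∣_∣ (A i))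

        -- As e belongs to `suc b`, 2^e = 2^(4p) (2^b)^(4p). The first factor is part of `Q`, the
        -- second is the power in `finite-bound`.
        natural : 2 ℕ.^ suc k ℕ.* 2 ℕ.^ e ℕ.* P ℕ.≤ C₀ ℕ.* Π N ℕ.* v
        natural = subst (ℕ._≤ C₀ ℕ.* Π N ℕ.* v)
          (trans (cong (λ t → Q ℕ.* t ℕ.* (2 ℕ.^ b) ℕ.^ (4 ℕ.* p)) Π≡P) (trans
            (rearrange (2 ℕ.^ suc k) (2 ℕ.^ (4 ℕ.* p)) P ((2 ℕ.^ b) ℕ.^ (4 ℕ.* p)))
            (cong (λ t → 2 ℕ.^ suc k ℕ.* t ℕ.* P) (trans (cong (2 ℕ.^ (4 ℕ.* p) ℕ.*_) (ℕ.^-*-assoc 2 b (4 ℕ.* p)))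
              (sym (ℕ.^-distribˡ-+-* 2 (4 ℕ.* p) (b ℕ.* (4 ℕ.* p))))))))
          (finite-bound b (ℕ.s≤s ℕ.z≤n) ∣A∣ N ∣A∣-unique bounds ∣T∣ ∣T∣-unique ∣T∣⊆∣A∣ common 1≤∣A∣
            (subst (1 ℕ.≤_) (sym ∣∣T∣∣≡E) 1≤E) {v} 1≤v
            (subst₂ ℕ._≤_ (cong (ℕ._^ suc k) (sym Π≡P))
              (cong (λ t → suc v ℕ.^ k ℕ.* t ℕ.^ suc k) (sym ∣∣T∣∣≡E)) P≤vE) Q)
          where
          rearrange : ∀ a b c d → a ℕ.* b ℕ.* c ℕ.* d ≡ a ℕ.* (b ℕ.* d) ℕ.* c
          rearrange = solve 4 (λ a b c d → a :* b :* c :* d := a :* (b :* d) :* c) refl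
            where open ℕ.+-*-Solver
          ∣∣T∣∣≡E : length ∣T∣ ≡ E
          ∣∣T∣∣≡E = length-map (Vec.map ℤ.∣_∣) T

      nonempty : fromℕ P ≤ rhs
      nonempty below = upper D λ (u , D≤u) → let M , u≤M = archimedean u in
        -- The predicate holds at 0 because R^0 = 1 ≤ D. It fails at M + 1 because R^(M+1) > M + 1 >
        -- M ≥ u ≥ D.
        ¬¬-crossing {λ b → fromℕ (R ℕ.^ b) ≤ D} (suc M) 1≤D
          (λ h → ℕ.<⇒≱ (n<m^n (suc M) 2≤R) (ℕ.m≤n⇒m≤1+n (ι-cancel (subst₂ ℚ._≤_ refl (sym (ι-def M)) (ℚ.≤-trans
            (≤-via D (subst (_≤ D) (fromℕ≡ (R ℕ.^ suc M)) h) D≤u) u≤M)))))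
          λ (b , R^b≤D , ¬R^1+b≤D) → bound b R^b≤D (λ fr<D → ¬R^1+b≤D (<⇒≤ {fromℕ (R ℕ.^ suc b)} {D} fr<D)) below

    main : Dec (1 ℕ.≤ P) → fromℕ P ≤ rhs
    main (yes 1≤P) = nonempty 1≤P
    main (no  1≰P) = subst (λ P → fromℕ P ≤ rhs) (sym (ℕ.n<1⇒n≡0 (ℕ.≰⇒> 1≰P))) 0≤rhs

theorem1p3 : (k : ℕ) → 2 ℕ.≤ k → (ε : ℝ) → 0ℝ < ε → ε < 1ℝ →
    ∃ λ (C : ℝ) → 0ℝ < C ×
    ((X : Fin k → ℝ) (D : ℝ) → (∀ i → 1ℝ ≤ X i) → 1ℝ ≤ D → (∀ i → D ≤ X i) →
    (δ : ℝ) → 0ℝ < δ → δ ≤ 1ℝ →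
    (A : Fin k → List ℤ) → (∀ i → Unique (A i)) →
    (∀ i {a} → a ∈ A i → fromℤ a ∈[ X i , fromℕ 2 * X i ]) →
    AtLeast (δ * fromℕ (∏card A)) (λ (t : Vec ℤ k) → (∀ i → lookup t i ∈ A i) × D ≤ fromℤ (gcdᵥ t)) →
    fromℕ (∏card A) ≤ C * (δ ^ (fromℕ k ÷ fromℕ (k ℕ.∸ 1))) ⁻¹ * (∏ X ÷ D ^ (fromℕ k - ε)))
theorem1p3 (suc zero) (ℕ.s≤s ()) ε 0<ε ε<1
theorem1p3 (suc (suc k-1)) _ ε 0<ε ε<1 =
  let q , 0<q , q≤ε = positive-below {ε} 0<ε
      n-1 , inv≤q   = 0<⇒inv≤ 0<q
      -- This p is n K - 1 with K = `suc (suc k-1)`, written so that `suc p` unfolds to the product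
      -- and `refl` proves the equation.
      module M = Main k-1 n-1 (suc k-1 ℕ.+ n-1 ℕ.* suc (suc k-1)) refl {ε}
        (≤-trans {fromℚ (inv (suc n-1))} {fromℚ q} {ε} (fromℚ-mono inv≤q) q≤ε)
        (<⇒≤ {ε} {1ℝ} ε<1)
  in fromℕ M.C₀ , M.0<C₀ , λ X D 1≤X 1≤D _ δ 0<δ δ≤1 A unique A⊂ (T , uniqueT , T∈ , δP≤E) →
       M.main X D 1≤X 1≤D δ 0<δ δ≤1 A unique A⊂ T uniqueT T∈ δP≤E (1 ℕ.≤? ∏card A)
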